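{- Let $\gamma=(B,m,\sigma)$ be a fully mutated mutation sequence. Then, as an identity of rational functions in $y=(y_1,\dots,y_n)$, $$\det(I_n - K_\gamma(y)) = \det\bigl(A_+ Z_-(y) + A_- Z_+(y)\bigr).$$
   Context: Fix a positive integer $n$. Write $[x]_+=\max(0,x)$. An $n\times n$ integer matrix $B$ is skew-symmetrizable if there are positive integers $d_1,\dots,d_n$ with $d_iB_{ij}=-d_jB_{ji}$. Let $\mathcal F_{\mathrm{sf}}$ be the set of rational functions $f/g$ in $y_1,\dots,y_n$ with $f,g\in\mathbb Q[y_1,\dots,y_n]$ nonzero polynomials with non-negative coefficients. A Y-seed is a pair $(B,Y)$ with $B$ an $n\times n$ skew-symmetrizable integer matrix and $Y=(Y_1,\dots,Y_n)\in\mathcal F_{\mathrm{sf}}^n$. For $k\in\{1,\dots,n\}$ the Y-seed mutation is $\mu_k(B,Y)=(\widetilde B,\widetilde Y)$ where: $\widetilde B_{ij}=-B_{ij}$ if $i=k$ or $j=k$; otherwise $\widetilde B_{ij}=B_{ij}+B_{ik}B_{kj}$ if $B_{ik}>0$ and $B_{kj}>0$, $\widetilde B_{ij}=B_{ij}-B_{ik}B_{kj}$ if $B_{ik}<0$ and $B_{kj}<0$, and $\widetilde B_{ij}=B_{ij}$ in the remaining cases; and $\widetilde Y_k=Y_k^{ -1}$, while for $i\neq k$, $\widetilde Y_i=Y_i(Y_k^{ -1}+1)^{ -B_{ki}}$ if $B_{ki}\ge 0$ and $\widetilde Y_i=Y_i(Y_k+1)^{ -B_{ki}}$ if $B_{ki}\le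 0$. A permutation $\sigma$ of $\{1,\dots,n\}$ acts by $\sigma(B,Y)=(\sigma(B),\sigma(Y))$, $\sigma(B)_{ij}=B_{\sigma^{ -1}(i)\sigma^{ -1}(j)}$, $\sigma(Y)_i=Y_{\sigma^{ -1}(i)}$. A mutation sequence (of length $T\ge 1$) is a triple $\gamma=(B,m,\sigma)$ with $B$ an $n\times n$ skew-symmetrizable integer matrix, $m=(m_1,\dots,m_T)$ a sequence in $\{1,\dots,n\}$ and $\sigma=(\sigma_1,\dots,\sigma_T)$ a sequence of permutations of $\{1,\dots,n\}$. Put $(B(0),Y(0))=(B,(y_1,\dots,y_n))$ and $(B(t),Y(t))=\sigma_t(\mu_{m_t}(B(t-1),Y(t-1)))$ for $t=1,\dots,T$. The cluster transformation of $\gamma$ is $\mu_\gamma(y)=Y(T)$, with components $\mu_1(y),\dots,\mu_n(y)$. Mutation network. Let $\overline{\mathcal E}=\{(i,t)\mid 1\le i\le n,\ 0\le t\le T\}$ and let $\sim$ be the equivalence relation on $\overline{\mathcal E}$ generated by $(i,t-1)\sim(\sigma_t(i),t)$ for $1\le t\le T$ and $i\ne m_t$, and $(i,T)\sim(i,0)$ for all $i$. Put $\mathcal E=\overline{\mathcal E}/\sim$. The mutation network $\mathcal N_\gamma$ is the graph with black vertices labeled by $\mathcal E$, square vertices labeled by $1,\dots,T$, and for each $t$ the following edges (all kept with multiplicity, without cancelling opposite arrows): one broken edge between $t$ and $[(m_t,t-1)]$ and one broken edge between $t$ and $[(\sigma_t(m_t),t)]$; and, for each $i$, $[B_{m_t,i}(t-1)]_+$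 arrows from $t$ to $[(i,t-1)]$ and $[-B_{m_t,i}(t-1)]_+$ arrows from $[(i,t-1)]$ to $t$. For $e\in\mathcal E$ and $1\le t\le T$ let $n^0_{et}$ be the number of broken edges between $e$ and $t$, $n^+_{et}$ the number of arrows from $t$ to $e$, $n^-_{et}$ the number of arrows from $e$ to $t$; let $N_0,N_+,N_-$ be the corresponding $\mathcal E\times T$ matrices. The Neumann-Zagier matrices are $A_+=N_0-N_+$ and $A_-=N_0-N_-$. $\gamma$ is fully mutated if for every $e\in\mathcal E$ there is $t\in\{1,\dots,T\}$ with $(m_t,t-1)\in e$. In that case $t\mapsto[(m_t,t-1)]$ is a bijection $\{1,\dots,T\}\to\mathcal E$, and $\mathcal E\times T$ matrices such as $A_\pm$ are regarded as $T\times T$ matrices through it. Let $J_\gamma(y)=(\partial\mu_i/\partial y_j)_{1\le i,j\le n}$ and $K_\gamma(y)=\mathrm{diag}(\mu_1(y),\dots,\mu_n(y))^{ -1}J_\gamma(y)\,\mathrm{diag}(y_1,\dots,y_n)$. For $1\le t\le T$ let $z_{t,+}=\frac{Y_{m_t}(t-1)}{Y_{m_t}(t-1)+1}$ and $z_{t,- }=\frac{1}{Y_{m_t}(t-1)+1}$, and let $Z_\pm(y)=\mathrm{diag}(z_{1,\pm},\dots,z_{T,\pm})$. $I_n$ is the identity matrix. -}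

module Defs where

open import Algebra.Bundles using (CommutativeRing; RawRing)
import Algebra.Definitions.RawSemiring as RawSemiringDefinitions
import Algebra.Properties.CommutativeSemigroup as CommutativeSemigroupProperties
import Algebra.Properties.Ring as RingProperties
open import Data.Bool.Base using (true; false; if_then_else_; _∧_; _∨_)
open import Data.Empty using (⊥-elim)
open import Data.Fin.Base using (Fin; zero; suc; toℕ; fromℕ; inject₁; punchIn)
import Data.Fin.Properties as Fin
open import Data.Fin.Permutation using (Permutation′; _⟨$⟩ʳ_; _⟨$⟩ˡ_)
open import Data.Integer.Base as ℤ using (ℤ; +_; -[1+_]; 0ℤ)
import Data.Integer.Properties as ℤ
open import Data.Integer.Tactic.RingSolver using (solve-∀)
open import Data.List.Base as List using (List; []; _∷_)
open import Data.List.Membership.Propositional using (_∈_)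
open import Data.List.Membership.Propositional.Properties
  using (∈-++⁺ˡ; ∈-++⁺ʳ; ∈-++⁻; ∈-map⁺; ∈-map⁻; ∈-allFin; ∈-cartesianProductWith⁺; ∈-cartesianProductWith⁻)
open import Data.List.Relation.Unary.All as All using (All; []; _∷_)
open import Data.List.Relation.Unary.Any using (here; there)
open import Data.Nat.Base as ℕ using (ℕ; zero; suc)
open import Data.Product.Base using (Σ-syntax; ∃-syntax; _×_; _,_; proj₁; proj₂)
import Data.Product.Properties as Product
open import Data.Rational.Base as ℚ using (ℚ; 0ℚ; 1ℚ)
import Data.Rational.Properties as ℚ
open import Data.Sum.Base using (_⊎_; inj₁; inj₂; [_,_]′)
open import Function.Bundles using (mk⇔)
open import Level using (0ℓ)
open import Relation.Binary.Bundles using (Setoid)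
open import Relation.Binary.Core using (Rel)
open import Relation.Binary.Definitions using (Decidable; DecidableEquality)
open import Relation.Binary.Structures using (IsEquivalence)
import Relation.Binary.Construct.Closure.Equivalence as Eq
open Eq using (EqClosure)
open import Relation.Binary.PropositionalEquality using (_≡_; _≢_; refl; sym; trans; cong; cong₂; subst; module ≡-Reasoning; isEquivalence)
import Relation.Binary.Reasoning.Setoid as SetoidReasoning
open import Relation.Nullary using (¬_; Dec; yes; no; does)
open import Relation.Nullary.Decidable using (map′; _⊎-dec_; _×-dec_; dec-false; does-⇔)

------------------------------------------------------------------------
-- Polynomials

record DecidableDomain : Set₁ where
  field
    commutativeRing : CommutativeRing 0ℓ 0ℓ
  open CommutativeRing commutativeRing
  field
    ≈0?     : ∀ x → Dec (x ≈ 0#)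
    x*y≈0⇒  : ∀ x y → x * y ≈ 0# → x ≈ 0# ⊎ y ≈ 0#
    1≉0     : ¬ 1# ≈ 0#

-- Univariate polynomials over D: the list a₀ ∷ a₁ ∷ … stands for
-- a₀ + a₁ X + …, and equality ignores trailing zeros.

module Univariate (D : DecidableDomain) where

  open DecidableDomain D
  open CommutativeRing commutativeRing
    renaming (refl to ≈-refl; sym to ≈-sym; trans to ≈-trans)
  open CommutativeSemigroupProperties +-commutativeSemigroup using (interchange)
  open RingProperties ring using (-0#≈0#)

  infixl 7 _⊛_ _·_
  infixl 6 _⊕_
  infix  4 _≋_

  coeff : List Carrier → ℕ → Carrier
  coeff []      _       = 0#
  coeff (a ∷ p) zero    = a
  coeff (a ∷ p) (suc k) = coeff p k

  record _≋_ (p q : List Carrier) : Set where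
    constructor eq
    field at : ∀ k → coeff p k ≈ coeff q k
  open _≋_ public

  _⊕_ : List Carrier → List Carrier → List Carrier
  []      ⊕ q       = q
  (a ∷ p) ⊕ []      = a ∷ p
  (a ∷ p) ⊕ (b ∷ q) = (a + b) ∷ (p ⊕ q)

  _·_ : Carrier → List Carrier → List Carrier
  a · p = List.map (a *_) p

  ⊖_ : List Carrier → List Carrier
  ⊖ p = List.map (-_) p

  _⊛_ : List Carrier → List Carrier → List Carrier
  []      ⊛ q = []
  (a ∷ p) ⊛ q = a · q ⊕ (0# ∷ p ⊛ q)

  -- (a + X p)′ = p + X p′
  derivative : List Carrier → List Carrier
  derivative []      = []
  derivative (a ∷ p) = p ⊕ (0# ∷ derivative p)

  ≋-isEquivalence : IsEquivalence _≋_
  ≋-isEquivalence = record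
    { refl  = eq λ _ → ≈-refl
    ; sym   = λ p≋q → eq λ k → ≈-sym (at p≋q k)
    ; trans = λ p≋q q≋r → eq λ k → ≈-trans (at p≋q k) (at q≋r k)
    }

  ≋-setoid : Setoid 0ℓ 0ℓ
  ≋-setoid = record { isEquivalence = ≋-isEquivalence }

  open Setoid ≋-setoid public using () renaming (refl to ≋-refl; sym to ≋-sym; trans to ≋-trans)
  private
    module R = SetoidReasoning ≋-setoid

  coeff-⊕ : ∀ p q k → coeff (p ⊕ q) k ≈ coeff p k + coeff q k
  coeff-⊕ []      q       k       = ≈-sym (+-identityˡ _)
  coeff-⊕ (a ∷ p) []      k       = ≈-sym (+-identityʳ _)
  coeff-⊕ (a ∷ p) (b ∷ q) zero    = ≈-refl
  coeff-⊕ (a ∷ p) (b ∷ q) (suc k) = coeff-⊕ p q k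

  coeff-· : ∀ a p k → coeff (a · p) k ≈ a * coeff p k
  coeff-· a []      k       = ≈-sym (zeroʳ a)
  coeff-· a (b ∷ p) zero    = ≈-refl
  coeff-· a (b ∷ p) (suc k) = coeff-· a p k

  coeff-⊖ : ∀ p k → coeff (⊖ p) k ≈ - coeff p k
  coeff-⊖ []      k       = ≈-sym -0#≈0#
  coeff-⊖ (a ∷ p) zero    = ≈-refl
  coeff-⊖ (a ∷ p) (suc k) = coeff-⊖ p k

  ∷-cong : ∀ {a b p q} → a ≈ b → p ≋ q → a ∷ p ≋ b ∷ q
  ∷-cong a≈b p≋q = eq λ { zero → a≈b ; (suc k) → at p≋q k }

  ∷-injective : ∀ {a b p q} → a ∷ p ≋ b ∷ q → a ≈ b × p ≋ q
  ∷-injective e = at e 0 , eq λ k → at e (suc k)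

  ∷-zero : ∀ {a p} → a ≈ 0# → p ≋ [] → a ∷ p ≋ []
  ∷-zero a≈0 p≋0 = eq λ { zero → a≈0 ; (suc k) → at p≋0 k }

  ∷-zero⁻ : ∀ {a p} → a ∷ p ≋ [] → a ≈ 0# × p ≋ []
  ∷-zero⁻ e = at e 0 , eq λ k → at e (suc k)

  ⊕-cong : ∀ {p p′ q q′} → p ≋ p′ → q ≋ q′ → p ⊕ q ≋ p′ ⊕ q′
  ⊕-cong {p} {p′} {q} {q′} e f = eq λ k →
    ≈-trans (coeff-⊕ p q k) (≈-trans (+-cong (at e k) (at f k)) (≈-sym (coeff-⊕ p′ q′ k)))

  ⊕-assoc : ∀ p q r → (p ⊕ q) ⊕ r ≋ p ⊕ (q ⊕ r)
  ⊕-assoc p q r = eq λ k →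
    ≈-trans (coeff-⊕ (p ⊕ q) r k) (≈-trans (+-cong (coeff-⊕ p q k) ≈-refl)
      (≈-trans (+-assoc _ _ _)
        (≈-sym (≈-trans (coeff-⊕ p (q ⊕ r) k) (+-cong ≈-refl (coeff-⊕ q r k))))))

  ⊕-comm : ∀ p q → p ⊕ q ≋ q ⊕ p
  ⊕-comm p q = eq λ k →
    ≈-trans (coeff-⊕ p q k) (≈-trans (+-comm _ _) (≈-sym (coeff-⊕ q p k)))

  ⊕-identityʳ : ∀ p → p ⊕ [] ≋ p
  ⊕-identityʳ p = ⊕-comm p []

  ⊕-interchange : ∀ p q r s → (p ⊕ q) ⊕ (r ⊕ s) ≋ (p ⊕ r) ⊕ (q ⊕ s)
  ⊕-interchange p q r s = eq λ k →
    ≈-trans (expand p q r s k) (≈-trans (interchange _ _ _ _) (≈-sym (expand p r q s k)))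
    where
    expand : ∀ p q r s k →
      coeff ((p ⊕ q) ⊕ (r ⊕ s)) k ≈ (coeff p k + coeff q k) + (coeff r k + coeff s k)
    expand p q r s k = ≈-trans (coeff-⊕ (p ⊕ q) (r ⊕ s) k) (+-cong (coeff-⊕ p q k) (coeff-⊕ r s k))

  ⊕-swap : ∀ p q r → p ⊕ (q ⊕ r) ≋ q ⊕ (p ⊕ r)
  ⊕-swap p q r = R.begin
    p ⊕ (q ⊕ r)  R.≈⟨ ⊕-assoc p q r ⟨
    (p ⊕ q) ⊕ r  R.≈⟨ ⊕-cong (⊕-comm p q) (≋-refl {r}) ⟩
    (q ⊕ p) ⊕ r  R.≈⟨ ⊕-assoc q p r ⟩
    q ⊕ (p ⊕ r)  R.∎

  ⊖-cong : ∀ {p q} → p ≋ q → ⊖ p ≋ ⊖ q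
  ⊖-cong {p} {q} e = eq λ k →
    ≈-trans (coeff-⊖ p k) (≈-trans (-‿cong (at e k)) (≈-sym (coeff-⊖ q k)))

  ⊖-inverseˡ : ∀ p → ⊖ p ⊕ p ≋ []
  ⊖-inverseˡ p = eq λ k →
    ≈-trans (coeff-⊕ (⊖ p) p k) (≈-trans (+-cong (coeff-⊖ p k) ≈-refl) (-‿inverseˡ _))

  ·-cong : ∀ {a b p q} → a ≈ b → p ≋ q → a · p ≋ b · q
  ·-cong {a} {b} {p} {q} e f = eq λ k →
    ≈-trans (coeff-· a p k) (≈-trans (*-cong e (at f k)) (≈-sym (coeff-· b q k)))

  ·-zeroˡ : ∀ {a} p → a ≈ 0# → a · p ≋ []
  ·-zeroˡ {a} p a≈0 = eq λ k → ≈-trans (coeff-· a p k) (≈-trans (*-cong a≈0 ≈-refl) (zeroˡ _))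

  ·-identity : ∀ p → 1# · p ≋ p
  ·-identity p = eq λ k → ≈-trans (coeff-· 1# p k) (*-identityˡ _)

  ·-distribʳ : ∀ a b p → (a + b) · p ≋ a · p ⊕ b · p
  ·-distribʳ a b p = eq λ k →
    ≈-trans (coeff-· (a + b) p k) (≈-trans (distribʳ _ _ _)
      (≈-sym (≈-trans (coeff-⊕ (a · p) (b · p) k) (+-cong (coeff-· a p k) (coeff-· b p k)))))

  ·-distribˡ : ∀ a p q → a · (p ⊕ q) ≋ a · p ⊕ a · q
  ·-distribˡ a p q = eq λ k →
    ≈-trans (coeff-· a (p ⊕ q) k) (≈-trans (*-cong ≈-refl (coeff-⊕ p q k)) (≈-trans (distribˡ _ _ _)
      (≈-sym (≈-trans (coeff-⊕ (a · p) (a · q) k) (+-cong (coeff-· a p k) (coeff-· a q k))))))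

  ·-assoc : ∀ a b p → (a * b) · p ≋ a · (b · p)
  ·-assoc a b p = eq λ k →
    ≈-trans (coeff-· (a * b) p k) (≈-trans (*-assoc _ _ _)
      (≈-sym (≈-trans (coeff-· a (b · p) k) (*-cong ≈-refl (coeff-· b p k)))))

  ⊛-zeroˡ : ∀ {p} q → p ≋ [] → p ⊛ q ≋ []
  ⊛-zeroˡ {[]}    q e = ≋-refl
  ⊛-zeroˡ {a ∷ p} q e with ∷-zero⁻ e
  ... | a≈0 , p≋0 = ⊕-cong (·-zeroˡ q a≈0) (∷-zero ≈-refl (⊛-zeroˡ q p≋0))

  ⊛-cong : ∀ {p p′ q q′} → p ≋ p′ → q ≋ q′ → p ⊛ q ≋ p′ ⊛ q′
  ⊛-cong {[]}    {p′}     {q} {q′} e f = ≋-sym (⊛-zeroˡ q′ (≋-sym e))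
  ⊛-cong {a ∷ p} {[]}     {q} {q′} e f = ⊛-zeroˡ q e
  ⊛-cong {a ∷ p} {b ∷ p′} {q} {q′} e f with ∷-injective e
  ... | a≈b , p≋p′ = ⊕-cong (·-cong a≈b f) (∷-cong ≈-refl (⊛-cong p≋p′ f))

  shift-⊕ : ∀ p q → (0# ∷ p) ⊕ (0# ∷ q) ≋ 0# ∷ (p ⊕ q)
  shift-⊕ p q = ∷-cong (+-identityˡ _) ≋-refl

  ⊛-distribʳ : ∀ r p q → (p ⊕ q) ⊛ r ≋ p ⊛ r ⊕ q ⊛ r
  ⊛-distribʳ r []      q       = ≋-refl
  ⊛-distribʳ r (a ∷ p) []      = ≋-sym (⊕-identityʳ _)
  ⊛-distribʳ r (a ∷ p) (b ∷ q) = R.begin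
    (a + b) · r ⊕ (0# ∷ (p ⊕ q) ⊛ r)
      R.≈⟨ ⊕-cong (·-distribʳ a b r) (∷-cong ≈-refl (⊛-distribʳ r p q)) ⟩
    (a · r ⊕ b · r) ⊕ (0# ∷ (p ⊛ r ⊕ q ⊛ r))
      R.≈⟨ ⊕-cong (≋-refl {a · r ⊕ b · r}) (≋-sym (shift-⊕ (p ⊛ r) (q ⊛ r))) ⟩
    (a · r ⊕ b · r) ⊕ ((0# ∷ p ⊛ r) ⊕ (0# ∷ q ⊛ r))
      R.≈⟨ ⊕-interchange (a · r) (b · r) (0# ∷ p ⊛ r) (0# ∷ q ⊛ r) ⟩
    (a · r ⊕ (0# ∷ p ⊛ r)) ⊕ (b · r ⊕ (0# ∷ q ⊛ r)) R.∎

  ⊛-zeroʳ : ∀ p → p ⊛ [] ≋ []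
  ⊛-zeroʳ []      = ≋-refl
  ⊛-zeroʳ (a ∷ p) = ∷-zero ≈-refl (⊛-zeroʳ p)

  ⊛-∷ : ∀ p b q → p ⊛ (b ∷ q) ≋ b · p ⊕ (0# ∷ p ⊛ q)
  ⊛-∷ []      b q = ≋-sym (∷-zero ≈-refl ≋-refl)
  ⊛-∷ (a ∷ p) b q = ∷-cong (+-cong (*-comm a b) ≈-refl) (R.begin
    a · q ⊕ p ⊛ (b ∷ q)              R.≈⟨ ⊕-cong (≋-refl {a · q}) (⊛-∷ p b q) ⟩
    a · q ⊕ (b · p ⊕ (0# ∷ p ⊛ q))   R.≈⟨ ⊕-swap (a · q) (b · p) (0# ∷ p ⊛ q) ⟩
    b · p ⊕ (a · q ⊕ (0# ∷ p ⊛ q))   R.∎)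

  ⊛-comm : ∀ p q → p ⊛ q ≋ q ⊛ p
  ⊛-comm []      q = ≋-sym (⊛-zeroʳ q)
  ⊛-comm (a ∷ p) q = R.begin
    a · q ⊕ (0# ∷ p ⊛ q)  R.≈⟨ ⊕-cong (≋-refl {a · q}) (∷-cong ≈-refl (⊛-comm p q)) ⟩
    a · q ⊕ (0# ∷ q ⊛ p)  R.≈⟨ ⊛-∷ q a p ⟨
    q ⊛ (a ∷ p)           R.∎

  ·-⊛-assoc : ∀ a p q → (a · p) ⊛ q ≋ a · (p ⊛ q)
  ·-⊛-assoc a []      q = ≋-refl
  ·-⊛-assoc a (b ∷ p) q = R.begin
    (a * b) · q ⊕ (0# ∷ (a · p) ⊛ q)
      R.≈⟨ ⊕-cong (·-assoc a b q) (∷-cong (≈-sym (zeroʳ a)) (·-⊛-assoc a p q)) ⟩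
    a · (b · q) ⊕ a · (0# ∷ p ⊛ q)
      R.≈⟨ ·-distribˡ a (b · q) (0# ∷ p ⊛ q) ⟨
    a · (b · q ⊕ (0# ∷ p ⊛ q)) R.∎

  shift-⊛ : ∀ p q → (0# ∷ p) ⊛ q ≋ 0# ∷ p ⊛ q
  shift-⊛ p q = ⊕-cong (·-zeroˡ q ≈-refl) (≋-refl {0# ∷ p ⊛ q})

  ⊛-assoc : ∀ p q r → (p ⊛ q) ⊛ r ≋ p ⊛ (q ⊛ r)
  ⊛-assoc []      q r = ≋-refl
  ⊛-assoc (a ∷ p) q r = R.begin
    (a · q ⊕ (0# ∷ p ⊛ q)) ⊛ r
      R.≈⟨ ⊛-distribʳ r (a · q) (0# ∷ p ⊛ q) ⟩
    (a · q) ⊛ r ⊕ (0# ∷ p ⊛ q) ⊛ r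
      R.≈⟨ ⊕-cong (·-⊛-assoc a q r) (shift-⊛ (p ⊛ q) r) ⟩
    a · (q ⊛ r) ⊕ (0# ∷ (p ⊛ q) ⊛ r)
      R.≈⟨ ⊕-cong (≋-refl {a · (q ⊛ r)}) (∷-cong ≈-refl (⊛-assoc p q r)) ⟩
    a · (q ⊛ r) ⊕ (0# ∷ p ⊛ (q ⊛ r)) R.∎

  ⊛-identityˡ : ∀ p → (1# ∷ []) ⊛ p ≋ p
  ⊛-identityˡ p = R.begin
    1# · p ⊕ (0# ∷ [])  R.≈⟨ ⊕-cong (·-identity p) (∷-zero ≈-refl ≋-refl) ⟩
    p ⊕ []              R.≈⟨ ⊕-identityʳ p ⟩
    p                   R.∎

  polynomialRing : CommutativeRing 0ℓ 0ℓ
  polynomialRing = record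
    { Carrier = List Carrier
    ; _≈_ = _≋_
    ; _+_ = _⊕_
    ; _*_ = _⊛_
    ; -_  = ⊖_
    ; 0#  = []
    ; 1#  = 1# ∷ []
    ; isCommutativeRing = record
      { isRing = record
        { +-isAbelianGroup = record
          { isGroup = record
            { isMonoid = record
              { isSemigroup = record
                { isMagma = record { isEquivalence = ≋-isEquivalence ; ∙-cong = ⊕-cong }
                ; assoc = ⊕-assoc
                }
              ; identity = (λ _ → ≋-refl) , ⊕-identityʳ
              }
            ; inverse = ⊖-inverseˡ , λ p → ≋-trans (⊕-comm p (⊖ p)) (⊖-inverseˡ p)
            ; ⁻¹-cong = ⊖-cong
            }
          ; comm = ⊕-comm
          }
        ; *-cong = ⊛-cong
        ; *-assoc = ⊛-assoc
        ; *-identity = ⊛-identityˡ , λ p → ≋-trans (⊛-comm p (1# ∷ [])) (⊛-identityˡ p)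
        ; distrib =
            (λ p q r → ≋-trans (⊛-comm p (q ⊕ r)) (≋-trans (⊛-distribʳ p q r)
                         (⊕-cong (⊛-comm q p) (⊛-comm r p))))
          , ⊛-distribʳ
        }
      ; *-comm = ⊛-comm
      }
    }

  ≋0? : ∀ p → Dec (p ≋ [])
  ≋0? []      = yes ≋-refl
  ≋0? (a ∷ p) = map′ (λ (e , f) → ∷-zero e f) ∷-zero⁻ (≈0? a ×-dec ≋0? p)

  p⊛q≋0⇒ : ∀ p q → p ⊛ q ≋ [] → p ≋ [] ⊎ q ≋ []
  p⊛q≋0⇒ []      q e = inj₁ ≋-refl
  p⊛q≋0⇒ (a ∷ p) q e with ≈0? a
  ... | yes a≈0 = [ (λ p≋0 → inj₁ (∷-zero a≈0 p≋0)) , inj₂ ]′ (p⊛q≋0⇒ p q tail≋0)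
    where
    tail≋0 : p ⊛ q ≋ []
    tail≋0 = proj₂ (∷-zero⁻ (≋-trans
      (≋-sym (⊕-cong (·-zeroˡ q a≈0) (≋-refl {0# ∷ p ⊛ q}))) e))
  ... | no a≉0 = inj₂ (go q e)
    where
    go : ∀ q → (a ∷ p) ⊛ q ≋ [] → q ≋ []
    go []      e = ≋-refl
    go (b ∷ q) e with x*y≈0⇒ a b (≈-trans (≈-sym (+-identityʳ _)) (at e 0))
    ... | inj₁ a≈0 = ⊥-elim (a≉0 a≈0)
    ... | inj₂ b≈0 = ∷-zero b≈0 (go q (proj₂ (∷-zero⁻ (≋-trans (≋-sym shifted) e))))
      where
      shifted : (a ∷ p) ⊛ (b ∷ q) ≋ 0# ∷ (a ∷ p) ⊛ q
      shifted = ≋-trans (⊛-∷ (a ∷ p) b q)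
        (⊕-cong (·-zeroˡ (a ∷ p) b≈0) (≋-refl {0# ∷ (a ∷ p) ⊛ q}))

  polynomialDomain : DecidableDomain
  polynomialDomain = record
    { commutativeRing = polynomialRing
    ; ≈0?    = ≋0?
    ; x*y≈0⇒ = p⊛q≋0⇒
    ; 1≉0    = λ e → 1≉0 (at e 0)
    }

ℚ-domain : DecidableDomain
ℚ-domain = record
  { commutativeRing = ℚ.+-*-commutativeRing
  ; ≈0?    = ℚ._≟ 0ℚ
  ; x*y≈0⇒ = p*q≡0⇒
  ; 1≉0    = ℚ.1≢0
  }
  where
  p*q≡0⇒ : ∀ p q → p ℚ.* q ≡ 0ℚ → p ≡ 0ℚ ⊎ q ≡ 0ℚ
  p*q≡0⇒ p q e with p ℚ.≟ 0ℚ
  ... | yes p≡0 = inj₁ p≡0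
  ... | no  p≢0 = inj₂ (trans (sym (ℚ.*-identityˡ q))
    (trans (cong (ℚ._* q) (sym (ℚ.*-inverseˡ p)))
    (trans (ℚ.*-assoc (ℚ.1/ p) p q)
    (trans (cong (ℚ.1/ p ℚ.*_) e) (ℚ.*-zeroʳ (ℚ.1/ p))))))
    where instance _ = ℚ.≢-nonZero p≢0

-- ℚ[y₁,…,yₙ] as ℚ[y₂,…,yₙ][y₁].

polynomialDomain : ℕ → DecidableDomain
polynomialDomain zero    = ℚ-domain
polynomialDomain (suc n) = Univariate.polynomialDomain (polynomialDomain n)

polynomialRing : ℕ → CommutativeRing 0ℓ 0ℓ
polynomialRing n = DecidableDomain.commutativeRing (polynomialDomain n)

Polynomial : ℕ → Set
Polynomial n = CommutativeRing.Carrier (polynomialRing n)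

constantPoly : ∀ n → ℚ → Polynomial n
constantPoly zero    q = q
constantPoly (suc n) q = constantPoly n q ∷ []

variablePoly : ∀ n → Fin n → Polynomial n
variablePoly (suc n) zero    = 0# ∷ 1# ∷ []
  where open CommutativeRing (polynomialRing n)
variablePoly (suc n) (suc i) = variablePoly n i ∷ []

∂Poly : ∀ n → Fin n → Polynomial n → Polynomial n
∂Poly (suc n) zero    = Univariate.derivative (polynomialDomain n)
∂Poly (suc n) (suc i) = List.map (∂Poly n i)

NonNegative : ∀ n → Polynomial n → Set
NonNegative zero    q = 0ℚ ℚ.≤ q
NonNegative (suc n) p = All (NonNegative n) p

NonZero : ∀ n → Polynomial n → Set
NonZero n p = ¬ p ≈ 0#
  where open CommutativeRing (polynomialRing n)

nonZero-1 : ∀ n → NonZero n (CommutativeRing.1# (polynomialRing n))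
nonZero-1 n = DecidableDomain.1≉0 (polynomialDomain n)

nonZero-* : ∀ n {p q} → NonZero n p → NonZero n q →
            NonZero n (CommutativeRing._*_ (polynomialRing n) p q)
nonZero-* n p≉0 q≉0 e = [ p≉0 , q≉0 ]′ (DecidableDomain.x*y≈0⇒ (polynomialDomain n) _ _ e)

nonZero-variable : ∀ n i → NonZero n (variablePoly n i)
nonZero-variable (suc n) zero    e = nonZero-1 n (Univariate.at e 1)
nonZero-variable (suc n) (suc i) e = nonZero-variable n i (Univariate.at e 0)

nonNeg-0 : ∀ n → NonNegative n (CommutativeRing.0# (polynomialRing n))
nonNeg-0 zero    = ℚ.≤-refl
nonNeg-0 (suc n) = []

nonNeg-1 : ∀ n → NonNegative n (CommutativeRing.1# (polynomialRing n))
nonNeg-1 zero    = ℚ.nonNegative⁻¹ 1ℚ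
nonNeg-1 (suc n) = nonNeg-1 n ∷ []

nonNeg-variable : ∀ n i → NonNegative n (variablePoly n i)
nonNeg-variable (suc n) zero    = nonNeg-0 n ∷ nonNeg-1 n ∷ []
nonNeg-variable (suc n) (suc i) = nonNeg-variable n i ∷ []

nonNeg-+ : ∀ n {p q} → NonNegative n p → NonNegative n q →
           NonNegative n (CommutativeRing._+_ (polynomialRing n) p q)
nonNeg-+ zero    p≥0       q≥0       = ℚ.+-mono-≤ p≥0 q≥0
nonNeg-+ (suc n) []        q≥0       = q≥0
nonNeg-+ (suc n) (a ∷ p≥0) []        = a ∷ p≥0
nonNeg-+ (suc n) (a ∷ p≥0) (b ∷ q≥0) = nonNeg-+ n a b ∷ nonNeg-+ (suc n) p≥0 q≥0

nonNeg-* : ∀ n {p q} → NonNegative n p → NonNegative n q →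
           NonNegative n (CommutativeRing._*_ (polynomialRing n) p q)
nonNeg-* zero {p} {q} p≥0 q≥0 =
  subst (ℚ._≤ p ℚ.* q) (ℚ.*-zeroʳ p) (ℚ.*-monoˡ-≤-nonNeg p q≥0)
  where instance _ = ℚ.nonNegative p≥0
nonNeg-* (suc n) []        q≥0 = []
nonNeg-* (suc n) (a ∷ p≥0) q≥0 =
  nonNeg-+ (suc n) (scale q≥0) (nonNeg-0 n ∷ nonNeg-* (suc n) p≥0 q≥0)
  where
  scale : ∀ {q} → NonNegative (suc n) q →
          NonNegative (suc n) (Univariate._·_ (polynomialDomain n) _ q)
  scale []        = []
  scale (b ∷ q≥0) = nonNeg-* n a b ∷ scale q≥0

p+q≈0⇒p≈0 : ∀ n {p q} → NonNegative n p → NonNegative n q →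
            let open CommutativeRing (polynomialRing n) in p + q ≈ 0# → p ≈ 0#
p+q≈0⇒p≈0 zero {p} {q} p≥0 q≥0 e = ℚ.≤-antisym p≤0 p≥0
  where
  p≤0 : p ℚ.≤ 0ℚ
  p≤0 = subst (p ℚ.≤_) e (subst (ℚ._≤ p ℚ.+ q) (ℚ.+-identityʳ p) (ℚ.+-monoʳ-≤ p q≥0))
p+q≈0⇒p≈0 (suc n) []        q≥0       e = CommutativeRing.refl (polynomialRing (suc n))
p+q≈0⇒p≈0 (suc n) (a ∷ p≥0) []        e = e
p+q≈0⇒p≈0 (suc n) (a ∷ p≥0) (b ∷ q≥0) e =
  U.∷-zero (p+q≈0⇒p≈0 n a b (proj₁ (U.∷-zero⁻ e)))
           (p+q≈0⇒p≈0 (suc n) p≥0 q≥0 (proj₂ (U.∷-zero⁻ e)))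
  where module U = Univariate (polynomialDomain n)

------------------------------------------------------------------------
-- Rational functions

record RationalFunction (n : ℕ) : Set where
  field
    num den     : Polynomial n
    den-nonZero : NonZero n den

rationalFunctions : ℕ → RawRing 0ℓ 0ℓ
rationalFunctions n = record
  { Carrier = RationalFunction n
  ; _≈_ = λ r s → num r P.* den s P.≈ num s P.* den r
  ; _+_ = λ r s → record
    { num = num r P.* den s P.+ num s P.* den r
    ; den = den r P.* den s
    ; den-nonZero = nonZero-* n (den-nonZero r) (den-nonZero s)
    }
  ; _*_ = λ r s → record
    { num = num r P.* num s
    ; den = den r P.* den s
    ; den-nonZero = nonZero-* n (den-nonZero r) (den-nonZero s)
    }
  ; -_ = λ r → record { num = P.- num r ; den = den r ; den-nonZero = den-nonZero r }
  ; 0# = record { num = P.0# ; den = P.1# ; den-nonZero = nonZero-1 n }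
  ; 1# = record { num = P.1# ; den = P.1# ; den-nonZero = nonZero-1 n }
  }
  where
  module P = CommutativeRing (polynomialRing n)
  open RationalFunction

∂ : ∀ {n} → Fin n → RationalFunction n → RationalFunction n
∂ {n} j r = record
  { num = ∂Poly n j num * den - num * ∂Poly n j den
  ; den = den * den
  ; den-nonZero = nonZero-* n den-nonZero den-nonZero
  }
  where
  open CommutativeRing (polynomialRing n)
  open RationalFunction r

variableRF : ∀ {n} → Fin n → RationalFunction n
variableRF {n} i = record
  { num = variablePoly n i
  ; den = CommutativeRing.1# (polynomialRing n)
  ; den-nonZero = nonZero-1 n
  }

fromℤ : ∀ {n} → ℤ → RationalFunction n
fromℤ {n} z = record
  { num = constantPoly n (z ℚ./ 1)
  ; den = CommutativeRing.1# (polynomialRing n)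
  ; den-nonZero = nonZero-1 n
  }

record SubtractionFree (n : ℕ) : Set where
  field
    num den     : Polynomial n
    num-nonZero : NonZero n num
    den-nonZero : NonZero n den
    num-nonNeg  : NonNegative n num
    den-nonNeg  : NonNegative n den

toRationalFunction : ∀ {n} → SubtractionFree n → RationalFunction n
toRationalFunction r = record { num = num ; den = den ; den-nonZero = den-nonZero }
  where open SubtractionFree r

module SF {n : ℕ} where

  open SubtractionFree
  private
    module P = CommutativeRing (polynomialRing n)

  infix  9 _⁻¹
  infixr 8 _^_ _^ℤ_
  infixl 7 _*_
  infixl 6 _+_

  1# : SubtractionFree n
  1# = record
    { num = P.1# ; num-nonZero = nonZero-1 n ; num-nonNeg = nonNeg-1 n
    ; den = P.1# ; den-nonZero = nonZero-1 n ; den-nonNeg = nonNeg-1 n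
    }

  var : Fin n → SubtractionFree n
  var i = record
    { num = variablePoly n i
    ; num-nonZero = nonZero-variable n i
    ; num-nonNeg = nonNeg-variable n i
    ; den = P.1# ; den-nonZero = nonZero-1 n ; den-nonNeg = nonNeg-1 n
    }

  _*_ : SubtractionFree n → SubtractionFree n → SubtractionFree n
  r * s = record
    { num = num r P.* num s
    ; num-nonZero = nonZero-* n (num-nonZero r) (num-nonZero s)
    ; num-nonNeg = nonNeg-* n (num-nonNeg r) (num-nonNeg s)
    ; den = den r P.* den s
    ; den-nonZero = nonZero-* n (den-nonZero r) (den-nonZero s)
    ; den-nonNeg = nonNeg-* n (den-nonNeg r) (den-nonNeg s)
    }

  _+_ : SubtractionFree n → SubtractionFree n → SubtractionFree n
  r + s = record
    { num = num r P.* den s P.+ num s P.* den r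
    ; num-nonZero = λ e → nonZero-* n (num-nonZero r) (den-nonZero s) (p+q≈0⇒p≈0 n rs sr e)
    ; num-nonNeg = nonNeg-+ n rs sr
    ; den = den r P.* den s
    ; den-nonZero = nonZero-* n (den-nonZero r) (den-nonZero s)
    ; den-nonNeg = nonNeg-* n (den-nonNeg r) (den-nonNeg s)
    }
    where
    rs : NonNegative n (num r P.* den s)
    rs = nonNeg-* n (num-nonNeg r) (den-nonNeg s)
    sr : NonNegative n (num s P.* den r)
    sr = nonNeg-* n (num-nonNeg s) (den-nonNeg r)

  _⁻¹ : SubtractionFree n → SubtractionFree n
  r ⁻¹ = record
    { num = den r ; num-nonZero = den-nonZero r ; num-nonNeg = den-nonNeg r
    ; den = num r ; den-nonZero = num-nonZero r ; den-nonNeg = num-nonNeg r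
    }

  _^_ : SubtractionFree n → ℕ → SubtractionFree n
  r ^ zero  = 1#
  r ^ suc k = r * r ^ k

  _^ℤ_ : SubtractionFree n → ℤ → SubtractionFree n
  r ^ℤ (+ k)    = r ^ k
  r ^ℤ -[1+ k ] = r ⁻¹ ^ suc k

------------------------------------------------------------------------
-- Matrices

Matrix : Set → ℕ → ℕ → Set
Matrix A m n = Fin m → Fin n → A

module MatrixOperations (R : RawRing 0ℓ 0ℓ) where

  open RawRing R
  open RawSemiringDefinitions rawSemiring using (sum; _^_)

  infixl 7 _⊡_
  infixl 6 _⊞_ _⊟_

  diag : ∀ {n} → (Fin n → Carrier) → Matrix Carrier n n
  diag d i j = if does (i Fin.≟ j) then d i else 0#

  I : ∀ n → Matrix Carrier n n
  I n = diag λ _ → 1#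

  _⊞_ _⊟_ : ∀ {m n} → Matrix Carrier m n → Matrix Carrier m n → Matrix Carrier m n
  (M ⊞ N) i j = M i j + N i j
  (M ⊟ N) i j = M i j + (- N i j)

  _⊡_ : ∀ {l m n} → Matrix Carrier l m → Matrix Carrier m n → Matrix Carrier l n
  (M ⊡ N) i k = sum λ j → M i j * N j k

  -- Laplace expansion along the first row.
  det : ∀ {n} → Matrix Carrier n n → Carrier
  det {zero}  M = 1#
  det {suc n} M = sum λ j →
    (- 1#) ^ toℕ j * (M zero j * det λ i k → M (suc i) (punchIn j k))

------------------------------------------------------------------------
-- Y-seeds

SkewSymmetrizable : ∀ {n} → Matrix ℤ n n → Set
SkewSymmetrizable {n} B = Σ[ d ∈ (Fin n → ℕ) ]
  (∀ i → 0 ℕ.< d i) × (∀ i j → + d i ℤ.* B i j ≡ ℤ.- (+ d j ℤ.* B j i))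

record YSeed (n : ℕ) : Set where
  field
    B : Matrix ℤ n n
    Y : Fin n → SubtractionFree n
    skewSymmetrizable : SkewSymmetrizable B

mutateB : ∀ {n} → Fin n → Matrix ℤ n n → Matrix ℤ n n
mutateB k B i j =
  if does (i Fin.≟ k) ∨ does (j Fin.≟ k) then ℤ.- B i j
  else if does (0ℤ ℤ.<? B i k) ∧ does (0ℤ ℤ.<? B k j) then B i j ℤ.+ B i k ℤ.* B k j
  else if does (B i k ℤ.<? 0ℤ) ∧ does (B k j ℤ.<? 0ℤ) then B i j ℤ.- B i k ℤ.* B k j
  else B i j

mutateY : ∀ {n} → Fin n → Matrix ℤ n n → (Fin n → SubtractionFree n) → Fin n → SubtractionFree n
mutateY k B Y i =
  if does (i Fin.≟ k) then Y k ⁻¹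
  else if does (0ℤ ℤ.≤? B k i) then Y i * (Y k ⁻¹ + 1#) ^ℤ (ℤ.- B k i)
  else Y i * (Y k + 1#) ^ℤ (ℤ.- B k i)
  where open SF

neg-pos : ∀ {a b x y} → 0 ℕ.< a → 0 ℕ.< b → + a ℤ.* x ≡ ℤ.- (+ b ℤ.* y) → 0ℤ ℤ.< x → y ℤ.< 0ℤ
neg-pos {a} {b} {x} {y} a>0 b>0 e x>0 = ℤ.*-cancelˡ-<-nonNeg (+ b) by<b0
  where
  instance
    _ = ℤ.positive (ℤ.+<+ a>0)
  0<ax : 0ℤ ℤ.< + a ℤ.* x
  0<ax = subst (ℤ._< + a ℤ.* x) (ℤ.*-zeroʳ (+ a)) (ℤ.*-monoˡ-<-pos (+ a) x>0)
  by<b0 : + b ℤ.* y ℤ.< + b ℤ.* 0ℤ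
  by<b0 = subst (+ b ℤ.* y ℤ.<_) (sym (ℤ.*-zeroʳ (+ b)))
    (ℤ.neg-cancel-< (subst (0ℤ ℤ.<_) e 0<ax))

pos-neg : ∀ {a b x y} → 0 ℕ.< a → 0 ℕ.< b → + a ℤ.* x ≡ ℤ.- (+ b ℤ.* y) → x ℤ.< 0ℤ → 0ℤ ℤ.< y
pos-neg {a} {b} {x} {y} a>0 b>0 e x<0 = ℤ.*-cancelˡ-<-nonNeg (+ b) b0<by
  where
  instance
    _ = ℤ.positive (ℤ.+<+ a>0)
  ax<0 : + a ℤ.* x ℤ.< 0ℤ
  ax<0 = subst (+ a ℤ.* x ℤ.<_) (ℤ.*-zeroʳ (+ a)) (ℤ.*-monoˡ-<-pos (+ a) x<0)
  b0<by : + b ℤ.* 0ℤ ℤ.< + b ℤ.* y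
  b0<by = subst (ℤ._< + b ℤ.* y) (sym (ℤ.*-zeroʳ (+ b)))
    (ℤ.neg-cancel-< (subst (ℤ._< 0ℤ) e ax<0))

skew-sym : ∀ {u v : ℤ} → u ≡ ℤ.- v → v ≡ ℤ.- u
skew-sym {u} {v} e = trans (sym (ℤ.neg-involutive v)) (cong ℤ.-_ (sym e))

mutateB-skewSymmetrizable : ∀ {n} (k : Fin n) {B : Matrix ℤ n n} →
                            SkewSymmetrizable B → SkewSymmetrizable (mutateB k B)
mutateB-skewSymmetrizable {n} k {B} (d , d>0 , skew) = d , d>0 , skew′
  where
  sign⁺ : ∀ i j → does (0ℤ ℤ.<? B j i) ≡ does (B i j ℤ.<? 0ℤ)
  sign⁺ i j = does-⇔ (mk⇔ (neg-pos (d>0 j) (d>0 i) (skew j i)) (pos-neg (d>0 i) (d>0 j) (skew i j)))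
    (0ℤ ℤ.<? B j i) (B i j ℤ.<? 0ℤ)

  product : ∀ i j → + d i ℤ.* (B i k ℤ.* B k j) ≡ + d j ℤ.* (B j k ℤ.* B k i)
  product i j = let open ≡-Reasoning in begin
    + d i ℤ.* (B i k ℤ.* B k j)          ≡⟨ ℤ.*-assoc (+ d i) (B i k) (B k j) ⟨
    + d i ℤ.* B i k ℤ.* B k j            ≡⟨ cong (ℤ._* B k j) (skew i k) ⟩
    ℤ.- (+ d k ℤ.* B k i) ℤ.* B k j      ≡⟨ rearrange (+ d k) (B k i) (B k j) ⟩
    ℤ.- (+ d k ℤ.* B k j) ℤ.* B k i      ≡⟨ cong (ℤ._* B k i) (skew j k) ⟨
    + d j ℤ.* B j k ℤ.* B k i            ≡⟨ ℤ.*-assoc (+ d j) (B j k) (B k i) ⟩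
    + d j ℤ.* (B j k ℤ.* B k i)          ∎
    where
    rearrange : ∀ a b c → ℤ.- (a ℤ.* b) ℤ.* c ≡ ℤ.- (a ℤ.* c) ℤ.* b
    rearrange = solve-∀

  expand⁺ : ∀ i j → + d i ℤ.* (B i j ℤ.+ B i k ℤ.* B k j) ≡ ℤ.- (+ d j ℤ.* (B j i ℤ.- B j k ℤ.* B k i))
  expand⁺ i j = trans (ℤ.*-distribˡ-+ (+ d i) (B i j) (B i k ℤ.* B k j))
    (trans (cong₂ ℤ._+_ (skew i j) (product i j)) (collect (+ d j) (B j i) (B j k ℤ.* B k i)))
    where
    collect : ∀ a b c → ℤ.- (a ℤ.* b) ℤ.+ a ℤ.* c ≡ ℤ.- (a ℤ.* (b ℤ.- c))
    collect = solve-∀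

  negated : ∀ i j → + d i ℤ.* (ℤ.- B i j) ≡ ℤ.- (+ d j ℤ.* (ℤ.- B j i))
  negated i j = trans (sym (ℤ.neg-distribʳ-* (+ d i) (B i j)))
    (cong ℤ.-_ (trans (skew i j) (ℤ.neg-distribʳ-* (+ d j) (B j i))))

  skew′ : ∀ i j → + d i ℤ.* mutateB k B i j ≡ ℤ.- (+ d j ℤ.* mutateB k B j i)
  skew′ i j with does (i Fin.≟ k) | does (j Fin.≟ k)
  ... | true  | true  = negated i j
  ... | true  | false = negated i j
  ... | false | true  = negated i j
  ... | false | false
    rewrite sign⁺ k j | sign⁺ i k | sym (sign⁺ j k) | sym (sign⁺ k i)
    with 0ℤ ℤ.<? B i k | 0ℤ ℤ.<? B k j | B i k ℤ.<? 0ℤ | B k j ℤ.<? 0ℤ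
  ... | yes p | yes q | yes r | _     = ⊥-elim (ℤ.<-asym p r)
  ... | yes p | yes q | no _  | yes s = ⊥-elim (ℤ.<-asym q s)
  ... | yes p | yes q | no _  | no _  = expand⁺ i j
  ... | yes p | no _  | yes r | _     = ⊥-elim (ℤ.<-asym p r)
  ... | yes _ | no _  | no _  | yes _ = skew i j
  ... | yes _ | no _  | no _  | no _  = skew i j
  ... | no _  | yes q | yes r | yes s = ⊥-elim (ℤ.<-asym q s)
  ... | no _  | no _  | yes r | yes s = skew-sym (expand⁺ j i)
  ... | no _  | yes _ | yes _ | no _  = skew i j
  ... | no _  | yes _ | no _  | yes _ = skew i j
  ... | no _  | yes _ | no _  | no _  = skew i j
  ... | no _  | no _  | yes _ | no _  = skew i j
  ... | no _  | no _  | no _  | yes _ = skew i j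
  ... | no _  | no _  | no _  | no _  = skew i j

mutate : ∀ {n} → Fin n → YSeed n → YSeed n
mutate k S = record
  { B = mutateB k B
  ; Y = mutateY k B Y
  ; skewSymmetrizable = mutateB-skewSymmetrizable k skewSymmetrizable
  }
  where open YSeed S

permute : ∀ {n} → Permutation′ n → YSeed n → YSeed n
permute σ S = record
  { B = λ i j → B (σ ⟨$⟩ˡ i) (σ ⟨$⟩ˡ j)
  ; Y = λ i → Y (σ ⟨$⟩ˡ i)
  ; skewSymmetrizable = let d , d>0 , skew = skewSymmetrizable in
      (λ i → d (σ ⟨$⟩ˡ i)) , (λ i → d>0 (σ ⟨$⟩ˡ i)) , (λ i j → skew (σ ⟨$⟩ˡ i) (σ ⟨$⟩ˡ j))
  }
  where open YSeed S

------------------------------------------------------------------------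
-- Equivalence relations generated by finitely many pairs

module FiniteGeneration {A : Set} (_≟_ : DecidableEquality A) where

  Generated : List (A × A) → Rel A 0ℓ
  Generated L = EqClosure (λ x y → (x , y) ∈ L)

  -- How the generated relation grows when the pair (a , b) is added.
  Merge : Rel A 0ℓ → A → A → Rel A 0ℓ
  Merge _∼_ a b x y = x ∼ y ⊎ (x ∼ a × b ∼ y) ⊎ (x ∼ b × a ∼ y)

  Merge-isEquivalence : ∀ {_∼_ a b} → IsEquivalence _∼_ → IsEquivalence (Merge _∼_ a b)
  Merge-isEquivalence {_∼_} {a} {b} isEq = record
    { refl  = inj₁ E.refl
    ; sym   = λ
      { (inj₁ e)              → inj₁ (E.sym e)
      ; (inj₂ (inj₁ (e , f))) → inj₂ (inj₂ (E.sym f , E.sym e))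
      ; (inj₂ (inj₂ (e , f))) → inj₂ (inj₁ (E.sym f , E.sym e))
      }
    ; trans = λ
      { (inj₁ e)              (inj₁ g)              → inj₁ (E.trans e g)
      ; (inj₁ e)              (inj₂ (inj₁ (g , h))) → inj₂ (inj₁ (E.trans e g , h))
      ; (inj₁ e)              (inj₂ (inj₂ (g , h))) → inj₂ (inj₂ (E.trans e g , h))
      ; (inj₂ (inj₁ (e , f))) (inj₁ g)              → inj₂ (inj₁ (e , E.trans f g))
      ; (inj₂ (inj₁ (e , f))) (inj₂ (inj₁ (g , h))) → inj₂ (inj₁ (e , h))
      ; (inj₂ (inj₁ (e , f))) (inj₂ (inj₂ (g , h))) → inj₁ (E.trans e h)
      ; (inj₂ (inj₂ (e , f))) (inj₁ g)              → inj₂ (inj₂ (e , E.trans f g))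
      ; (inj₂ (inj₂ (e , f))) (inj₂ (inj₁ (g , h))) → inj₁ (E.trans e h)
      ; (inj₂ (inj₂ (e , f))) (inj₂ (inj₂ (g , h))) → inj₂ (inj₂ (e , h))
      }
    }
    where module E = IsEquivalence isEq

  generated? : ∀ L → Decidable (Generated L)
  generated? [] x y = map′
    (λ { refl → IsEquivalence.refl (Eq.isEquivalence _) })
    (Eq.fold isEquivalence (λ ()))
    (x ≟ y)
  generated? ((a , b) ∷ L) x y = map′ from to
    (x ∼? y ⊎-dec ((x ∼? a ×-dec b ∼? y) ⊎-dec (x ∼? b ×-dec a ∼? y)))
    where
    _∼?_ = generated? L
    module E = IsEquivalence (Eq.isEquivalence (λ x y → (x , y) ∈ (a , b) ∷ L))
    weaken : ∀ {x y} → Generated L x y → Generated ((a , b) ∷ L) x y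
    weaken = Eq.map there
    a∼b : Generated ((a , b) ∷ L) a b
    a∼b = Eq.return (here refl)
    from : Merge (Generated L) a b x y → Generated ((a , b) ∷ L) x y
    from (inj₁ e)              = weaken e
    from (inj₂ (inj₁ (e , f))) = E.trans (weaken e) (E.trans a∼b (weaken f))
    from (inj₂ (inj₂ (e , f))) = E.trans (weaken e) (E.trans (E.sym a∼b) (weaken f))
    to : Generated ((a , b) ∷ L) x y → Merge (Generated L) a b x y
    to = Eq.fold (Merge-isEquivalence (Eq.isEquivalence _)) λ
      { (here refl) → inj₂ (inj₁ (IsEquivalence.refl (Eq.isEquivalence _) ,
                                  IsEquivalence.refl (Eq.isEquivalence _)))
      ; (there e)   → inj₁ (Eq.return e)
      }

------------------------------------------------------------------------
-- Mutation sequences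

positivePart : ℤ → ℕ
positivePart (+ k)    = k
positivePart -[1+ _ ] = 0

-- Steps are numbered from zero: step t : Fin T takes the seed at time
-- inject₁ t : Fin (suc T) to the seed at time suc t.

record MutationSequence (n T : ℕ) : Set where
  field
    B : Matrix ℤ n n
    skewSymmetrizable : SkewSymmetrizable B
    m : Fin T → Fin n
    σ : Fin T → Permutation′ n

module _ {n : ℕ} where

  trajectory : ∀ {T} → (Fin T → Fin n) → (Fin T → Permutation′ n) → YSeed n → Fin (suc T) → YSeed n
  trajectory         m σ S zero    = S
  trajectory {suc T} m σ S (suc t) =
    trajectory (λ s → m (suc s)) (λ s → σ (suc s)) (permute (σ zero) (mutate (m zero) S)) t

  trajectory-suc : ∀ {T} m σ S (t : Fin T) →
    trajectory m σ S (suc t) ≡ permute (σ t) (mutate (m t) (trajectory m σ S (inject₁ t)))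
  trajectory-suc m σ S zero    = refl
  trajectory-suc m σ S (suc t) = trajectory-suc _ _ _ t

module _ {n T : ℕ} (γ : MutationSequence n T) where

  open MutationSequence γ

  seed : Fin (suc T) → YSeed n
  seed = trajectory m σ record { B = B ; Y = SF.var ; skewSymmetrizable = skewSymmetrizable }

  B⟨_⟩ : Fin (suc T) → Matrix ℤ n n
  B⟨ t ⟩ = YSeed.B (seed t)

  Y⟨_⟩ : Fin (suc T) → Fin n → SubtractionFree n
  Y⟨ t ⟩ = YSeed.Y (seed t)

  clusterTransformation : Fin n → SubtractionFree n
  clusterTransformation = Y⟨ fromℕ T ⟩

  ----------------------------------------------------------------------
  -- Black vertices of the mutation network are classes of _∼_, and a function
  -- of a black vertex takes an arbitrary representative. Lacking quotient
  -- types, incidence of edges with a class is tested by _∼?_.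

  Ē : Set
  Ē = Fin n × Fin (suc T)

  data _∼₁_ : Rel Ē 0ℓ where
    step : ∀ t {i} → i ≢ m t → (i , inject₁ t) ∼₁ (σ t ⟨$⟩ʳ i , suc t)
    wrap : ∀ i → (i , fromℕ T) ∼₁ (i , zero)

  infix 4 _∼_ _∼?_

  _∼_ : Rel Ē 0ℓ
  _∼_ = EqClosure _∼₁_

  private
    _≟Ē_ : DecidableEquality Ē
    _≟Ē_ = Product.≡-dec Fin._≟_ Fin._≟_

    open FiniteGeneration _≟Ē_

    stepPair : Fin T → Fin n → Ē × Ē
    stepPair t i = (i , inject₁ t) ,
      (if does (i Fin.≟ m t) then (i , inject₁ t) else (σ t ⟨$⟩ʳ i , suc t))

    wrapPair : Fin n → Ē × Ē
    wrapPair i = (i , fromℕ T) , (i , zero)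

    steps wraps : List (Ē × Ē)
    steps = List.cartesianProductWith stepPair (List.allFin T) (List.allFin n)
    wraps = List.map wrapPair (List.allFin n)

    ∼₁⇒∈ : ∀ {x y} → x ∼₁ y → (x , y) ∈ steps List.++ wraps
    ∼₁⇒∈ (wrap i)         = ∈-++⁺ʳ steps (∈-map⁺ wrapPair (∈-allFin i))
    ∼₁⇒∈ (step t {i} i≢m) = ∈-++⁺ˡ (subst (_∈ steps) pair≡
      (∈-cartesianProductWith⁺ stepPair (∈-allFin t) (∈-allFin i)))
      where
      pair≡ : stepPair t i ≡ ((i , inject₁ t) , (σ t ⟨$⟩ʳ i , suc t))
      pair≡ rewrite dec-false (i Fin.≟ m t) i≢m = refl

    stepPair⇒∼ : ∀ t i → proj₁ (stepPair t i) ∼ proj₂ (stepPair t i)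
    stepPair⇒∼ t i with i Fin.≟ m t
    ... | yes _  = IsEquivalence.refl (Eq.isEquivalence _)
    ... | no i≢m = Eq.return (step t i≢m)

    ∈⇒∼ : ∀ {x y} → (x , y) ∈ steps List.++ wraps → x ∼ y
    ∈⇒∼ xy∈ with ∈-++⁻ steps xy∈
    ... | inj₁ xy∈steps with ∈-cartesianProductWith⁻ stepPair (List.allFin T) (List.allFin n) xy∈steps
    ...   | t , i , _ , _ , refl = stepPair⇒∼ t i
    ∈⇒∼ xy∈ | inj₂ xy∈wraps with ∈-map⁻ wrapPair xy∈wraps
    ...   | i , _ , refl = Eq.return (wrap i)

  _∼?_ : Decidable _∼_
  x ∼? y = map′ (Eq.fold (Eq.isEquivalence _) ∈⇒∼) (Eq.map ∼₁⇒∈)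
    (generated? (steps List.++ wraps) x y)

  open RawSemiringDefinitions ℕ.+-*-rawSemiring using (sum)

  δ : Ē → Ē → ℕ
  δ x y = if does (x ∼? y) then 1 else 0

  N₀ N₊ N₋ : Ē → Fin T → ℕ
  N₀ e t = δ e (m t , inject₁ t) ℕ.+ δ e (σ t ⟨$⟩ʳ m t , suc t)
  N₊ e t = sum λ i → δ e (i , inject₁ t) ℕ.* positivePart (B⟨ inject₁ t ⟩ (m t) i)
  N₋ e t = sum λ i → δ e (i , inject₁ t) ℕ.* positivePart (ℤ.- B⟨ inject₁ t ⟩ (m t) i)

  FullyMutated : Set
  FullyMutated = ∀ (e : Ē) → ∃[ t ] (m t , inject₁ t) ∼ e

  -- For fully mutated γ, s ↦ [(m s , inject₁ s)] is a bijection from the steps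
  -- to the black vertices; it indexes the rows.
  A₊ A₋ : Matrix ℤ T T
  A₊ s t = + N₀ (m s , inject₁ s) t ℤ.- + N₊ (m s , inject₁ s) t
  A₋ s t = + N₀ (m s , inject₁ s) t ℤ.- + N₋ (m s , inject₁ s) t

  private
    RF : Set
    RF = RationalFunction n

    open MatrixOperations (rationalFunctions n)

  J : Matrix RF n n
  J i j = ∂ j (toRationalFunction (clusterTransformation i))

  K : Matrix RF n n
  K = diag (λ i → toRationalFunction (clusterTransformation i SF.⁻¹)) ⊡ J ⊡ diag variableRF

  z₊ z₋ : Fin T → SubtractionFree n
  z₊ t = y * (y + 1#) ⁻¹
    where
    open SF
    y = Y⟨ inject₁ t ⟩ (m t)
  z₋ t = (Y⟨ inject₁ t ⟩ (m t) + 1#) ⁻¹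
    where open SF

  Z₊ Z₋ : Matrix RF T T
  Z₊ = diag λ t → toRationalFunction (z₊ t)
  Z₋ = diag λ t → toRationalFunction (z₋ t)

fromℤMatrix : ∀ {k l n} → Matrix ℤ k l → Matrix (RationalFunction n) k l
fromℤMatrix A i j = fromℤ (A i j)

{-# OPTIONS --safe #-}
module Submission where

-- Both sides compute the determinant of one linear system, whose unknowns are
-- x(i,t) for (i,t) in Ē and w(t) for each step t, with the equations
--   w(t) = x(m_t, t-1),
--   x(σ_t(m_t), t) = - w(t),
--   x(σ_t(i), t) = x(i, t-1) + c(t,i) w(t)  for i ≠ m_t,
--   x(i, 0) = x(i, T),
-- where c(t,i) = [B]₊ z₋ + [-B]₊ z₊ for B = B_{m_t,i}(t-1). Logarithmic derivatives
-- of the Y_i(t) satisfy all equations but the last, so eliminating in the order of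
-- time everything except the x(i,0) leaves I - K. The unknowns x can also be
-- eliminated along the paths (i,t-1) ↦ (σ_t(i),t), i ≠ m_t, (i,T) ↦ (i,0), each of
-- which ends at some (m_t,t-1) because γ is fully mutated; this leaves a matrix
-- indexed by the w(t), and it is the Neumann-Zagier matrix A₊ Z₋ + A₋ Z₊. Both
-- eliminations are unitriangular and preserve the determinant.

open import Defs
open import Algebra.Bundles using (AbelianGroup; CommutativeRing; RawRing)
import Algebra.Definitions.RawSemiring as RawSemiringDefinitions
import Algebra.Properties.CommutativeMonoid.Mult as CommutativeMultiples
import Algebra.Properties.Group as GroupProperties
import Algebra.Properties.Ring as RingProperties
import Algebra.Properties.Semiring.Mult.TCOptimised as Multiples
import Algebra.Properties.Semiring.Sum as SemiringSum
import Algebra.Solver.Ring as RingSolver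
import Algebra.Solver.Ring.AlmostCommutativeRing as AlmostCommutativeRing
open import Data.Bool.Base using (Bool; false; if_then_else_; true)
open import Data.Empty using (⊥)
open import Data.Fin.Base using (Fin; fromℕ; inject₁; punchIn; splitAt; suc; toℕ; zero)
open import Data.Fin.Permutation as Perm using (Permutation; _⟨$⟩ʳ_; _⟨$⟩ˡ_)
import Data.Fin.Permutation.Components as PC
open import Data.Fin.Permutation.Transposition.List using (decompose; eval; eval-decompose)
import Data.Fin.Properties as Fin
open import Data.Integer.Base as ℤ using (+_; -[1+_]; 0ℤ; 1ℤ; ℤ)
import Data.Integer.Properties as ℤ
open import Data.Integer.Tactic.RingSolver using (solve-∀)
open import Data.List.Base as List using (List; []; _∷_)
open import Data.List.Membership.Propositional using (_∈_)
open import Data.List.Membership.Propositional.Properties using (∈-allFin)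
open import Data.List.Relation.Unary.Any using (here; there)
import Data.Maybe.Base as Maybe
open import Data.Nat.Base as ℕ using (_≤_; suc; s≤s; zero; z≤n; ℕ)
import Data.Nat.Properties as ℕ
open import Data.Product.Base using (_,_; _×_; proj₁; proj₂; ∃-syntax)
import Data.Product.Properties as Product
open import Data.Rational.Base as ℚ using (1ℚ; ℚ)
import Data.Rational.Properties as ℚ
open import Data.Rational.Unnormalised.Base as ℚᵘ using (*≡*; mkℚᵘ)
import Data.Rational.Unnormalised.Properties as ℚᵘ
open import Data.Sum.Base as Sum using (_⊎_; inj₁; inj₂)
open import Data.Sum.Function.Propositional using (_⊎-↔_)
import Data.Sum.Properties as Sum
open import Data.Unit.Base using (tt; ⊤)
open import Data.Vec.Functional using (updateAt)
import Data.Vec.Functional.Properties as Vector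
open import Function.Base using (_∘_; const)
open import Function.Bundles using (Equivalence; Injection; Inverse; _↔_; _⇔_; mk↔ₛ′; mk⇔)
open import Function.Properties.Equivalence using (⇔-isEquivalence)
open import Function.Properties.Inverse using (↔-refl; ↔-sym; ↔-trans; ↔⇒↣)
open import Level using (0ℓ)
import Relation.Binary.Construct.Closure.Equivalence as Eq
import Relation.Binary.Construct.On as On
open import Relation.Binary.Core using (Rel)
open import Relation.Binary.Definitions using (DecidableEquality; Transitive; WeaklyDecidable)
open import Relation.Binary.PropositionalEquality as ≡ using (_≡_; _≢_)
import Relation.Binary.Reasoning.Setoid as SetoidReasoning
open import Relation.Binary.Structures using (IsEquivalence)
open import Relation.Nullary using (Dec; contradiction; does; no; yes; ¬_)
open import Relation.Nullary.Decidable using (_×-dec_; dec-false; dec-true; dec⇒maybe; does-⇔)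

-- Writing the system as x = G x, the common value is the determinant of I - G. Both eliminations
-- use only pivots equal to 1, so they work over any commutative ring, provided the eliminated
-- unknowns do not depend on each other in a cycle. In the order of time this is clear. Along the
-- paths it is where full mutation enters: the arrows generating the equivalence form a partial
-- injection, so a class is a chain or a cycle, and a class that contains some (m_t, t-1) is a chain
-- ending there, because no arrow leaves that vertex. The copy w(t) of x(m_t, t-1) decouples the two
-- computations: it can stay as a parameter while every x is eliminated. The coefficient c(t,i)
-- comes from d log(1 + Y) = z₊ d log Y and d log(1 + 1/Y) = - z₋ d log Y. In the matrix left for
-- the w(t), the identity and the coefficient -1 become the two broken edges counted by N₀, and z₋ +
-- z₊ = 1 distributes N₀ over the two products A₊ Z₋ and A₋ Z₊.

-- Ring identities with integer coefficients

module IntegerCoefficientSolver (R : CommutativeRing 0ℓ 0ℓ) where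

  open CommutativeRing R hiding (zero)
  open Multiples semiring using (×-homo-+; ×1-homo-*; 1+×) renaming (_×_ to _×ᵣ_)
  open RingProperties ring
  open SetoidReasoning setoid

  private
    ⟦_⟧ : ℤ → Carrier
    ⟦ + n ⟧      = n ×ᵣ 1#
    ⟦ -[1+ n ] ⟧ = - (suc n ×ᵣ 1#)

    cancel : ∀ a x y → (a + x) - (a + y) ≈ x - y
    cancel a x y = begin
      (a + x) - (a + y)      ≈⟨ +-congˡ (-‿+-comm a y) ⟨
      (a + x) + (- a - y)    ≈⟨ +-congʳ (+-comm a x) ⟩
      (x + a) + (- a - y)    ≈⟨ +-assoc x a _ ⟩
      x + (a + (- a - y))    ≈⟨ +-congˡ (+-assoc a (- a) _) ⟨
      x + (a - a - y)        ≈⟨ +-congˡ (+-congʳ (-‿inverseʳ a)) ⟩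
      x + (0# - y)           ≈⟨ +-congˡ (+-identityˡ _) ⟩
      x - y                  ∎

    ⊖-homo : ∀ m n → ⟦ m ℤ.⊖ n ⟧ ≈ m ×ᵣ 1# - n ×ᵣ 1#
    ⊖-homo m       zero    = sym (trans (+-congˡ -0#≈0#) (+-identityʳ _))
    ⊖-homo zero    (suc n) = sym (+-identityˡ _)
    ⊖-homo (suc m) (suc n) = begin
      ⟦ suc m ℤ.⊖ suc n ⟧            ≡⟨ ≡.cong ⟦_⟧ (ℤ.[1+m]⊖[1+n]≡m⊖n m n) ⟩
      ⟦ m ℤ.⊖ n ⟧                    ≈⟨ ⊖-homo m n ⟩
      m ×ᵣ 1# - n ×ᵣ 1#                ≈⟨ cancel 1# _ _ ⟨
      (1# + m ×ᵣ 1#) - (1# + n ×ᵣ 1#)  ≈⟨ +-cong (1+× m 1#) (-‿cong (1+× n 1#)) ⟨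
      suc m ×ᵣ 1# - suc n ×ᵣ 1#        ∎

    +-homo : ∀ x y → ⟦ x ℤ.+ y ⟧ ≈ ⟦ x ⟧ + ⟦ y ⟧
    +-homo (+ m)    (+ n)    = ×-homo-+ 1# m n
    +-homo (+ m)    -[1+ n ] = ⊖-homo m (suc n)
    +-homo -[1+ m ] (+ n)    = trans (⊖-homo n (suc m)) (+-comm _ _)
    +-homo -[1+ m ] -[1+ n ] = begin
      - (suc (suc (m ℕ.+ n)) ×ᵣ 1#)    ≡⟨ ≡.cong (λ k → - (k ×ᵣ 1#)) (ℕ.+-suc (suc m) n) ⟨
      - ((suc m ℕ.+ suc n) ×ᵣ 1#)      ≈⟨ -‿cong (×-homo-+ 1# (suc m) (suc n)) ⟩
      - (suc m ×ᵣ 1# + suc n ×ᵣ 1#)     ≈⟨ -‿+-comm _ _ ⟨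
      - (suc m ×ᵣ 1#) - suc n ×ᵣ 1#     ∎

    -‿homo : ∀ x → ⟦ ℤ.- x ⟧ ≈ - ⟦ x ⟧
    -‿homo (+ zero)   = sym -0#≈0#
    -‿homo (+ suc n)  = refl
    -‿homo -[1+ n ]   = sym (-‿involutive _)

    *-homo⁺ : ∀ m y → ⟦ + m ℤ.* y ⟧ ≈ ⟦ + m ⟧ * ⟦ y ⟧
    *-homo⁺ m (+ n) = trans (reflexive (≡.cong ⟦_⟧ (≡.sym (ℤ.pos-* m n)))) (×1-homo-* m n)
    *-homo⁺ m -[1+ n ] = begin
      ⟦ + m ℤ.* -[1+ n ] ⟧         ≡⟨ ≡.cong ⟦_⟧ (ℤ.neg-distribʳ-* (+ m) (+ suc n)) ⟨
      ⟦ ℤ.- (+ m ℤ.* + suc n) ⟧    ≈⟨ -‿homo (+ m ℤ.* + suc n) ⟩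
      - ⟦ + m ℤ.* + suc n ⟧        ≈⟨ -‿cong (*-homo⁺ m (+ suc n)) ⟩
      - (⟦ + m ⟧ * ⟦ + suc n ⟧)    ≈⟨ -‿distribʳ-* _ _ ⟩
      ⟦ + m ⟧ * ⟦ -[1+ n ] ⟧       ∎

    *-homo : ∀ x y → ⟦ x ℤ.* y ⟧ ≈ ⟦ x ⟧ * ⟦ y ⟧
    *-homo (+ m)    y = *-homo⁺ m y
    *-homo -[1+ m ] y = begin
      ⟦ -[1+ m ] ℤ.* y ⟧           ≡⟨ ≡.cong ⟦_⟧ (ℤ.neg-distribˡ-* (+ suc m) y) ⟨
      ⟦ ℤ.- (+ suc m ℤ.* y) ⟧      ≈⟨ -‿homo (+ suc m ℤ.* y) ⟩
      - ⟦ + suc m ℤ.* y ⟧          ≈⟨ -‿cong (*-homo⁺ (suc m) y) ⟩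
      - (⟦ + suc m ⟧ * ⟦ y ⟧)      ≈⟨ -‿distribˡ-* _ _ ⟩
      ⟦ -[1+ m ] ⟧ * ⟦ y ⟧         ∎

    almostCommutativeRing = AlmostCommutativeRing.fromCommutativeRing R

    morphism : AlmostCommutativeRing._-Raw-AlmostCommutative⟶_
      (CommutativeRing.rawRing ℤ.+-*-commutativeRing) almostCommutativeRing
    morphism = record
      { ⟦_⟧ = ⟦_⟧ ; +-homo = +-homo ; *-homo = *-homo ; -‿homo = -‿homo ; 0-homo = refl ; 1-homo = refl }

    -- Coefficients are compared in ℤ, so terms cancel even though equality in `R` is not assumed
    -- decidable.
    coefficients≟ : WeaklyDecidable (AlmostCommutativeRing.Induced-equivalence morphism)
    coefficients≟ x y = Maybe.map (λ x≡y → reflexive (≡.cong ⟦_⟧ x≡y)) (dec⇒maybe (x ℤ.≟ y))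

  open RingSolver (CommutativeRing.rawRing ℤ.+-*-commutativeRing) almostCommutativeRing morphism coefficients≟
    public using (solve; _:=_; _:+_; _:*_; _:-_; :-_; con) renaming (Polynomial to Expression)

  :0 :1 : ∀ {n} → Expression n
  :0 = con (+ 0)
  :1 = con (+ 1)

-- Determinants over a commutative ring

module Determinant (R : CommutativeRing 0ℓ 0ℓ) where

  open CommutativeRing R hiding (zero)
  open MatrixOperations rawRing
  private module Summation = SemiringSum semiring
  open Summation using (sum)
  open RawSemiringDefinitions (RawRing.rawSemiring rawRing) using (_^_)
  open RingProperties ring using (-‿involutive; -0#≈0#; +-inverseʳ-unique)
  open IntegerCoefficientSolver R
  open SetoidReasoning setoid

  private
    variable
      n : ℕ

    ε : ℕ → Carrier
    ε k = (- 1#) ^ k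

  Square : ℕ → Set
  Square n = Matrix Carrier n n

  infix 4 _≈ₘ_
  _≈ₘ_ : ∀ {l n} → Rel (Matrix Carrier l n) 0ℓ
  M ≈ₘ N = ∀ i j → M i j ≈ N i j

  _ᵀ : ∀ {l n} → Matrix Carrier l n → Matrix Carrier n l
  (M ᵀ) i j = M j i

  infixl 6 _[_]≔_
  _[_]≔_ : ∀ {l n} → Matrix Carrier l n → Fin l → (Fin n → Carrier) → Matrix Carrier l n
  M [ a ]≔ r = updateAt M a (const r)

  -- Opaque, so that unification does not unfold sums and determinants.
  opaque

    ∑ : (Fin n → Carrier) → Carrier
    ∑ = sum

    Det : Square n → Carrier
    Det = det

    ∑-unfold : (f : Fin n → Carrier) → ∑ f ≡ sum f
    ∑-unfold f = ≡.refl

    Det-unfold : (M : Square n) → Det M ≡ det M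
    Det-unfold M = ≡.refl

    ∑-suc : (f : Fin (suc n) → Carrier) → ∑ f ≈ f zero + ∑ (f ∘ suc)
    ∑-suc f = refl

    ∑-empty : (f : Fin 0 → Carrier) → ∑ f ≈ 0#
    ∑-empty f = refl

    ∑-cong : {f g : Fin n → Carrier} → (∀ i → f i ≈ g i) → ∑ f ≈ ∑ g
    ∑-cong = Summation.sum-cong-≋

    ∑-zero : {f : Fin n → Carrier} → (∀ i → f i ≈ 0#) → ∑ f ≈ 0#
    ∑-zero {n} f≈0 = trans (Summation.sum-cong-≋ f≈0) (Summation.sum-replicate-zero n)

    ∑-+ : (f g : Fin n → Carrier) → ∑ (λ i → f i + g i) ≈ ∑ f + ∑ g
    ∑-+ = Summation.∑-distrib-+

    ∑-comm : ∀ {m} (f : Fin m → Fin n → Carrier) → ∑ (λ i → ∑ λ j → f i j) ≈ ∑ (λ j → ∑ λ i → f i j)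
    ∑-comm = Summation.∑-comm

    *-∑ : ∀ x (f : Fin n → Carrier) → x * ∑ f ≈ ∑ λ i → x * f i
    *-∑ = Summation.*-distribˡ-sum

    ∑-* : ∀ x (f : Fin n → Carrier) → ∑ f * x ≈ ∑ λ i → f i * x
    ∑-* = Summation.*-distribʳ-sum

    laplace : (M : Square (suc n)) →
      Det M ≈ ∑ λ j → ε (toℕ j) * (M zero j * Det λ i k → M (suc i) (punchIn j k))
    laplace M = refl

    Det-cong : {M N : Square n} → M ≈ₘ N → Det M ≈ Det N
    Det-cong {zero}  M≈N = refl
    Det-cong {suc n} M≈N = Summation.sum-cong-≋ λ j →
      *-congˡ {x = ε (toℕ j)} (*-cong (M≈N zero j) (Det-cong λ i k → M≈N (suc i) (punchIn j k)))

  det-cong : {M N : Square n} → M ≈ₘ N → det M ≈ det N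
  det-cong {M = M} {N} M≈N = ≡.subst₂ _≈_ (Det-unfold M) (Det-unfold N) (Det-cong M≈N)

  private
    corner : Square (suc n) → Square n
    corner N i j = N (suc i) (suc j)

  private module _ {n : ℕ} where

    minor : Square (suc (suc n)) → Fin (suc n) → Fin (suc n) → Square n
    minor N i j k l = N (suc (punchIn i k)) (suc (punchIn j l))

    -- One summand of the expansion along the first row and then the first column; the extra `- 1#`
    -- is the sign of passing from column `j` to `suc j`.
    doubleTerm : Square (suc (suc n)) → Fin (suc n) → Fin (suc n) → Carrier
    doubleTerm N j i =
      - 1# * ε (toℕ j) * (N zero (suc j) * (ε (toℕ i) * (N (suc i) zero * Det (minor N i j))))

    -- Expanding a minor along its first column means transposing it, expanding along the first row
    -- and transposing the smaller minors back. Invariance in these two sizes is passed as an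
    -- argument, for the recursion in `Det-transpose` to supply.
    doubleLaplace : (∀ N → Det {suc n} (N ᵀ) ≈ Det N) → (∀ N → Det {n} (N ᵀ) ≈ Det N) → ∀ N →
      Det N ≈ 1# * (N zero zero * Det (corner N)) + ∑ (λ j → ∑ λ i → doubleTerm N j i)
    doubleLaplace transpose₁ transpose₀ N = trans (laplace N) (trans (∑-suc _) (+-congˡ (∑-cong λ j → begin
      - 1# * ε (toℕ j) * (N zero (suc j) * Det (λ i k → N (suc i) (punchIn (suc j) k)))
        ≈⟨ *-congˡ (*-congˡ (trans (sym (transpose₁ _)) (laplace _))) ⟩
      - 1# * ε (toℕ j) * (N zero (suc j) * ∑ λ i → ε (toℕ i) * (N (suc i) zero * Det (minor N i j ᵀ)))
        ≈⟨ *-congˡ (*-congˡ (∑-cong λ i → *-congˡ (*-congˡ (transpose₀ (minor N i j))))) ⟩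
      - 1# * ε (toℕ j) * (N zero (suc j) * ∑ λ i → ε (toℕ i) * (N (suc i) zero * Det (minor N i j)))
        ≈⟨ *-congˡ (*-∑ _ _) ⟩
      - 1# * ε (toℕ j) * ∑ (λ i → N zero (suc j) * (ε (toℕ i) * (N (suc i) zero * Det (minor N i j))))
        ≈⟨ *-∑ _ _ ⟩
      ∑ (λ i → doubleTerm N j i) ∎)))

  -- Expanding along the first row and then along the first column is symmetric
  -- under transposition.
  Det-transpose : (M : Square n) → Det (M ᵀ) ≈ Det M
  Det-transpose {zero}        M = Det-cong λ ()
  Det-transpose {suc zero}    M = Det-cong λ { zero zero → refl }
  Det-transpose {suc (suc n)} M = begin
    Det (M ᵀ)                                               ≈⟨ doubleLaplace Det-transpose Det-transpose (M ᵀ) ⟩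
    1# * (M zero zero * Det (corner M ᵀ)) + ∑ (λ j → ∑ λ i → doubleTerm (M ᵀ) j i)
      ≈⟨ +-cong (*-congˡ (*-congˡ (Det-transpose (corner M)))) (∑-comm (doubleTerm (M ᵀ))) ⟩
    1# * (M zero zero * Det (corner M)) + ∑ (λ i → ∑ λ j → doubleTerm (M ᵀ) j i)
      ≈⟨ +-congˡ (∑-cong λ i → ∑-cong λ j → trans
           (*-congˡ (*-congˡ (*-congˡ (*-congˡ (Det-transpose (minor M j i))))))
           (rearrange (ε (toℕ j)) (M (suc j) zero) (ε (toℕ i)) (M zero (suc i)) (Det (minor M j i)))) ⟩
    1# * (M zero zero * Det (corner M)) + ∑ (λ i → ∑ λ j → doubleTerm M i j)
      ≈⟨ doubleLaplace Det-transpose Det-transpose M ⟨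
    Det M                                                   ∎
    where
    rearrange : ∀ a x b y d → - 1# * a * (x * (b * (y * d))) ≈ - 1# * b * (y * (a * (x * d)))
    rearrange = solve 5 (λ a x b y d → :- :1 :* a :* (x :* (b :* (y :* d))) := :- :1 :* b :* (y :* (a :* (x :* d)))) refl

  Det-firstColumn : (M : Square (suc n)) → (∀ i → M (suc i) zero ≈ 0#) →
                    Det M ≈ M zero zero * Det λ i j → M (suc i) (suc j)
  Det-firstColumn {n} M M≈0 = begin
    Det M          ≈⟨ trans (sym (Det-transpose M)) (trans (laplace _) (∑-suc _)) ⟩
    1# * (M zero zero * Det (corner M ᵀ)) +
    ∑ (λ j → - 1# * ε (toℕ j) * (M (suc j) zero * Det λ i k → (M ᵀ) (suc i) (punchIn (suc j) k)))
      ≈⟨ +-cong (*-identityˡ _) (∑-zero λ j →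
           trans (*-congˡ (trans (*-congʳ (M≈0 j)) (zeroˡ _))) (zeroʳ _)) ⟩
    M zero zero * Det (corner M ᵀ) + 0#   ≈⟨ +-identityʳ _ ⟩
    M zero zero * Det (corner M ᵀ)        ≈⟨ *-congˡ (Det-transpose (corner M)) ⟩
    M zero zero * Det (corner M)          ∎

  []≔-∘ : ∀ {l n k} (M : Matrix Carrier l n) a r (f : Fin k → Fin n) i j →
          (M [ a ]≔ r) i (f j) ≡ ((λ i j → M i (f j)) [ a ]≔ (r ∘ f)) i j
  []≔-∘ M zero    r f zero    j = ≡.refl
  []≔-∘ M zero    r f (suc i) j = ≡.refl
  []≔-∘ M (suc a) r f zero    j = ≡.refl
  []≔-∘ M (suc a) r f (suc i) j = []≔-∘ (M ∘ suc) a r f i j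

  -- Additivity and scaling in one statement: the polarization takes c = `1#`, the shear an
  -- arbitrary c.
  Det-linear : ∀ (M : Square n) a r c s →
    Det (M [ a ]≔ (λ k → r k + c * s k)) ≈ Det (M [ a ]≔ r) + c * Det (M [ a ]≔ s)
  Det-linear {suc n} M zero r c s = begin
    Det (M [ zero ]≔ (λ k → r k + c * s k))
      ≈⟨ laplace _ ⟩
    ∑ (λ j → ε (toℕ j) * ((r j + c * s j) * minor₀ j))
      ≈⟨ ∑-cong (λ j → expand (ε (toℕ j)) (r j) c (s j) (minor₀ j)) ⟩
    ∑ (λ j → term r j + c * term s j)
      ≈⟨ ∑-+ (term r) _ ⟩
    ∑ (term r) + ∑ (λ j → c * term s j)
      ≈⟨ +-cong (sym (laplace _)) (trans (sym (*-∑ c (term s))) (*-congˡ (sym (laplace _)))) ⟩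
    Det (M [ zero ]≔ r) + c * Det (M [ zero ]≔ s) ∎
    where
    minor₀ : Fin (suc n) → Carrier
    minor₀ j = Det λ i k → M (suc i) (punchIn j k)
    term : (Fin (suc n) → Carrier) → Fin (suc n) → Carrier
    term r j = ε (toℕ j) * (r j * minor₀ j)
    expand : ∀ e x c y m → e * ((x + c * y) * m) ≈ e * (x * m) + c * (e * (y * m))
    expand = solve 5 (λ e x c y m → e :* ((x :+ c :* y) :* m) := e :* (x :* m) :+ c :* (e :* (y :* m))) refl
  Det-linear {suc n} M (suc a) r c s = begin
    Det (M [ suc a ]≔ (λ k → r k + c * s k))
      ≈⟨ row _ ⟩
    ∑ (term λ k → r k + c * s k)
      ≈⟨ ∑-cong (λ j → trans
           (*-congˡ (*-congˡ (Det-linear (minor₀ j) a (r ∘ punchIn j) c (s ∘ punchIn j))))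
           (expand (ε (toℕ j)) (M zero j) _ c _)) ⟩
    ∑ (λ j → term r j + c * term s j)
      ≈⟨ ∑-+ (term r) _ ⟩
    ∑ (term r) + ∑ (λ j → c * term s j)
      ≈⟨ +-cong (sym (row r)) (trans (sym (*-∑ c (term s))) (*-congˡ (sym (row s)))) ⟩
    Det (M [ suc a ]≔ r) + c * Det (M [ suc a ]≔ s) ∎
    where
    minor₀ : Fin (suc n) → Square n
    minor₀ j i k = M (suc i) (punchIn j k)
    term : (Fin (suc n) → Carrier) → Fin (suc n) → Carrier
    term r j = ε (toℕ j) * (M zero j * Det (minor₀ j [ a ]≔ (r ∘ punchIn j)))
    row : ∀ r → Det (M [ suc a ]≔ r) ≈ ∑ (term r)
    row r = trans (laplace _) (∑-cong λ j → *-congˡ (*-congˡ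
      (Det-cong λ i k → reflexive ([]≔-∘ (M ∘ suc) a r (punchIn j) i k))))
    expand : ∀ e x p c q → e * (x * (p + c * q)) ≈ e * (x * p) + c * (e * (x * q))
    expand = solve 5 (λ e x p c q → e :* (x :* (p :+ c :* q)) := e :* (x :* p) :+ c :* (e :* (x :* q))) refl

  -- F j k stands for the ordered pair of distinct positions j and punchIn j k; for
  -- i ≤ k, the pairs (inject₁ i , k) and (suc k , i) are the two orders of i < suc k.
  ∑-antisymmetric : (F : Fin (suc n) → Fin n → Carrier) →
    (∀ i k → toℕ i ℕ.≤ toℕ k → F (inject₁ i) k + F (suc k) i ≈ 0#) →
    ∑ (λ j → ∑ (F j)) ≈ 0#
  ∑-antisymmetric {zero}  F anti = ∑-zero λ j → ∑-empty (F j)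
  ∑-antisymmetric {suc n} F anti = begin
    ∑ (λ j → ∑ (F j))
      ≈⟨ ∑-suc _ ⟩
    -- The pairs that involve position zero are the row `F zero` and the column `F (suc j) zero`,
    -- which cancel against each other; the rest has the same shape one size down.
    ∑ (F zero) + ∑ (λ j → ∑ (F (suc j)))
      ≈⟨ +-congˡ (trans (∑-cong λ j → ∑-suc (F (suc j))) (∑-+ _ _)) ⟩
    ∑ (F zero) + (∑ (λ j → F (suc j) zero) + ∑ (λ j → ∑ λ k → F (suc j) (suc k)))
      ≈⟨ +-assoc _ _ _ ⟨
    ∑ (F zero) + ∑ (λ j → F (suc j) zero) + ∑ (λ j → ∑ λ k → F (suc j) (suc k))
      ≈⟨ +-cong (sym (∑-+ (F zero) _))
                (∑-antisymmetric (λ j k → F (suc j) (suc k)) λ i k i≤k → anti (suc i) (suc k) (s≤s i≤k)) ⟩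
    ∑ (λ k → F zero k + F (suc k) zero) + 0#
      ≈⟨ +-identityʳ _ ⟩
    ∑ (λ k → F zero k + F (suc k) zero)
      ≈⟨ ∑-zero (λ k → anti zero k z≤n) ⟩
    0# ∎

  punchIn-inject₁ : ∀ (i k : Fin n) → toℕ i ℕ.≤ toℕ k → punchIn (inject₁ i) k ≡ suc k
  punchIn-inject₁ zero    k       _         = ≡.refl
  punchIn-inject₁ (suc i) (suc k) (s≤s i≤k) = ≡.cong suc (punchIn-inject₁ i k i≤k)

  punchIn-suc : ∀ (i k : Fin n) → toℕ i ℕ.≤ toℕ k → punchIn (suc k) i ≡ inject₁ i
  punchIn-suc zero    k       _         = ≡.refl
  punchIn-suc (suc i) (suc k) (s≤s i≤k) = ≡.cong suc (punchIn-suc i k i≤k)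

  -- Both sides enumerate the complement of the positions i and k + 1, deleted in the two possible
  -- orders, so the two orders of a pair have the same minor.
  punchIn-punchIn : ∀ (i k : Fin (suc n)) l → toℕ i ℕ.≤ toℕ k →
    punchIn (inject₁ i) (punchIn k l) ≡ punchIn (suc k) (punchIn i l)
  punchIn-punchIn zero    k       l       _         = ≡.refl
  punchIn-punchIn (suc i) (suc k) zero    _         = ≡.refl
  punchIn-punchIn (suc i) (suc k) (suc l) (s≤s i≤k) = ≡.cong suc (punchIn-punchIn i k l i≤k)

  -- Expansion along two rows is a sum over ordered pairs of distinct columns. Exchanging the two
  -- columns keeps the product of entries, as the rows agree, and the minor, but flips the sign.
  Det-firstRowsEqual : (M : Square (suc (suc n))) → (∀ k → M zero k ≈ M (suc zero) k) → Det M ≈ 0#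
  Det-firstRowsEqual {n} M M₀≈M₁ = trans
    (trans (laplace M) (∑-cong λ j → trans
      (*-congˡ (trans (*-congˡ (laplace _)) (*-∑ (M zero j) _))) (*-∑ (ε (toℕ j)) _)))
    (∑-antisymmetric F anti)
    where
    minor₂ : Fin (suc (suc n)) → Fin (suc n) → Square n
    minor₂ j k i l = M (suc (suc i)) (punchIn j (punchIn k l))
    F : Fin (suc (suc n)) → Fin (suc n) → Carrier
    F j k = ε (toℕ j) * (M zero j * (ε (toℕ k) * (M (suc zero) (punchIn j k) * Det (minor₂ j k))))
    cancel : ∀ a x b y d → a * (x * (b * (y * d))) + (- 1# * b) * (y * (a * (x * d))) ≈ 0#
    cancel = solve 5 (λ a x b y d → a :* (x :* (b :* (y :* d))) :+ (:- :1 :* b) :* (y :* (a :* (x :* d))) := :0) refl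
    anti : ∀ i k → toℕ i ℕ.≤ toℕ k → F (inject₁ i) k + F (suc k) i ≈ 0#
    anti i k i≤k = begin
      F (inject₁ i) k + F (suc k) i
        ≈⟨ +-cong
             (*-cong (reflexive (≡.cong ε (Fin.toℕ-inject₁ i)))
               (*-congˡ (*-congˡ (*-cong (trans (reflexive (≡.cong (M (suc zero)) (punchIn-inject₁ i k i≤k)))
                                                (sym (M₀≈M₁ (suc k))))
                 (Det-cong λ p l → reflexive (≡.cong (M (suc (suc p))) (punchIn-punchIn i k l i≤k)))))))
             (*-congˡ (*-congˡ (*-congˡ (*-congʳ
               (trans (reflexive (≡.cong (M (suc zero)) (punchIn-suc i k i≤k))) (sym (M₀≈M₁ (inject₁ i)))))))) ⟩
      ε (toℕ i) * (M zero (inject₁ i) * (ε (toℕ k) * (M zero (suc k) * Det (minor₂ (suc k) i)))) +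
      - 1# * ε (toℕ k) * (M zero (suc k) * (ε (toℕ i) * (M zero (inject₁ i) * Det (minor₂ (suc k) i))))
        ≈⟨ cancel (ε (toℕ i)) (M zero (inject₁ i)) (ε (toℕ k)) (M zero (suc k)) (Det (minor₂ (suc k) i)) ⟩
      0# ∎

  AlternatingAt : Fin n → Fin n → Set
  AlternatingAt {n} a b = (M : Square n) → (∀ k → M a k ≈ M b k) → Det M ≈ 0#

  transposeRows : Fin n → Fin n → Square n → Square n
  transposeRows a b M i = M (PC.transpose a b i)

  -- Polarization: the determinant with r + s in both rows vanishes.
  antisymmetricAt : ∀ {a b : Fin n} → a ≢ b → AlternatingAt a b →
                    ∀ M → Det (transposeRows a b M) ≈ - Det M
  antisymmetricAt {n} {a} {b} a≢b alt M =
    trans (Det-cong λ i k → reflexive (≡.cong (λ r → r k) (transposed i)))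
      (trans (+-inverseʳ-unique (D (M a) (M b)) (D (M b) (M a)) cancel)
        (-‿cong (Det-cong λ i k → reflexive (≡.cong (λ r → r k) (original i)))))
    where
    D : (Fin n → Carrier) → (Fin n → Carrier) → Carrier
    D r s = Det (M [ a ]≔ r [ b ]≔ s)

    transposed : ∀ i → transposeRows a b M i ≡ (M [ a ]≔ M b [ b ]≔ M a) i
    transposed i with i Fin.≟ a
    ... | yes ≡.refl = ≡.sym (≡.trans (Vector.updateAt-minimal i b _ a≢b) (Vector.updateAt-updates i M))
    ... | no i≢a with i Fin.≟ b
    ...   | yes ≡.refl = ≡.sym (Vector.updateAt-updates i _)
    ...   | no i≢b = ≡.sym (≡.trans (Vector.updateAt-minimal i b _ i≢b) (Vector.updateAt-minimal i a M i≢a))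

    original : ∀ i → (M [ a ]≔ M a [ b ]≔ M b) i ≡ M i
    original i with i Fin.≟ b
    ... | yes ≡.refl = Vector.updateAt-updates i _
    ... | no i≢b = ≡.trans (Vector.updateAt-minimal i b _ i≢b) (Vector.updateAt-id-local a M ≡.refl i)

    swapUpdates : ∀ r s → D r s ≈ Det (M [ b ]≔ s [ a ]≔ r)
    swapUpdates r s = Det-cong λ i k →
      reflexive (≡.cong (λ u → u k) (Vector.updateAt-commutes b a (a≢b ∘ ≡.sym) M i))

    vanish : ∀ r → D r r ≈ 0#
    vanish r = alt _ λ k → reflexive (≡.cong (λ u → u k)
      (≡.trans (≡.trans (Vector.updateAt-minimal a b _ a≢b) (Vector.updateAt-updates a M))
               (≡.sym (Vector.updateAt-updates b _))))

    linearʳ : ∀ r s t → D r (λ k → s k + 1# * t k) ≈ D r s + 1# * D r t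
    linearʳ r s t = Det-linear _ b s 1# t

    linearˡ : ∀ r s t → D (λ k → r k + 1# * s k) t ≈ D r t + 1# * D s t
    linearˡ r s t = trans (swapUpdates _ t)
      (trans (Det-linear _ a r 1# s) (+-cong (sym (swapUpdates r t)) (*-congˡ (sym (swapUpdates s t)))))

    cancel : D (M a) (M b) + D (M b) (M a) ≈ 0#
    cancel = begin
      D r s + D s r
        ≈⟨ collect (D r s) (D s r) ⟨
      (0# + 1# * D s r) + 1# * (D r s + 1# * 0#)
        ≈⟨ +-cong (+-congʳ (vanish r)) (*-congˡ (+-congˡ (*-congˡ (vanish s)))) ⟨
      (D r r + 1# * D s r) + 1# * (D r s + 1# * D s s)
        ≈⟨ +-cong (linearˡ r s r) (*-congˡ (linearˡ r s s)) ⟨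
      D (λ k → r k + 1# * s k) r + 1# * D (λ k → r k + 1# * s k) s
        ≈⟨ linearʳ _ r s ⟨
      D (λ k → r k + 1# * s k) (λ k → r k + 1# * s k)
        ≈⟨ vanish _ ⟩
      0# ∎
      where
      r = M a
      s = M b
      collect : ∀ p q → (0# + 1# * q) + 1# * (p + 1# * 0#) ≈ p + q
      collect = solve 2 (λ p q → (:0 :+ :1 :* q) :+ :1 :* (p :+ :1 :* :0) := p :+ q) refl

  private
    Alternating : ℕ → Set
    Alternating n = ∀ {a b : Fin n} → a ≢ b → AlternatingAt a b

    alternating-suc : Alternating n → ∀ {a b : Fin n} → a ≢ b → AlternatingAt (suc a) (suc b)
    alternating-suc alt a≢b M e = trans (laplace M) (∑-zero λ j → trans
      (*-congˡ (trans (*-congˡ (alt a≢b _ λ k → e (punchIn j k))) (zeroʳ _)))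
      (zeroʳ _))

    -- A swap of the first two rows moves an equal pair at `zero` and `suc (suc b)` to `suc zero`
    -- and `suc (suc b)`; both rows then survive in every minor of the first-row expansion.
    alternating-zero : Alternating n → ∀ (b : Fin n) → AlternatingAt zero (suc b)
    alternating-zero alt zero    M e = Det-firstRowsEqual M e
    alternating-zero alt (suc b) M e = begin
      Det M                                         ≈⟨ -‿involutive _ ⟨
      - - Det M                                     ≈⟨ -‿cong (antisymmetricAt (λ ()) Det-firstRowsEqual M) ⟨
      - Det (transposeRows zero (suc zero) M)
        ≈⟨ -‿cong (alternating-suc alt {zero} {suc b} (λ ()) (transposeRows zero (suc zero) M) e) ⟩
      - 0#                                          ≈⟨ -0#≈0# ⟩
      0#                                            ∎

  Det-alternating : ∀ {a b : Fin n} → a ≢ b → AlternatingAt a b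
  Det-alternating {a = zero}  {zero}  a≢b M e = contradiction ≡.refl a≢b
  Det-alternating {a = zero}  {suc b} a≢b M e = alternating-zero Det-alternating b M e
  Det-alternating {a = suc a} {zero}  a≢b M e = alternating-zero Det-alternating a M (sym ∘ e)
  Det-alternating {a = suc a} {suc b} a≢b M e = alternating-suc Det-alternating (a≢b ∘ ≡.cong suc) M e

  transpose-self : ∀ (a i : Fin n) → PC.transpose a a i ≡ i
  transpose-self a i with i Fin.≟ a
  ... | yes i≡a = ≡.sym i≡a
  ... | no i≢a with i Fin.≟ a
  ...   | yes i≡a = ≡.sym i≡a
  ...   | no _    = ≡.refl

  -- The swap of rows and the swap of columns contribute one sign each.
  Det-transposeIndices : ∀ (a b : Fin n) M →
    Det (λ i j → M (PC.transpose a b i) (PC.transpose a b j)) ≈ Det M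
  Det-transposeIndices a b M with a Fin.≟ b
  ... | yes ≡.refl = Det-cong λ i j → reflexive (≡.cong₂ M (transpose-self a i) (transpose-self a j))
  ... | no a≢b = begin
    Det (transposeRows a b (λ i j → M i (τ j)))       ≈⟨ antisymmetricAt a≢b (Det-alternating a≢b) _ ⟩
    - Det (λ i j → M i (τ j))                         ≈⟨ -‿cong (Det-transpose (λ i j → M i (τ j))) ⟨
    - Det (transposeRows a b (M ᵀ))                   ≈⟨ -‿cong (antisymmetricAt a≢b (Det-alternating a≢b) (M ᵀ)) ⟩
    - - Det (M ᵀ)                                     ≈⟨ -‿involutive _ ⟩
    Det (M ᵀ)                                         ≈⟨ Det-transpose M ⟩
    Det M                                             ∎
    where τ = PC.transpose a b

  -- Since rows and columns move together, transpositions can be peeled off without tracking a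
  -- parity. This makes one system comparable under two enumerations of its unknowns.
  Det-reindex : ∀ {m} (π : Permutation m n) (M : Square n) →
                Det (λ i j → M (π ⟨$⟩ʳ i) (π ⟨$⟩ʳ j)) ≈ Det M
  Det-reindex π M with Perm.↔⇒≡ π
  ... | ≡.refl = trans
    (Det-cong λ i j → reflexive (≡.sym (≡.cong₂ M (eval-decompose π i) (eval-decompose π j))))
    (go (decompose π) M)
    where
    go : ∀ τs M → Det (λ i j → M (eval τs ⟨$⟩ʳ i) (eval τs ⟨$⟩ʳ j)) ≈ Det M
    go []             M = refl
    go ((a , b) ∷ τs) M = trans
      (Det-transposeIndices a b (λ i j → M (eval τs ⟨$⟩ʳ i) (eval τs ⟨$⟩ʳ j))) (go τs M)

  shear : (Fin n → Carrier) → Matrix Carrier (suc n) (suc n) → Matrix Carrier (suc n) (suc n)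
  shear c M zero    = M zero
  shear c M (suc i) = λ k → M (suc i) k + c i * M zero k

  -- The list in `go` bounds the support of `c`. Each step sets `c` to zero at the head `a` by
  -- linearity in row `suc a`; the correction has that row equal to row `zero` and vanishes.
  Det-shear : ∀ (c : Fin n → Carrier) M → Det (shear c M) ≈ Det M
  Det-shear {n} c M = go (List.allFin n) c (λ i → inj₁ (∈-allFin i))
    where
    go : ∀ as c → (∀ i → i ∈ as ⊎ c i ≈ 0#) → Det (shear c M) ≈ Det M
    go [] c c≈0 = Det-cong λ
      { zero    k → refl
      ; (suc i) k → trans (+-congˡ (trans (*-congʳ (zeroAt i (c≈0 i))) (zeroˡ _))) (+-identityʳ _)
      }
      where
      zeroAt : ∀ i → i ∈ [] ⊎ c i ≈ 0# → c i ≈ 0#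
      zeroAt i (inj₂ c≈0) = c≈0
    go (a ∷ as) c support = begin
      Det (shear c M)
        ≈⟨ Det-cong sheared ⟩
      Det (N [ suc a ]≔ (λ k → M (suc a) k + c a * M zero k))
        ≈⟨ Det-linear N (suc a) (M (suc a)) (c a) (M zero) ⟩
      Det (N [ suc a ]≔ M (suc a)) + c a * Det (N [ suc a ]≔ M zero)
        ≈⟨ +-cong (Det-cong unsheared) (*-congˡ (Det-alternating {a = zero} {suc a} (λ ()) _
             λ k → reflexive (≡.cong (λ r → r k) (≡.sym (Vector.updateAt-updates (suc a) N))))) ⟩
      Det N + c a * 0#     ≈⟨ trans (+-congˡ (zeroʳ _)) (+-identityʳ _) ⟩
      Det N                ≈⟨ go as c′ support′ ⟩
      Det M                ∎
      where
      c′ = updateAt c a (const 0#)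
      N = shear c′ M
      support′ : ∀ i → i ∈ as ⊎ c′ i ≈ 0#
      support′ i with i Fin.≟ a | support i
      ... | yes ≡.refl | _                   = inj₂ (reflexive (Vector.updateAt-updates i c))
      ... | no i≢a     | inj₁ (here i≡a)     = contradiction i≡a i≢a
      ... | no i≢a     | inj₁ (there i∈as)   = inj₁ i∈as
      ... | no i≢a     | inj₂ cᵢ≈0           = inj₂ (trans (reflexive (Vector.updateAt-minimal i a c i≢a)) cᵢ≈0)
      sheared : shear c M ≈ₘ N [ suc a ]≔ (λ k → M (suc a) k + c a * M zero k)
      sheared zero    k = refl
      sheared (suc i) k with i Fin.≟ a
      ... | yes ≡.refl = reflexive (≡.cong (λ r → r k) (≡.sym (Vector.updateAt-updates i (N ∘ suc))))
      ... | no i≢a     = trans (+-congˡ (*-congʳ (reflexive (≡.sym (Vector.updateAt-minimal i a c i≢a)))))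
                           (reflexive (≡.cong (λ r → r k) (≡.sym (Vector.updateAt-minimal i a (N ∘ suc) i≢a))))
      unsheared : N [ suc a ]≔ M (suc a) ≈ₘ N
      unsheared zero    k = refl
      unsheared (suc i) k with i Fin.≟ a
      ... | yes ≡.refl = trans (reflexive (≡.cong (λ r → r k) (Vector.updateAt-updates i (N ∘ suc))))
                           (sym (trans (+-congˡ (trans (*-congʳ (reflexive (Vector.updateAt-updates i c))) (zeroˡ _))) (+-identityʳ _)))
      ... | no i≢a     = reflexive (≡.cong (λ r → r k) (Vector.updateAt-minimal i a (N ∘ suc) i≢a))

  -- A Schur complement; the pivot `1#` makes it free of division.
  Det-pivot : (M : Square (suc n)) → M zero zero ≈ 1# →
              Det M ≈ Det λ i j → M (suc i) (suc j) - M (suc i) zero * M zero (suc j)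
  Det-pivot {n} M M₀₀≈1 = begin
    Det M                ≈⟨ Det-shear c M ⟨
    Det (shear c M)      ≈⟨ Det-firstColumn (shear c M) cleared ⟩
    M zero zero * Det (λ i j → shear c M (suc i) (suc j))
                         ≈⟨ trans (*-congʳ M₀₀≈1) (*-identityˡ _) ⟩
    Det (λ i j → shear c M (suc i) (suc j))
      ≈⟨ Det-cong (λ i j → negate (M (suc i) (suc j)) (M (suc i) zero) (M zero (suc j))) ⟩
    Det (λ i j → M (suc i) (suc j) - M (suc i) zero * M zero (suc j)) ∎
    where
    c : Fin n → Carrier
    c i = - M (suc i) zero
    negate : ∀ x y z → x + - y * z ≈ x - y * z
    negate = solve 3 (λ x y z → x :+ :- y :* z := x :- y :* z) refl
    cleared : ∀ i → shear c M (suc i) zero ≈ 0#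
    cleared i = trans (+-congˡ (trans (*-congˡ M₀₀≈1) (*-identityʳ _))) (-‿inverseʳ _)

  -- Diagonal matrices and Gaussian elimination

  ∑-diag : ∀ (f d : Fin n → Carrier) k → ∑ (λ i → f i * diag d i k) ≈ f k * d k
  ∑-diag {suc n} f d zero = begin
    ∑ (λ i → f i * diag d i zero)             ≈⟨ ∑-suc _ ⟩
    f zero * d zero + ∑ (λ i → f (suc i) * 0#)  ≈⟨ +-congˡ (∑-zero λ i → zeroʳ _) ⟩
    f zero * d zero + 0#                      ≈⟨ +-identityʳ _ ⟩
    f zero * d zero                           ∎
  ∑-diag {suc n} f d (suc k) = begin
    ∑ (λ i → f i * diag d i (suc k))          ≈⟨ ∑-suc _ ⟩
    f zero * 0# + ∑ (λ i → f (suc i) * diag (d ∘ suc) i k)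
                                              ≈⟨ +-cong (zeroʳ _) (∑-diag (f ∘ suc) (d ∘ suc) k) ⟩
    0# + f (suc k) * d (suc k)                ≈⟨ +-identityˡ _ ⟩
    f (suc k) * d (suc k)                     ∎

  ∑-I : ∀ (f : Fin n → Carrier) k → ∑ (λ i → f i * I n i k) ≈ f k
  ∑-I f k = trans (∑-diag f _ k) (*-identityʳ _)

  diag-transpose : ∀ (d : Fin n → Carrier) i j → diag d i j ≈ diag d j i
  diag-transpose d i j with i Fin.≟ j
  ... | yes ≡.refl rewrite dec-true (i Fin.≟ i) ≡.refl = refl
  ... | no i≢j rewrite dec-false (j Fin.≟ i) (i≢j ∘ ≡.sym) = refl

  ⊡-diag : ∀ {l} (M : Matrix Carrier l n) d i j → (M ⊡ diag d) i j ≈ M i j * d j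
  ⊡-diag M d i j = trans (reflexive (≡.sym (∑-unfold _))) (∑-diag (M i) d j)

  diag-⊡ : ∀ {l} (M : Matrix Carrier n l) d i j → (diag d ⊡ M) i j ≈ d i * M i j
  diag-⊡ M d i j = begin
    (diag d ⊡ M) i j                        ≡⟨ ∑-unfold _ ⟨
    ∑ (λ k → diag d i k * M k j)
      ≈⟨ ∑-cong (λ k → trans (*-comm _ _) (*-congˡ (diag-transpose d i k))) ⟩
    ∑ (λ k → M k j * diag d k i)            ≈⟨ ∑-diag (λ k → M k j) d i ⟩
    M i j * d i                             ≈⟨ *-comm _ _ ⟩
    d i * M i j                             ∎

  -- Gaussian elimination of the first a unknowns of the system x = G x: the
  -- matrix X expresses all unknowns through the remaining b ones.
  module _ {b : ℕ} where

    private
      -- The system after the equation of `inj₁ zero` has been substituted into all the others.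
      contract : ∀ {a} → (Fin (suc a) ⊎ Fin b → Fin (suc a) ⊎ Fin b → Carrier) →
                 Fin a ⊎ Fin b → Fin a ⊎ Fin b → Carrier
      contract G x y = G (Sum.map₁ suc x) (Sum.map₁ suc y) +
                       G (Sum.map₁ suc x) (inj₁ zero) * G (inj₁ zero) (Sum.map₁ suc y)

    -- Unknowns are removed in the order of their indices, whatever `_≺_` is; the strict order only
    -- rules out cyclic dependence, which keeps each pivot equal to `1#`. The solution `X` is an
    -- argument so that the remaining matrix comes out in closed form.
    eliminate : ∀ {a} (G : Fin a ⊎ Fin b → Fin a ⊎ Fin b → Carrier)
      {_≺_ : Rel (Fin a) 0ℓ} → Transitive _≺_ → (∀ i → ¬ i ≺ i) →
      (∀ i j → i ≺ j ⊎ G (inj₁ i) (inj₁ j) ≈ 0#) →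
      (X : Fin a ⊎ Fin b → Fin b → Carrier) →
      (∀ l k → X (inj₂ l) k ≈ I b l k) →
      (∀ i k → X (inj₁ i) k ≈ ∑ λ y → G (inj₁ i) (splitAt a y) * X (splitAt a y) k) →
      Det (λ x y → I (a ℕ.+ b) x y - G (splitAt a x) (splitAt a y)) ≈
      Det (λ l k → I b l k - ∑ λ y → G (inj₂ l) (splitAt a y) * X (splitAt a y) k)
    eliminate {zero} G ≺-trans ≺-irrefl acyclic X X₂ X₁ = Det-cong λ l k →
      +-congˡ (-‿cong (sym (trans (∑-cong λ y → *-congˡ (X₂ y k)) (∑-I (λ y → G (inj₂ l) (inj₂ y)) k))))
    eliminate {suc a} G {_≺_} ≺-trans ≺-irrefl acyclic X X₂ X₁ = begin
      Det (λ x y → I (suc a ℕ.+ b) x y - G (splitAt (suc a) x) (splitAt (suc a) y))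
        ≈⟨ Det-pivot _ (trans (+-congˡ (trans (-‿cong G₀₀≈0) -0#≈0#)) (+-identityʳ _)) ⟩
      Det (λ x y → (I (a ℕ.+ b) x y - G (↑ x) (↑ y)) - (0# - G (↑ x) (inj₁ zero)) * (0# - G (inj₁ zero) (↑ y)))
        ≈⟨ Det-cong (λ x y → contracted (I (a ℕ.+ b) x y) _ _ _) ⟩
      Det (λ x y → I (a ℕ.+ b) x y - contract G (splitAt a x) (splitAt a y))
        ≈⟨ eliminate (contract G) {λ i j → suc i ≺ suc j} ≺-trans (λ i → ≺-irrefl (suc i)) acyclic′
             (X ∘ Sum.map₁ suc) X₂ (λ i k → trans (X₁ (suc i) k) (substituted (inj₁ i) k)) ⟩
      Det (λ l k → I b l k - ∑ λ y → contract G (inj₂ l) (splitAt a y) * X (↑ y) k)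
        ≈⟨ Det-cong (λ l k → +-congˡ (-‿cong (substituted (inj₂ l) k))) ⟨
      Det (λ l k → I b l k - ∑ λ y → G (inj₂ l) (splitAt (suc a) y) * X (splitAt (suc a) y) k) ∎
      where
      ↑ : Fin (a ℕ.+ b) → Fin (suc a) ⊎ Fin b
      ↑ y = Sum.map₁ suc (splitAt a y)

      contracted : ∀ i x y z → (i - x) - (0# - y) * (0# - z) ≈ i - (x + y * z)
      contracted = solve 4 (λ i x y z → (i :- x) :- (:0 :- y) :* (:0 :- z) := i :- (x :+ y :* z)) refl

      G₀₀≈0 : G (inj₁ zero) (inj₁ zero) ≈ 0#
      G₀₀≈0 with acyclic zero zero
      ... | inj₁ 0≺0 = contradiction 0≺0 (≺-irrefl zero)
      ... | inj₂ e   = e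

      -- A coefficient created by the substitution comes from a path through `zero`, so transitivity
      -- keeps the support inside `_≺_`; irreflexivity then gives the next pivot.
      acyclic′ : ∀ i j → suc i ≺ suc j ⊎ contract G (inj₁ i) (inj₁ j) ≈ 0#
      acyclic′ i j with acyclic (suc i) (suc j) | acyclic (suc i) zero | acyclic zero (suc j)
      ... | inj₁ i≺j | _        | _        = inj₁ i≺j
      ... | inj₂ _   | inj₁ i≺0 | inj₁ 0≺j = inj₁ (≺-trans i≺0 0≺j)
      ... | inj₂ e   | inj₂ f   | _        = inj₂ (trans (+-cong e (trans (*-congʳ f) (zeroˡ _))) (+-identityˡ _))
      ... | inj₂ e   | inj₁ _   | inj₂ f   = inj₂ (trans (+-cong e (trans (*-congˡ f) (zeroʳ _))) (+-identityˡ _))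

      X₀ : ∀ k → X (inj₁ zero) k ≈ ∑ λ y → G (inj₁ zero) (↑ y) * X (↑ y) k
      X₀ k = begin
        X (inj₁ zero) k      ≈⟨ X₁ zero k ⟩
        ∑ (λ y → G (inj₁ zero) (splitAt (suc a) y) * X (splitAt (suc a) y) k)
                             ≈⟨ ∑-suc _ ⟩
        G (inj₁ zero) (inj₁ zero) * X (inj₁ zero) k + ∑ (λ y → G (inj₁ zero) (↑ y) * X (↑ y) k)
                             ≈⟨ +-congʳ (trans (*-congʳ G₀₀≈0) (zeroˡ _)) ⟩
        0# + ∑ (λ y → G (inj₁ zero) (↑ y) * X (↑ y) k)
                             ≈⟨ +-identityˡ _ ⟩
        ∑ (λ y → G (inj₁ zero) (↑ y) * X (↑ y) k) ∎

      substituted : ∀ x k →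
        ∑ (λ y → G (Sum.map₁ suc x) (splitAt (suc a) y) * X (splitAt (suc a) y) k) ≈
        ∑ (λ y → contract G x (splitAt a y) * X (↑ y) k)
      substituted x k = begin
        ∑ (λ y → G x′ (splitAt (suc a) y) * X (splitAt (suc a) y) k)
          ≈⟨ ∑-suc _ ⟩
        G x′ (inj₁ zero) * X (inj₁ zero) k + ∑ (λ y → G x′ (↑ y) * X (↑ y) k)
          ≈⟨ +-congʳ (trans (*-congˡ (X₀ k)) (*-∑ _ _)) ⟩
        ∑ (λ y → G x′ (inj₁ zero) * (G (inj₁ zero) (↑ y) * X (↑ y) k)) + ∑ (λ y → G x′ (↑ y) * X (↑ y) k)
          ≈⟨ ∑-+ _ _ ⟨
        ∑ (λ y → G x′ (inj₁ zero) * (G (inj₁ zero) (↑ y) * X (↑ y) k) + G x′ (↑ y) * X (↑ y) k)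
          ≈⟨ ∑-cong (λ y → factor (G x′ (inj₁ zero)) (G (inj₁ zero) (↑ y)) (X (↑ y) k) (G x′ (↑ y))) ⟩
        ∑ (λ y → contract G x (splitAt a y) * X (↑ y) k) ∎
        where
        x′ = Sum.map₁ suc x
        factor : ∀ p q x g → p * (q * x) + g * x ≈ (g + p * q) * x
        factor = solve 4 (λ p q x g → p :* (q :* x) :+ g :* x := (g :+ p :* q) :* x) refl

  -- Systems with two terms per equation

  -- No equation of the network has more than two terms on its right side, so two pointers and two
  -- coefficients describe it. A missing term has coefficient `0#` and a placeholder pointer.
  module SparseSystem {S : Set} (_≟_ : DecidableEquality S) (α β : S → Carrier) (p q : S → S) where

    private
      ⟦_≡_⟧ : S → S → Carrier
      ⟦ x ≡ y ⟧ = if does (x ≟ y) then 1# else 0#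

      G : S → S → Carrier
      G x y = α x * ⟦ y ≡ p x ⟧ + β x * ⟦ y ≡ q x ⟧

    apply : (S → Carrier) → S → Carrier
    apply f x = α x * f (p x) + β x * f (q x)

    systemDet : ∀ {N} → Fin N ↔ S → Carrier
    systemDet {N} e = Det λ x y → I N x y - G (Inverse.to e x) (Inverse.to e y)

    -- Two enumerations differ by one permutation acting on rows and columns, so the determinant
    -- belongs to the system alone. Here the two eliminations meet.
    systemDet-unique : ∀ {M N} (e : Fin M ↔ S) (f : Fin N ↔ S) → systemDet e ≈ systemDet f
    systemDet-unique {M} {N} e f = trans
      (Det-cong λ x y → +-cong (I-reindex x y) (-‿cong (reflexive (≡.sym (≡.cong₂ G (to-π x) (to-π y))))))
      (Det-reindex π _)
      where
      π : Permutation M N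
      π = ↔-trans e (↔-sym f)
      to-π : ∀ x → Inverse.to f (π ⟨$⟩ʳ x) ≡ Inverse.to e x
      to-π x = Inverse.strictlyInverseˡ f (Inverse.to e x)
      I-reindex : ∀ x y → I M x y ≈ I N (π ⟨$⟩ʳ x) (π ⟨$⟩ʳ y)
      I-reindex x y = reflexive (≡.cong (if_then 1# else 0#) (does-⇔
        (mk⇔ (≡.cong (π ⟨$⟩ʳ_)) (Injection.injective (↔⇒↣ π)))
        (x Fin.≟ y) ((π ⟨$⟩ʳ x) Fin.≟ (π ⟨$⟩ʳ y))))

    private
      ∑-indicator : ∀ {N} (e : Fin N ↔ S) (f : S → Carrier) s →
                    ∑ (λ y → f (Inverse.to e y) * ⟦ Inverse.to e y ≡ s ⟧) ≈ f s
      ∑-indicator {N} e f s = begin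
        ∑ (λ y → f (to y) * ⟦ to y ≡ s ⟧)
          ≈⟨ ∑-cong (λ y → *-congˡ (reflexive (≡.cong (if_then 1# else 0#) (does-⇔
               (mk⇔ (λ { ≡.refl → ≡.sym (strictlyInverseʳ y) }) (λ { ≡.refl → strictlyInverseˡ s }))
               (to y ≟ s) (y Fin.≟ from s))))) ⟩
        ∑ (λ y → f (to y) * I N y (from s))   ≈⟨ ∑-I (f ∘ to) (from s) ⟩
        f (to (from s))                       ≡⟨ ≡.cong f (strictlyInverseˡ s) ⟩
        f s                                   ∎
        where open Inverse e

      ∑-G : ∀ {N} (e : Fin N ↔ S) (f : S → Carrier) x →
            ∑ (λ y → G x (Inverse.to e y) * f (Inverse.to e y)) ≈ apply f x
      ∑-G e f x = begin
        ∑ (λ y → G x (to y) * f (to y))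
          ≈⟨ ∑-cong (λ y → distribute (α x) (β x) ⟦ to y ≡ p x ⟧ ⟦ to y ≡ q x ⟧ (f (to y))) ⟩
        ∑ (λ y → α x * (f (to y) * ⟦ to y ≡ p x ⟧) + β x * (f (to y) * ⟦ to y ≡ q x ⟧))
          ≈⟨ trans (∑-+ _ _) (+-cong (sym (*-∑ _ _)) (sym (*-∑ _ _))) ⟩
        α x * ∑ (λ y → f (to y) * ⟦ to y ≡ p x ⟧) + β x * ∑ (λ y → f (to y) * ⟦ to y ≡ q x ⟧)
          ≈⟨ +-cong (*-congˡ (∑-indicator e f (p x))) (*-congˡ (∑-indicator e f (q x))) ⟩
        apply f x ∎
        where
        open Inverse e
        distribute : ∀ a b u v f → (a * u + b * v) * f ≈ a * (f * u) + b * (f * v)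
        distribute = solve 5 (λ a b u v f → (a :* u :+ b :* v) :* f := a :* (f :* u) :+ b :* (f :* v)) refl

    -- A pointer has to respect `_≺_` only where its coefficient is nonzero, because a placeholder
    -- may point back at its own unknown.
    eliminateSparse : ∀ {a b} {A : Set} (eA : Fin a ↔ A) (e : (A ⊎ Fin b) ↔ S)
      {_≺_ : Rel S 0ℓ} → Transitive _≺_ → (∀ x → ¬ x ≺ x) →
      (∀ x → Inverse.to e (inj₁ x) ≺ p (Inverse.to e (inj₁ x)) ⊎ α (Inverse.to e (inj₁ x)) ≈ 0#) →
      (∀ x → Inverse.to e (inj₁ x) ≺ q (Inverse.to e (inj₁ x)) ⊎ β (Inverse.to e (inj₁ x)) ≈ 0#) →
      (X : S → Fin b → Carrier) →
      (∀ l k → X (Inverse.to e (inj₂ l)) k ≈ I b l k) →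
      (∀ x k → X (Inverse.to e (inj₁ x)) k ≈ apply (λ s → X s k) (Inverse.to e (inj₁ x))) →
      systemDet (↔-trans Fin.+↔⊎ (↔-trans (eA ⊎-↔ ↔-refl) e)) ≈
      Det λ l k → I b l k - apply (λ s → X s k) (Inverse.to e (inj₂ l))
    eliminateSparse {a} {b} eA e {_≺_} ≺-trans ≺-irrefl α-acyclic β-acyclic X X₂ X₁ = trans
      (eliminate (λ x y → G (to x) (to y)) {λ i j → to (inj₁ i) ≺ to (inj₁ j)} ≺-trans (λ i → ≺-irrefl _) acyclic
        (X ∘ to) X₂ (λ i k → trans (X₁ _ k) (sym (∑-G full (λ s → X s k) _))))
      (Det-cong λ l k → +-congˡ (-‿cong (∑-G full (λ s → X s k) _)))
      where
      open Inverse (↔-trans (eA ⊎-↔ ↔-refl) e)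
      full : Fin (a ℕ.+ b) ↔ S
      full = ↔-trans Fin.+↔⊎ (↔-trans (eA ⊎-↔ ↔-refl) e)
      term : ∀ x y s c → x ≺ s ⊎ c ≈ 0# → x ≺ y ⊎ c * ⟦ y ≡ s ⟧ ≈ 0#
      term x y s c (inj₂ c≈0) = inj₂ (trans (*-congʳ c≈0) (zeroˡ _))
      term x y s c (inj₁ x≺s) with y ≟ s
      ... | yes ≡.refl = inj₁ x≺s
      ... | no _       = inj₂ (zeroʳ _)
      acyclic : ∀ i j → to (inj₁ i) ≺ to (inj₁ j) ⊎ G (to (inj₁ i)) (to (inj₁ j)) ≈ 0#
      acyclic i j with term _ (to (inj₁ j)) _ _ (α-acyclic (Inverse.to eA i))
                     | term _ (to (inj₁ j)) _ _ (β-acyclic (Inverse.to eA i))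
      ... | inj₁ x≺y | _        = inj₁ x≺y
      ... | inj₂ _   | inj₁ x≺y = inj₁ x≺y
      ... | inj₂ u   | inj₂ v   = inj₂ (trans (+-cong u v) (+-identityˡ _))

-- Paths through the equivalence classes of the mutation network

module Paths {n T : ℕ} (γ : MutationSequence n T) where

  open MutationSequence γ

  private
    V : Set
    V = Ē γ

    final : Fin T → V
    final t = m t , inject₁ t

    infix 4 _↝_
    _↝_ : Rel V 0ℓ
    _↝_ = _∼₁_ γ

    variable
      x x′ y y′ : V
      s s′ : Fin T
      d d′ : ℕ

  final-stuck : x ↝ y → x ≢ final s
  final-stuck {s = s} (step t i≢m) e with Fin.inject₁-injective (≡.cong proj₂ e)
  ... | ≡.refl = i≢m (≡.cong proj₁ e)
  final-stuck (wrap i) e = Fin.fromℕ≢inject₁ (≡.cong proj₂ e)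

  -- Together with `↝-injective` this makes the generating relation a partial injection, so that
  -- each class is a chain or a cycle.
  ↝-deterministic : x ↝ y → x′ ↝ y′ → x ≡ x′ → y ≡ y′
  ↝-deterministic (step t _) (step t′ _) e with ≡.cong proj₁ e | Fin.inject₁-injective (≡.cong proj₂ e)
  ... | ≡.refl | ≡.refl = ≡.refl
  ↝-deterministic (step t _) (wrap i)    e = contradiction (≡.sym (≡.cong proj₂ e)) Fin.fromℕ≢inject₁
  ↝-deterministic (wrap i)   (step t _)  e = contradiction (≡.cong proj₂ e) Fin.fromℕ≢inject₁
  ↝-deterministic (wrap i)   (wrap j)    e = ≡.cong (λ x → proj₁ x , zero) e

  ↝-injective : x ↝ y → x′ ↝ y′ → y ≡ y′ → x ≡ x′
  ↝-injective (step t _) (step t′ _) e with Fin.suc-injective (≡.cong proj₂ e)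
  ... | ≡.refl = ≡.cong (_, inject₁ t) (Injection.injective (↔⇒↣ (σ t)) (≡.cong proj₁ e))
  ↝-injective (step t _) (wrap i)    e = contradiction (≡.cong proj₂ e) λ ()
  ↝-injective (wrap i)   (step t _)  e = contradiction (≡.cong proj₂ e) λ ()
  ↝-injective (wrap i)   (wrap j)    e = ≡.cong (λ x → proj₁ x , fromℕ T) e

  step⁻¹ : ∀ t i → σ t ⟨$⟩ˡ i ≢ m t → (σ t ⟨$⟩ˡ i , inject₁ t) ↝ (i , suc t)
  step⁻¹ t i j≢m = ≡.subst (λ k → (σ t ⟨$⟩ˡ i , inject₁ t) ↝ (k , suc t)) (Perm.inverseʳ (σ t)) (step t j≢m)

  source : ∀ t i → σ t ⟨$⟩ˡ i ≡ m t → x ↝ y → y ≢ (i , suc t)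
  source t i j≡m (step t′ {k} k≢m) e with Fin.suc-injective (≡.cong proj₂ e)
  ... | ≡.refl = k≢m (≡.trans (≡.sym (Perm.inverseˡ (σ t)))
                   (≡.trans (≡.cong (σ t ⟨$⟩ˡ_) (≡.cong proj₁ e)) j≡m))
  source t i j≡m (wrap _) e = contradiction (≡.cong proj₂ e) λ ()

  data Terminates : V → Fin T → ℕ → Set where
    stop : ∀ s → Terminates (final s) s 0
    next : x ↝ y → Terminates y s d → Terminates x s (suc d)

  terminates-unique : Terminates x s d → Terminates x′ s′ d′ → x ≡ x′ → s ≡ s′ × d ≡ d′
  terminates-unique (stop s)   (stop s′)  e = Fin.inject₁-injective (≡.cong proj₂ e) , ≡.refl
  terminates-unique (stop s)   (next r _) e = contradiction (≡.sym e) (final-stuck r)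
  terminates-unique (next r _) (stop s′)  e = contradiction e (final-stuck r)
  terminates-unique (next r u) (next r′ v) e with terminates-unique u v (↝-deterministic r r′ e)
  ... | s≡s′ , d≡d′ = s≡s′ , ≡.cong suc d≡d′

  -- Walking `d` arrows back from `final s` is unambiguous, by injectivity. The end and the length
  -- thus serve as coordinates of a vertex.
  terminates-injective : Terminates x s d → Terminates y s d → x ≡ y
  terminates-injective (stop s)   (stop s)    = ≡.refl
  terminates-injective (next r u) (next r′ v) = ↝-injective r r′ (terminates-injective u v)

  -- The longer path visits a vertex at distance `d` from the same end, which must be `x`; the
  -- vertex visited just before it is the witness.
  predecessor : Terminates x s d → Terminates y s d′ → d ℕ.< d′ → ∃[ z ] z ↝ x
  predecessor {d = d} u (next {d = d″} r v) (s≤s d≤d″) with ℕ.m≤n⇒m<n∨m≡n d≤d″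
  ... | inj₁ d<d″   = predecessor u v d<d″
  ... | inj₂ ≡.refl = _ , ≡.subst (_ ↝_) (terminates-injective v u) r

  terminates⇒∼ : Terminates x s d → _∼_ γ x (final s)
  terminates⇒∼ (stop s)   = IsEquivalence.refl (Eq.isEquivalence _)
  terminates⇒∼ (next r u) = IsEquivalence.trans (Eq.isEquivalence _) (Eq.return r) (terminates⇒∼ u)

  module FullyMutatedPaths (fullyMutated : FullyMutated γ) where

    private
      Terminating : V → Set
      Terminating x = ∃[ s ] ∃[ d ] Terminates x s d

      -- Invariance in both directions lets termination spread over a whole equivalence class from
      -- the one final vertex that full mutation puts there. Going forward uses determinism.
      ↝-invariant : x ↝ y → Terminating x ⇔ Terminating y
      ↝-invariant {x} {y} r = mk⇔ forward λ { (s , d , u) → s , suc d , next r u }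
        where
        forward′ : Terminates x′ s d → x′ ≡ x → Terminating y
        forward′ (stop s)           e = contradiction (≡.sym e) (final-stuck r)
        forward′ (next {d = d} r′ u) e = _ , d , ≡.subst (λ z → Terminates z _ d) (↝-deterministic r′ r e) u
        forward : Terminating x → Terminating y
        forward (_ , _ , u) = forward′ u ≡.refl

    opaque
      terminating : ∀ x → Terminating x
      terminating x with fullyMutated x
      ... | s , s∼x = Equivalence.to
        (Eq.fold (On.isEquivalence Terminating ⇔-isEquivalence) ↝-invariant s∼x) (s , 0 , stop s)

    end : V → Fin T
    end x = proj₁ (terminating x)

    distance : V → ℕ
    distance x = proj₁ (proj₂ (terminating x))

    terminates : ∀ x → Terminates x (end x) (distance x)
    terminates x = proj₂ (proj₂ (terminating x))

    end-final : ∀ s → end (final s) ≡ s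
    end-final s = proj₁ (terminates-unique (terminates (final s)) (stop s) ≡.refl)

    distance-final : ∀ s → distance (final s) ≡ 0
    distance-final s = proj₂ (terminates-unique (terminates (final s)) (stop s) ≡.refl)

    end-↝ : x ↝ y → end x ≡ end y
    end-↝ {x} {y} r = proj₁ (terminates-unique (terminates x) (next r (terminates y)) ≡.refl)

    distance-↝ : x ↝ y → distance x ≡ suc (distance y)
    distance-↝ {x} {y} r = proj₂ (terminates-unique (terminates x) (next r (terminates y)) ≡.refl)

    -- `end` stands in for the quotient map: it is constant along arrows, and every vertex is
    -- equivalent to the final vertex of its path.
    ∼⇔end≡ : _∼_ γ x y ⇔ end x ≡ end y
    ∼⇔end≡ {x} {y} = mk⇔
      (Eq.fold (On.isEquivalence end ≡.isEquivalence) end-↝)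
      λ e → IsEquivalence.trans (Eq.isEquivalence _) (terminates⇒∼ (terminates x))
        (IsEquivalence.sym (Eq.isEquivalence _)
          (≡.subst (λ s → _∼_ γ y (final s)) (≡.sym e) (terminates⇒∼ (terminates y))))

    -- x is reachable from y along ↝.
    infix 4 _≼_
    _≼_ : Rel V 0ℓ
    y ≼ x = end y ≡ end x × distance x ℕ.≤ distance y

    opaque
      _≼?_ : ∀ y x → Dec (y ≼ x)
      y ≼? x = (end y Fin.≟ end x) ×-dec (distance x ℕ.≤? distance y)

    ≼-refl : x ≼ x
    ≼-refl = ≡.refl , ℕ.≤-refl

    ≼-cases : ∀ {x y} → y ≼ x → y ≡ x ⊎ (end y ≡ end x × distance x ℕ.< distance y)
    ≼-cases {x} {y} (e , x≤y) with ℕ.m≤n⇒m<n∨m≡n x≤y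
    ... | inj₁ x<y = inj₂ (e , x<y)
    ... | inj₂ x≡y = inj₁ (terminates-injective
      (≡.subst₂ (Terminates y) e (≡.sym x≡y) (terminates y)) (terminates x))

    ≼-predecessor : x′ ↝ x → y ≼ x → y ≡ x ⊎ y ≼ x′
    ≼-predecessor r y≼x with ≼-cases y≼x
    ... | inj₁ y≡x       = inj₁ y≡x
    ... | inj₂ (e , x<y) = inj₂ (≡.trans e (≡.sym (end-↝ r)) , ≡.subst (ℕ._≤ _) (≡.sym (distance-↝ r)) x<y)

    ≼-extend : x′ ↝ x → y ≼ x′ → y ≼ x
    ≼-extend r (e , x′≤y) = ≡.trans e (end-↝ r) , ℕ.≤-trans (ℕ.n≤1+n _) (≡.subst (ℕ._≤ _) (distance-↝ r) x′≤y)

    ⋠-predecessor : x′ ↝ x → ¬ x ≼ x′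
    ⋠-predecessor r (_ , x′≤x) = ℕ.<-irrefl ≡.refl (≡.subst (ℕ._≤ _) (distance-↝ r) x′≤x)

    ≼-source : (∀ {z} → ¬ z ↝ x) → y ≼ x → y ≡ x
    ≼-source {x} {y} noPredecessor y≼x with ≼-cases y≼x
    ... | inj₁ y≡x       = y≡x
    ... | inj₂ (e , x<y) = contradiction
      (proj₂ (predecessor (≡.subst (λ s → Terminates x s _) (≡.sym e) (terminates x)) (terminates y) x<y))
      noPredecessor

    -- A final vertex has distance 0, so its whole class leads to it. This turns reachability, which
    -- the elimination produces, into the equivalence tested by `N₀`, `N₊` and `N₋`.
    ≼-final⇔ : ∀ {s y} → _∼_ γ (final s) y ⇔ y ≼ final s
    ≼-final⇔ {s} {y} = mk⇔
      (λ s∼y → ≡.sym (Equivalence.to ∼⇔end≡ s∼y) , ≡.subst (ℕ._≤ _) (≡.sym (distance-final s)) z≤n)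
      (λ (e , _) → Equivalence.from ∼⇔end≡ (≡.sym e))

    final-injective-∼ : ∀ {s t} → _∼_ γ (final s) (final t) → s ≡ t
    final-injective-∼ {s} {t} s∼t = ≡.trans (≡.sym (end-final s))
      (≡.trans (Equivalence.to ∼⇔end≡ s∼t) (end-final t))

-- The linear system and its two eliminations

-- inj₁ (i , t) is the unknown x(i,t) and inj₂ t is w(t); the equation of the
-- unknown u is u = α u * p u + β u * q u.
module NetworkSystem (R : CommutativeRing 0ℓ 0ℓ) {n T : ℕ} (γ : MutationSequence n T)
  (b : Fin T → Fin n → CommutativeRing.Carrier R) where

  open CommutativeRing R hiding (zero)
  open MatrixOperations rawRing
  open Determinant R
  open SetoidReasoning setoid
  open MutationSequence γ

  Unknown : Set
  Unknown = Ē γ ⊎ Fin T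

  -- At the mutated index the equation has no `α` term; x = - w is carried by `β`, once `b t (m t)`
  -- is chosen to be `- 1#`.
  α β : Unknown → Carrier
  α (inj₁ (i , zero))  = 1#
  α (inj₁ (i , suc t)) = if does (σ t ⟨$⟩ˡ i Fin.≟ m t) then 0# else 1#
  α (inj₂ t)           = 1#
  β (inj₁ (i , zero))  = 0#
  β (inj₁ (i , suc t)) = b t (σ t ⟨$⟩ˡ i)
  β (inj₂ t)           = 0#

  p q : Unknown → Unknown
  p (inj₁ (i , zero))  = inj₁ (i , fromℕ T)
  p (inj₁ (i , suc t)) = inj₁ (σ t ⟨$⟩ˡ i , inject₁ t)
  p (inj₂ t)           = inj₁ (m t , inject₁ t)
  q (inj₁ (i , zero))  = inj₁ (i , zero)
  q (inj₁ (i , suc t)) = inj₂ t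
  q (inj₂ t)           = inj₂ t

  _≟_ : DecidableEquality Unknown
  _≟_ = Sum.≡-dec (Product.≡-dec Fin._≟_ Fin._≟_) Fin._≟_

  open SparseSystem _≟_ α β p q

  enumeration : Fin (n ℕ.* suc T ℕ.+ T) ↔ Unknown
  enumeration = ↔-trans Fin.+↔⊎ (Fin.*↔× ⊎-↔ ↔-refl)

  single : ∀ x y → 1# * x + 0# * y ≈ x
  single x y = trans (+-cong (*-identityˡ x) (zeroˡ y)) (+-identityʳ x)

  -- `L t i k` is the coefficient of x(k,0) in x(i,t) when the system is solved forward in time.
  module _ (L : Fin (suc T) → Fin n → Fin n → Carrier)
    (L-zero : ∀ i k → L zero i k ≈ I n i k)
    (L-suc : ∀ t i k →
      L (suc t) i k ≈ (if does (σ t ⟨$⟩ˡ i Fin.≟ m t) then 0# else 1#) * L (inject₁ t) (σ t ⟨$⟩ˡ i) k +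
                      b t (σ t ⟨$⟩ˡ i) * L (inject₁ t) (m t) k)
    where

    private
      split : (((Fin n × Fin T) ⊎ Fin T) ⊎ Fin n) ↔ Unknown
      split = mk↔ₛ′
        (λ { (inj₁ (inj₁ (i , t))) → inj₁ (i , suc t) ; (inj₁ (inj₂ t)) → inj₂ t ; (inj₂ i) → inj₁ (i , zero) })
        (λ { (inj₁ (i , zero)) → inj₂ i ; (inj₁ (i , suc t)) → inj₁ (inj₁ (i , t)) ; (inj₂ t) → inj₁ (inj₂ t) })
        (λ { (inj₁ (i , zero)) → ≡.refl ; (inj₁ (i , suc t)) → ≡.refl ; (inj₂ t) → ≡.refl })
        (λ { (inj₁ (inj₁ (i , t))) → ≡.refl ; (inj₁ (inj₂ t)) → ≡.refl ; (inj₂ i) → ≡.refl })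

      X : Unknown → Fin n → Carrier
      X (inj₁ (i , t)) = L t i
      X (inj₂ t)       = L (inject₁ t) (m t)

      -- Doubling leaves an odd value for w(t) between the states before and after its step.
      time : Unknown → ℕ
      time (inj₁ (i , t)) = toℕ t ℕ.+ toℕ t
      time (inj₂ t)       = suc (toℕ t ℕ.+ toℕ t)

      infix 4 _≻_
      _≻_ : Rel Unknown 0ℓ
      x ≻ y = time y ℕ.< time x

      inject₁-time : ∀ (t : Fin T) → toℕ (inject₁ t) ℕ.+ toℕ (inject₁ t) ≡ toℕ t ℕ.+ toℕ t
      inject₁-time t = ≡.cong (λ k → k ℕ.+ k) (Fin.toℕ-inject₁ t)

      w≻x : ∀ t → inj₂ t ≻ inj₁ (m t , inject₁ t)
      w≻x t = s≤s (ℕ.≤-reflexive (inject₁-time t))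

      x≻w : ∀ i t → inj₁ (i , suc t) ≻ inj₂ t
      x≻w i t = s≤s (ℕ.≤-reflexive (≡.sym (ℕ.+-suc (toℕ t) (toℕ t))))

      open Inverse split

      p-acyclic : ∀ x → to (inj₁ x) ≻ p (to (inj₁ x)) ⊎ α (to (inj₁ x)) ≈ 0#
      p-acyclic (inj₁ (i , t)) = inj₁ (ℕ.<-trans (w≻x t) (x≻w i t))
      p-acyclic (inj₂ t)       = inj₁ (w≻x t)

      q-acyclic : ∀ x → to (inj₁ x) ≻ q (to (inj₁ x)) ⊎ β (to (inj₁ x)) ≈ 0#
      q-acyclic (inj₁ (i , t)) = inj₁ (x≻w i t)
      q-acyclic (inj₂ t)       = inj₂ refl

      solution : ∀ x k → X (to (inj₁ x)) k ≈ apply (λ s → X s k) (to (inj₁ x))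
      solution (inj₁ (i , t)) k = L-suc t i k
      solution (inj₂ t)       k = sym (single _ _)

    systemDet-transfer : systemDet enumeration ≈ Det λ i k → I n i k - L (fromℕ T) i k
    systemDet-transfer = begin
      systemDet enumeration
        ≈⟨ systemDet-unique enumeration (↔-trans Fin.+↔⊎ (↔-trans (states ⊎-↔ ↔-refl) split)) ⟩
      systemDet (↔-trans Fin.+↔⊎ (↔-trans (states ⊎-↔ ↔-refl) split))
        ≈⟨ eliminateSparse states split {_≻_} (λ y<x z<y → ℕ.<-trans z<y y<x) (λ x → ℕ.<-irrefl ≡.refl)
             p-acyclic q-acyclic X L-zero solution ⟩
      Det (λ i k → I n i k - apply (λ s → X s k) (inj₁ (i , zero)))
        -- What remains are the equations x(i,0) = x(i,T).
        ≈⟨ Det-cong (λ i k → +-congˡ (-‿cong (single _ _))) ⟩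
      Det (λ i k → I n i k - L (fromℕ T) i k) ∎
      where
      states : Fin (n ℕ.* T ℕ.+ T) ↔ ((Fin n × Fin T) ⊎ Fin T)
      states = ↔-trans Fin.+↔⊎ (Fin.*↔× ⊎-↔ ↔-refl)

  module _ (fullyMutated : FullyMutated γ) where

    open Paths γ
    open FullyMutatedPaths fullyMutated

    private
      _≼ᵣ_ : Ē γ → Ē γ → Carrier
      y ≼ᵣ x = if does (y ≼? x) then 1# else 0#

      _≡ᵣ_ : Ē γ → Ē γ → Carrier
      y ≡ᵣ x = if does (Product.≡-dec Fin._≟_ Fin._≟_ y x) then 1# else 0#

      -- The two ways of reaching `x`, trivially or through its predecessor, exclude each other
      -- because distances strictly decrease along arrows; hence the indicators add.
      ≼-unfold : ∀ {x′ x} → _∼₁_ γ x′ x → ∀ y → y ≼ᵣ x ≈ y ≼ᵣ x′ + y ≡ᵣ x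
      ≼-unfold {x′} {x} r y with y ≼? x | y ≼? x′ | Product.≡-dec Fin._≟_ Fin._≟_ y x
      ... | yes _   | yes y≼x′ | yes ≡.refl = contradiction y≼x′ (⋠-predecessor r)
      ... | yes _   | yes _    | no _       = sym (+-identityʳ _)
      ... | yes _   | no _     | yes _      = sym (+-identityˡ _)
      ... | no ¬y≼x | _        | yes ≡.refl = contradiction (≼-refl) ¬y≼x
      ... | no ¬y≼x | yes y≼x′ | no _       = contradiction (≼-extend r y≼x′) ¬y≼x
      ... | no _    | no _     | no _       = sym (+-identityˡ _)
      ... | yes y≼x | no ¬y≼x′ | no y≢x with ≼-predecessor r y≼x
      ...   | inj₁ y≡x  = contradiction y≡x y≢x
      ...   | inj₂ y≼x′ = contradiction y≼x′ ¬y≼x′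

      ≼-unfold-source : ∀ {x} → (∀ {z} → ¬ _∼₁_ γ z x) → ∀ y → y ≼ᵣ x ≈ y ≡ᵣ x
      ≼-unfold-source {x} source y = reflexive (≡.cong (if_then 1# else 0#) (does-⇔
        (mk⇔ (≼-source source) λ { ≡.refl → ≼-refl })
        (y ≼? x) (Product.≡-dec Fin._≟_ Fin._≟_ y x)))

      output : Fin T → Fin n → Ē γ
      output t i = σ t ⟨$⟩ʳ i , suc t

      -- Following the path through `x` backwards picks up `b t i` times w(t) at each output of step
      -- `t` that lies upstream, `x` included; this is the total coefficient of w(t) in `x`.
      X : Unknown → Fin T → Carrier
      X (inj₁ x) t = ∑ λ i → output t i ≼ᵣ x * b t i
      X (inj₂ s) t = I T s t

      ≡ᵣ-zero : ∀ x y → x ≢ y → x ≡ᵣ y ≈ 0#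
      ≡ᵣ-zero x y x≢y = reflexive (≡.cong (if_then 1# else 0#)
        (dec-false (Product.≡-dec Fin._≟_ Fin._≟_ x y) x≢y))

      ∑-output : ∀ s i t → ∑ (λ k → output t k ≡ᵣ (i , suc s) * b t k) ≈ b s (σ s ⟨$⟩ˡ i) * I T s t
      ∑-output s i t with s Fin.≟ t
      ... | yes ≡.refl = begin
        ∑ (λ k → output s k ≡ᵣ (i , suc s) * b s k)
          ≈⟨ ∑-cong (λ k → trans (*-comm _ _) (*-congˡ (reflexive (≡.cong (if_then 1# else 0#) (does-⇔
               (mk⇔ (λ e → ≡.trans (≡.sym (Perm.inverseˡ (σ s))) (≡.cong (σ s ⟨$⟩ˡ_) (≡.cong proj₁ e)))
                    (λ { ≡.refl → ≡.cong (_, suc s) (Perm.inverseʳ (σ s)) }))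
               (Product.≡-dec Fin._≟_ Fin._≟_ (output s k) (i , suc s)) (k Fin.≟ σ s ⟨$⟩ˡ i)))))) ⟩
        ∑ (λ k → b s k * I n k (σ s ⟨$⟩ˡ i))   ≈⟨ ∑-I (b s) (σ s ⟨$⟩ˡ i) ⟩
        b s (σ s ⟨$⟩ˡ i)                        ≈⟨ *-identityʳ _ ⟨
        b s (σ s ⟨$⟩ˡ i) * 1#                   ∎
      ... | no s≢t = trans
        (∑-zero λ k → trans (*-congʳ (≡ᵣ-zero (output t k) (i , suc s) λ e → s≢t (≡.sym (Fin.suc-injective (≡.cong proj₂ e))))) (zeroˡ _))
        (sym (zeroʳ _))

      ∑-distrib-≼ : ∀ {x′ x} → _∼₁_ γ x′ x → ∀ t →
        X (inj₁ x) t ≈ X (inj₁ x′) t + ∑ λ i → output t i ≡ᵣ x * b t i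
      ∑-distrib-≼ r t = trans (∑-cong λ i → trans (*-congʳ (≼-unfold r _)) (distribʳ _ _ _)) (∑-+ _ _)

      solution : ∀ x t → X (inj₁ x) t ≈ apply (λ s → X s t) (inj₁ x)
      solution (i , zero) t = begin
        X (inj₁ (i , zero)) t
          ≈⟨ ∑-distrib-≼ (wrap i) t ⟩
        X (inj₁ (i , fromℕ T)) t + ∑ (λ k → output t k ≡ᵣ (i , zero) * b t k)
          ≈⟨ +-congˡ (∑-zero λ k → trans (*-congʳ (≡ᵣ-zero (output t k) (i , zero) λ ())) (zeroˡ _)) ⟩
        X (inj₁ (i , fromℕ T)) t + 0#
          ≈⟨ trans (+-identityʳ _) (sym (single _ _)) ⟩
        apply (λ s → X s t) (inj₁ (i , zero)) ∎
      solution (i , suc s) t with σ s ⟨$⟩ˡ i Fin.≟ m s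
      -- The path starts at this vertex, so its own output is the only one upstream.
      ... | yes j≡m = begin
        X (inj₁ (i , suc s)) t
          ≈⟨ ∑-cong (λ k → *-congʳ (≼-unfold-source (λ r → source s i j≡m r ≡.refl) _)) ⟩
        ∑ (λ k → output t k ≡ᵣ (i , suc s) * b t k)
          ≈⟨ trans (∑-output s i t) (trans (sym (+-identityˡ _)) (+-congʳ (sym (zeroˡ _)))) ⟩
        0# * X (inj₁ (σ s ⟨$⟩ˡ i , inject₁ s)) t + b s (σ s ⟨$⟩ˡ i) * I T s t ∎
      ... | no j≢m = trans (∑-distrib-≼ (step⁻¹ s i j≢m) t)
        (+-cong (sym (*-identityˡ _)) (∑-output s i t))

      infix 4 _≺_
      -- The equation of a vertex refers to its predecessor, which is farther from the end of the
      -- path. The w(t) lie above all vertices, as parameters.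
      _≺_ : Rel Unknown 0ℓ
      inj₁ x ≺ inj₁ y = distance x ℕ.< distance y
      inj₁ x ≺ inj₂ t = ⊤
      inj₂ t ≺ y      = ⊥

      ≺-trans : Transitive _≺_
      ≺-trans {inj₁ x} {inj₁ y} {inj₁ z} x<y y<z = ℕ.<-trans x<y y<z
      ≺-trans {inj₁ x} {inj₁ y} {inj₂ t} _   _   = tt

      ≺-irrefl : ∀ x → ¬ x ≺ x
      ≺-irrefl (inj₁ x) = ℕ.<-irrefl ≡.refl

      closer : ∀ {x y} → _∼₁_ γ y x → inj₁ x ≺ inj₁ y
      closer r = ℕ.≤-reflexive (≡.sym (distance-↝ r))

      p-acyclic : ∀ x → inj₁ x ≺ p (inj₁ x) ⊎ α (inj₁ x) ≈ 0#
      p-acyclic (i , zero)  = inj₁ (closer (wrap i))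
      p-acyclic (i , suc t) with σ t ⟨$⟩ˡ i Fin.≟ m t
      ... | yes _  = inj₂ refl
      ... | no j≢m = inj₁ (closer (step⁻¹ t i j≢m))

      q-acyclic : ∀ x → inj₁ x ≺ q (inj₁ x) ⊎ β (inj₁ x) ≈ 0#
      q-acyclic (i , zero)  = inj₂ refl
      q-acyclic (i , suc t) = inj₁ tt

    -- The equations w(s) = x(m_s, s-1) are left over, with the right side expanded in the w(t).
    systemDet-network : systemDet enumeration ≈
      Det λ s t → I T s t - ∑ λ i →
        (if does (_∼?_ γ (m s , inject₁ s) (σ t ⟨$⟩ʳ i , suc t)) then 1# else 0#) * b t i
    systemDet-network = begin
      systemDet enumeration
        ≈⟨ systemDet-unique enumeration (↔-trans Fin.+↔⊎ (↔-trans (Fin.*↔× ⊎-↔ ↔-refl) ↔-refl)) ⟩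
      systemDet (↔-trans Fin.+↔⊎ (↔-trans (Fin.*↔× ⊎-↔ ↔-refl) ↔-refl))
        ≈⟨ eliminateSparse Fin.*↔× ↔-refl {_≺_} (λ {x} {y} {z} → ≺-trans {x} {y} {z}) ≺-irrefl
             p-acyclic q-acyclic X (λ l k → refl) solution ⟩
      Det (λ s t → I T s t - apply (λ x → X x t) (inj₂ s))
        ≈⟨ Det-cong (λ s t → +-congˡ (-‿cong (trans (single _ _) (∑-cong λ i → *-congʳ (reflexive
             (≡.cong (if_then 1# else 0#) (≡.sym (does-⇔ ≼-final⇔
               (_∼?_ γ (m s , inject₁ s) (output t i)) (output t i ≼? (m s , inject₁ s)))))))))) ⟩
      Det (λ s t → I T s t - ∑ λ i →
        (if does (_∼?_ γ (m s , inject₁ s) (output t i)) then 1# else 0#) * b t i) ∎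

-- Derivations of polynomial rings

record IsDerivation (R : CommutativeRing 0ℓ 0ℓ) (d : CommutativeRing.Carrier R → CommutativeRing.Carrier R) : Set where
  open CommutativeRing R
  open RingProperties ring using (+-identityˡ-unique)
  open IntegerCoefficientSolver R
  open SetoidReasoning setoid
  field
    d-cong : ∀ {x y} → x ≈ y → d x ≈ d y
    d-+    : ∀ x y → d (x + y) ≈ d x + d y
    d-*    : ∀ x y → d (x * y) ≈ d x * y + x * d y

  d-0 : d 0# ≈ 0#
  d-0 = +-identityˡ-unique _ _ (trans (sym (d-+ 0# 0#)) (d-cong (+-identityˡ 0#)))

  d-1 : d 1# ≈ 0#
  d-1 = +-identityˡ-unique _ _ (begin
    d 1# + d 1#            ≈⟨ solve 1 (λ x → x :+ x := x :* :1 :+ :1 :* x) refl (d 1#) ⟩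
    d 1# * 1# + 1# * d 1#  ≈⟨ d-* 1# 1# ⟨
    d (1# * 1#)            ≈⟨ d-cong (*-identityˡ 1#) ⟩
    d 1#                   ∎)

module UnivariateDerivations (D : DecidableDomain) where

  open DecidableDomain D
  open Univariate D renaming (polynomialRing to univariateRing)
  open CommutativeRing commutativeRing
    renaming (refl to ≈-refl; sym to ≈-sym; trans to ≈-trans) hiding (zero)
  open CommutativeMultiples +-commutativeMonoid using (×-congʳ; ×-distrib-+) renaming (_×_ to _×ᵣ_)
  open IntegerCoefficientSolver univariateRing
  open SetoidReasoning ≋-setoid

  -- Equal polynomials may be lists of different length, so congruence of the derivative is read off
  -- from coefficients and not from the recursion on lists.
  coeff-derivative : ∀ p k → coeff (derivative p) k ≈ suc k ×ᵣ coeff p (suc k)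
  coeff-derivative []      zero    = ≈-sym (+-identityʳ _)
  coeff-derivative []      (suc k) = ≈-sym (≈-trans (+-identityˡ _) (≈-sym (coeff-derivative [] k)))
  coeff-derivative (a ∷ p) zero    = coeff-⊕ p (0# ∷ derivative p) 0
  coeff-derivative (a ∷ p) (suc k) =
    ≈-trans (coeff-⊕ p (0# ∷ derivative p) (suc k)) (+-congˡ (coeff-derivative p k))

  derivative-cong : ∀ {p q} → p ≋ q → derivative p ≋ derivative q
  derivative-cong {p} {q} e = eq λ k →
    ≈-trans (coeff-derivative p k) (≈-trans (×-congʳ (suc k) (at e (suc k))) (≈-sym (coeff-derivative q k)))

  derivative-⊕ : ∀ p q → derivative (p ⊕ q) ≋ derivative p ⊕ derivative q
  derivative-⊕ p q = eq λ k →
    ≈-trans (coeff-derivative (p ⊕ q) k) (≈-trans (×-congʳ (suc k) (coeff-⊕ p q (suc k)))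
      (≈-trans (×-distrib-+ _ _ (suc k))
        (≈-sym (≈-trans (coeff-⊕ (derivative p) (derivative q) k)
          (+-cong (coeff-derivative p k) (coeff-derivative q k))))))

  derivative-· : ∀ a p → derivative (a · p) ≋ a · derivative p
  derivative-· a []      = ≋-refl
  derivative-· a (b ∷ p) = begin
    a · p ⊕ (0# ∷ derivative (a · p))      ≈⟨ ⊕-cong {a · p} ≋-refl (∷-cong (≈-sym (zeroʳ a)) (derivative-· a p)) ⟩
    a · p ⊕ a · (0# ∷ derivative p)        ≈⟨ ·-distribˡ a p (0# ∷ derivative p) ⟨
    a · (p ⊕ (0# ∷ derivative p))          ∎

  derivative-⊛ : ∀ p q → derivative (p ⊛ q) ≋ derivative p ⊛ q ⊕ p ⊛ derivative q
  derivative-⊛ []      q = ≋-refl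
  derivative-⊛ (a ∷ p) q = begin
    derivative (a · q ⊕ (0# ∷ p ⊛ q))
      ≈⟨ derivative-⊕ (a · q) (0# ∷ p ⊛ q) ⟩
    derivative (a · q) ⊕ (p ⊛ q ⊕ (0# ∷ derivative (p ⊛ q)))
      ≈⟨ ⊕-cong (derivative-· a q) (⊕-cong {p ⊛ q} ≋-refl (≋-trans
           (∷-cong ≈-refl (derivative-⊛ p q)) (≋-sym (shift-⊕ (derivative p ⊛ q) (p ⊛ derivative q))))) ⟩
    a · derivative q ⊕ (p ⊛ q ⊕ ((0# ∷ derivative p ⊛ q) ⊕ (0# ∷ p ⊛ derivative q)))
      ≈⟨ solve 4 (λ x y z w → x :+ (y :+ (z :+ w)) := (y :+ z) :+ (x :+ w)) ≋-refl
           (a · derivative q) (p ⊛ q) (0# ∷ derivative p ⊛ q) (0# ∷ p ⊛ derivative q) ⟩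
    (p ⊛ q ⊕ (0# ∷ derivative p ⊛ q)) ⊕ (a · derivative q ⊕ (0# ∷ p ⊛ derivative q))
      ≈⟨ ⊕-cong (⊕-cong {p ⊛ q} ≋-refl (shift-⊛ (derivative p) q)) ≋-refl ⟨
    (p ⊛ q ⊕ (0# ∷ derivative p) ⊛ q) ⊕ (a ∷ p) ⊛ derivative q
      ≈⟨ ⊕-cong (⊛-distribʳ q p (0# ∷ derivative p)) ≋-refl ⟨
    (p ⊕ (0# ∷ derivative p)) ⊛ q ⊕ (a ∷ p) ⊛ derivative q ∎

  derivative-isDerivation : IsDerivation univariateRing derivative
  derivative-isDerivation = record
    { d-cong = derivative-cong ; d-+ = derivative-⊕ ; d-* = derivative-⊛ }

  module _ {d : Carrier → Carrier} (isDerivation : IsDerivation commutativeRing d) where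

    open IsDerivation isDerivation

    private
      D′ : List Carrier → List Carrier
      D′ = List.map d

    coeff-map : ∀ p k → coeff (D′ p) k ≈ d (coeff p k)
    coeff-map []      k       = ≈-sym d-0
    coeff-map (a ∷ p) zero    = ≈-refl
    coeff-map (a ∷ p) (suc k) = coeff-map p k

    map-cong : ∀ {p q} → p ≋ q → D′ p ≋ D′ q
    map-cong {p} {q} e = eq λ k →
      ≈-trans (coeff-map p k) (≈-trans (d-cong (at e k)) (≈-sym (coeff-map q k)))

    map-⊕ : ∀ p q → D′ (p ⊕ q) ≋ D′ p ⊕ D′ q
    map-⊕ p q = eq λ k →
      ≈-trans (coeff-map (p ⊕ q) k) (≈-trans (d-cong (coeff-⊕ p q k)) (≈-trans (d-+ _ _)
        (≈-sym (≈-trans (coeff-⊕ (D′ p) (D′ q) k) (+-cong (coeff-map p k) (coeff-map q k))))))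

    map-· : ∀ a p → D′ (a · p) ≋ d a · p ⊕ a · D′ p
    map-· a []      = ≋-refl
    map-· a (b ∷ p) = ∷-cong (d-* a b) (map-· a p)

    map-⊛ : ∀ p q → D′ (p ⊛ q) ≋ D′ p ⊛ q ⊕ p ⊛ D′ q
    map-⊛ []      q = ≋-refl
    map-⊛ (a ∷ p) q = begin
      D′ (a · q ⊕ (0# ∷ p ⊛ q))
        ≈⟨ map-⊕ (a · q) (0# ∷ p ⊛ q) ⟩
      D′ (a · q) ⊕ (d 0# ∷ D′ (p ⊛ q))
        ≈⟨ ⊕-cong (map-· a q) (≋-trans (∷-cong d-0 (map-⊛ p q)) (≋-sym (shift-⊕ (D′ p ⊛ q) (p ⊛ D′ q)))) ⟩
      (d a · q ⊕ a · D′ q) ⊕ ((0# ∷ D′ p ⊛ q) ⊕ (0# ∷ p ⊛ D′ q))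
        ≈⟨ ⊕-interchange (d a · q) (a · D′ q) (0# ∷ D′ p ⊛ q) (0# ∷ p ⊛ D′ q) ⟩
      (d a · q ⊕ (0# ∷ D′ p ⊛ q)) ⊕ (a · D′ q ⊕ (0# ∷ p ⊛ D′ q)) ∎

    map-isDerivation : IsDerivation univariateRing (List.map d)
    map-isDerivation = record { d-cong = map-cong ; d-+ = map-⊕ ; d-* = map-⊛ }

∂Poly-isDerivation : ∀ n j → IsDerivation (polynomialRing n) (∂Poly n j)
∂Poly-isDerivation (suc n) zero    = UnivariateDerivations.derivative-isDerivation (polynomialDomain n)
∂Poly-isDerivation (suc n) (suc j) =
  UnivariateDerivations.map-isDerivation (polynomialDomain n) (∂Poly-isDerivation n j)

∂Poly-variable : ∀ n i → let open CommutativeRing (polynomialRing n) in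
                 ∂Poly n i (variablePoly n i) ≈ 1#
∂Poly-variable (suc n) zero    = U.∷-cong (CommutativeRing.+-identityʳ (polynomialRing n) _)
  (U.∷-zero (CommutativeRing.refl (polynomialRing n)) U.≋-refl)
  where module U = Univariate (polynomialDomain n)
∂Poly-variable (suc n) (suc i) = U.∷-cong (∂Poly-variable n i) U.≋-refl
  where module U = Univariate (polynomialDomain n)

∂Poly-variable-≢ : ∀ n {i j} → j ≢ i → let open CommutativeRing (polynomialRing n) in
                   ∂Poly n j (variablePoly n i) ≈ 0#
∂Poly-variable-≢ (suc n) {zero}  {zero}  j≢i = contradiction ≡.refl j≢i
∂Poly-variable-≢ (suc n) {zero}  {suc j} j≢i = U.∷-zero d-0 (U.∷-zero d-1 U.≋-refl)
  where
  module U = Univariate (polynomialDomain n)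
  open IsDerivation (∂Poly-isDerivation n j)
∂Poly-variable-≢ (suc n) {suc i} {zero}  j≢i = U.∷-zero (CommutativeRing.refl (polynomialRing n)) U.≋-refl
  where module U = Univariate (polynomialDomain n)
∂Poly-variable-≢ (suc n) {suc i} {suc j} j≢i =
  U.∷-zero (∂Poly-variable-≢ n λ e → j≢i (≡.cong suc e)) U.≋-refl
  where module U = Univariate (polynomialDomain n)

-- The ring of rational functions and its partial derivatives

module _ (n : ℕ) where

  private
    module P = CommutativeRing (polynomialRing n)
    module F = RawRing (rationalFunctions n)
  open P using (_≈_; _+_; _*_; -_; _-_; 0#; 1#)
  open RationalFunction
  open DecidableDomain (polynomialDomain n) using (x*y≈0⇒)
  open IntegerCoefficientSolver (polynomialRing n)
  open GroupProperties (AbelianGroup.group P.+-abelianGroup)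
    using () renaming (x≈y⇒x∙y⁻¹≈ε to x≈y⇒x-y≈0; x∙y⁻¹≈ε⇒x≈y to x-y≈0⇒x≈y)
  open SetoidReasoning P.setoid

  -- Polynomials form a domain. Transitivity of equality of fractions cancels the middle denominator
  -- this way.
  *-cancelʳ : ∀ {x y} z → NonZero n z → x * z ≈ y * z → x ≈ y
  *-cancelʳ {x} {y} z z≉0 e with x*y≈0⇒ (x - y) z (begin
    (x - y) * z     ≈⟨ solve 3 (λ x y z → (x :- y) :* z := x :* z :- y :* z) P.refl x y z ⟩
    x * z - y * z   ≈⟨ x≈y⇒x-y≈0 e ⟩
    0#              ∎)
  ... | inj₁ x-y≈0 = x-y≈0⇒x≈y _ _ x-y≈0
  ... | inj₂ z≈0   = contradiction z≈0 z≉0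

  private

    F-trans : ∀ {r s t} → r F.≈ s → s F.≈ t → r F.≈ t
    F-trans {r} {s} {t} r≈s s≈t = *-cancelʳ (den s) (den-nonZero s) (begin
      num r * den t * den s
        ≈⟨ solve 3 (λ a b c → a :* b :* c := (a :* c) :* b) P.refl (num r) (den t) (den s) ⟩
      (num r * den s) * den t
        ≈⟨ P.*-congʳ r≈s ⟩
      (num s * den r) * den t
        ≈⟨ solve 3 (λ a b c → a :* b :* c := (a :* c) :* b) P.refl (num s) (den r) (den t) ⟩
      (num s * den t) * den r
        ≈⟨ P.*-congʳ s≈t ⟩
      (num t * den s) * den r
        ≈⟨ solve 3 (λ a b c → a :* b :* c := (a :* c) :* b) P.refl (num t) (den s) (den r) ⟩
      num t * den r * den s ∎)

    F-+-cong : ∀ {r r′ s s′} → r F.≈ r′ → s F.≈ s′ → r F.+ s F.≈ r′ F.+ s′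
    F-+-cong {r} {r′} {s} {s′} e f = begin
      (num r * den s + num s * den r) * (den r′ * den s′)
        ≈⟨ solve 6 (λ a b b′ c d d′ → (a :* d :+ c :* b) :* (b′ :* d′) :=
             (a :* b′) :* (d :* d′) :+ (c :* d′) :* (b :* b′)) P.refl
             (num r) (den r) (den r′) (num s) (den s) (den s′) ⟩
      (num r * den r′) * (den s * den s′) + (num s * den s′) * (den r * den r′)
        ≈⟨ P.+-cong (P.*-congʳ e) (P.*-congʳ f) ⟩
      (num r′ * den r) * (den s * den s′) + (num s′ * den s) * (den r * den r′)
        ≈⟨ solve 6 (λ a b b′ c d d′ → (a :* b) :* (d :* d′) :+ (c :* d) :* (b :* b′) :=
             (a :* d′ :+ c :* b′) :* (b :* d)) P.refl
             (num r′) (den r) (den r′) (num s′) (den s) (den s′) ⟩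
      (num r′ * den s′ + num s′ * den r′) * (den r * den s) ∎

    F-*-cong : ∀ {r r′ s s′} → r F.≈ r′ → s F.≈ s′ → r F.* s F.≈ r′ F.* s′
    F-*-cong {r} {r′} {s} {s′} e f = begin
      (num r * num s) * (den r′ * den s′)
        ≈⟨ solve 4 (λ a c b d → (a :* c) :* (b :* d) := (a :* b) :* (c :* d)) P.refl
             (num r) (num s) (den r′) (den s′) ⟩
      (num r * den r′) * (num s * den s′)
        ≈⟨ P.*-cong e f ⟩
      (num r′ * den r) * (num s′ * den s)
        ≈⟨ solve 4 (λ a c b d → (a :* c) :* (b :* d) := (a :* b) :* (c :* d)) P.refl
             (num r′) (den r) (num s′) (den s) ⟩
      (num r′ * num s′) * (den r * den s) ∎

    F--cong : ∀ {r s} → r F.≈ s → F.- r F.≈ F.- s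
    F--cong {r} {s} e = begin
      - num r * den s      ≈⟨ solve 2 (λ a b → :- a :* b := :- (a :* b)) P.refl (num r) (den s) ⟩
      - (num r * den s)    ≈⟨ P.-‿cong e ⟩
      - (num s * den r)    ≈⟨ solve 2 (λ a b → :- a :* b := :- (a :* b)) P.refl (num s) (den r) ⟨
      - num s * den r      ∎

  rationalFunctionRing : CommutativeRing 0ℓ 0ℓ
  rationalFunctionRing = record
    { Carrier = RationalFunction n
    ; _≈_ = F._≈_
    ; _+_ = F._+_
    ; _*_ = F._*_
    ; -_  = F.-_
    ; 0#  = F.0#
    ; 1#  = F.1#
    ; isCommutativeRing = record
      { isRing = record
        { +-isAbelianGroup = record
          { isGroup = record
            { isMonoid = record
              { isSemigroup = record
                { isMagma = record
                  { isEquivalence = record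
                    { refl  = P.refl
                    ; sym   = P.sym
                    ; trans = λ {r} {s} {t} → F-trans {r} {s} {t}
                    }
                  ; ∙-cong = λ {r} {r′} {s} {s′} → F-+-cong {r} {r′} {s} {s′}
                  }
                ; assoc = λ r s t → solve 6 (λ a b c d e f →
                    ((a :* d :+ c :* b) :* f :+ e :* (b :* d)) :* (b :* (d :* f)) :=
                    (a :* (d :* f) :+ (c :* f :+ e :* d) :* b) :* ((b :* d) :* f)) P.refl
                    (num r) (den r) (num s) (den s) (num t) (den t)
                }
              ; identity =
                  (λ r → solve 2 (λ a b → (:0 :* b :+ a :* :1) :* b := a :* (:1 :* b)) P.refl (num r) (den r))
                , (λ r → solve 2 (λ a b → (a :* :1 :+ :0 :* b) :* b := a :* (b :* :1)) P.refl (num r) (den r))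
              }
            ; inverse =
                (λ r → solve 2 (λ a b → (:- a :* b :+ a :* b) :* :1 := :0 :* (b :* b)) P.refl (num r) (den r))
              , (λ r → solve 2 (λ a b → (a :* b :+ :- a :* b) :* :1 := :0 :* (b :* b)) P.refl (num r) (den r))
            ; ⁻¹-cong = λ {r} {s} → F--cong {r} {s}
            }
          ; comm = λ r s → solve 4 (λ a b c d → (a :* d :+ c :* b) :* (d :* b) := (c :* b :+ a :* d) :* (b :* d))
              P.refl (num r) (den r) (num s) (den s)
          }
        ; *-cong = λ {r} {r′} {s} {s′} → F-*-cong {r} {r′} {s} {s′}
        ; *-assoc = λ r s t → solve 6 (λ a b c d e f →
            ((a :* c) :* e) :* (b :* (d :* f)) := (a :* (c :* e)) :* ((b :* d) :* f)) P.refl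
            (num r) (den r) (num s) (den s) (num t) (den t)
        ; *-identity =
            (λ r → solve 2 (λ a b → (:1 :* a) :* b := a :* (:1 :* b)) P.refl (num r) (den r))
          , (λ r → solve 2 (λ a b → (a :* :1) :* b := a :* (b :* :1)) P.refl (num r) (den r))
        ; distrib =
            (λ r s t → solve 6 (λ a b c d e f →
              (a :* (c :* f :+ e :* d)) :* ((b :* d) :* (b :* f)) :=
              ((a :* c) :* (b :* f) :+ (a :* e) :* (b :* d)) :* (b :* (d :* f))) P.refl
              (num r) (den r) (num s) (den s) (num t) (den t))
          , (λ r s t → solve 6 (λ a b c d e f →
              ((c :* f :+ e :* d) :* a) :* ((d :* b) :* (f :* b)) :=
              ((c :* a) :* (f :* b) :+ (e :* a) :* (d :* b)) :* ((d :* f) :* b)) P.refl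
              (num r) (den r) (num s) (den s) (num t) (den t))
        }
      ; *-comm = λ r s → solve 4 (λ a b c d → (a :* c) :* (d :* b) := (c :* a) :* (b :* d))
          P.refl (num r) (den r) (num s) (den s)
      }
    }

  module _ (j : Fin n) where

    open IsDerivation (∂Poly-isDerivation n j)

    private
      ∂ₚ = ∂Poly n j

    -- For a/b = f/c, the difference of the cross-multiplied quotient rules is a combination of ac -
    -- fb and of its derivative, which both vanish.
    ∂-cong : ∀ {r s} → r F.≈ s → ∂ j r F.≈ ∂ j s
    ∂-cong {r} {s} e = x-y≈0⇒x≈y _ _ (begin
      (∂ₚ a * b - a * ∂ₚ b) * (c * c) - (∂ₚ f * c - f * ∂ₚ c) * (b * b)
        ≈⟨ solve 8 (λ a b f c a′ b′ f′ c′ →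
             (a′ :* b :- a :* b′) :* (c :* c) :- (f′ :* c :- f :* c′) :* (b :* b) :=
             ((a′ :* c :+ a :* c′) :- (f′ :* b :+ f :* b′)) :* (b :* c) :-
             (a :* c :- f :* b) :* (c′ :* b :+ b′ :* c)) P.refl
             a b f c (∂ₚ a) (∂ₚ b) (∂ₚ f) (∂ₚ c) ⟩
      ((∂ₚ a * c + a * ∂ₚ c) - (∂ₚ f * b + f * ∂ₚ b)) * (b * c) - (a * c - f * b) * (∂ₚ c * b + ∂ₚ b * c)
        ≈⟨ P.+-cong
             (P.*-congʳ (x≈y⇒x-y≈0 (P.trans (P.sym (d-* a c)) (P.trans (d-cong e) (d-* f b)))))
             (P.-‿cong (P.*-congʳ (x≈y⇒x-y≈0 e))) ⟩
      0# * (b * c) - 0# * (∂ₚ c * b + ∂ₚ b * c)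
        ≈⟨ solve 2 (λ x y → :0 :* x :- :0 :* y := :0) P.refl (b * c) (∂ₚ c * b + ∂ₚ b * c) ⟩
      0# ∎)
      where
      a = num r
      b = den r
      f = num s
      c = den s

    ∂-+ : ∀ r s → ∂ j (r F.+ s) F.≈ ∂ j r F.+ ∂ j s
    ∂-+ r s = P.trans
      (P.*-congʳ (P.+-cong
        (P.*-congʳ (P.trans (d-+ _ _) (P.+-cong (d-* (num r) (den s)) (d-* (num s) (den r)))))
        (P.-‿cong (P.*-congˡ (d-* (den r) (den s))))))
      (solve 8 (λ a b c d a′ b′ c′ d′ →
        (((a′ :* d :+ a :* d′) :+ (c′ :* b :+ c :* b′)) :* (b :* d) :-
         (a :* d :+ c :* b) :* (b′ :* d :+ b :* d′)) :* ((b :* b) :* (d :* d)) :=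
        ((a′ :* b :- a :* b′) :* (d :* d) :+ (c′ :* d :- c :* d′) :* (b :* b)) :* ((b :* d) :* (b :* d)))
        P.refl (num r) (den r) (num s) (den s) (∂ₚ (num r)) (∂ₚ (den r)) (∂ₚ (num s)) (∂ₚ (den s)))

    ∂-* : ∀ r s → ∂ j (r F.* s) F.≈ ∂ j r F.* s F.+ r F.* ∂ j s
    ∂-* r s = P.trans
      (P.*-congʳ (P.+-cong
        (P.*-congʳ (d-* (num r) (num s)))
        (P.-‿cong (P.*-congˡ (d-* (den r) (den s))))))
      (solve 8 (λ a b c d a′ b′ c′ d′ →
        ((a′ :* c :+ a :* c′) :* (b :* d) :- (a :* c) :* (b′ :* d :+ b :* d′)) :*
          (((b :* b) :* d) :* (b :* (d :* d))) :=
        (((a′ :* b :- a :* b′) :* c) :* (b :* (d :* d)) :+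
         (a :* (c′ :* d :- c :* d′)) :* ((b :* b) :* d)) :* ((b :* d) :* (b :* d)))
        P.refl (num r) (den r) (num s) (den s) (∂ₚ (num r)) (∂ₚ (den r)) (∂ₚ (num s)) (∂ₚ (den s)))

    ∂-isDerivation : IsDerivation rationalFunctionRing (∂ j)
    ∂-isDerivation = record
      { d-cong = λ {r} {s} → ∂-cong {r} {s}
      ; d-+    = ∂-+
      ; d-*    = ∂-*
      }

-- Integers as rational functions

-- `ℚ./` normalises its fraction, so the comparison takes place among unnormalised fractions with
-- denominator 1.
/1-+ : ∀ a b → (a ℤ.+ b) ℚ./ 1 ≡ (a ℚ./ 1) ℚ.+ (b ℚ./ 1)
/1-+ a b = ℚ.toℚᵘ-injective (begin
  ℚ.toℚᵘ ((a ℤ.+ b) ℚ./ 1)                     ≈⟨ ℚ.toℚᵘ-fromℚᵘ (mkℚᵘ (a ℤ.+ b) 0) ⟩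
  mkℚᵘ (a ℤ.+ b) 0                             ≈⟨ *≡* (unitDenominators a b) ⟩
  mkℚᵘ a 0 ℚᵘ.+ mkℚᵘ b 0                       ≈⟨ ℚᵘ.+-cong (ℚ.toℚᵘ-fromℚᵘ (mkℚᵘ a 0)) (ℚ.toℚᵘ-fromℚᵘ (mkℚᵘ b 0)) ⟨
  ℚ.toℚᵘ (a ℚ./ 1) ℚᵘ.+ ℚ.toℚᵘ (b ℚ./ 1)       ≈⟨ ℚ.toℚᵘ-homo-+ (a ℚ./ 1) (b ℚ./ 1) ⟨
  ℚ.toℚᵘ ((a ℚ./ 1) ℚ.+ (b ℚ./ 1))             ∎)
  where
  open SetoidReasoning ℚᵘ.≃-setoid
  unitDenominators : ∀ a b → (a ℤ.+ b) ℤ.* 1ℤ ≡ (a ℤ.* 1ℤ ℤ.+ b ℤ.* 1ℤ) ℤ.* 1ℤ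
  unitDenominators = solve-∀

constantPoly-+ : ∀ n p q → let open CommutativeRing (polynomialRing n) in
                 constantPoly n (p ℚ.+ q) ≈ constantPoly n p + constantPoly n q
constantPoly-+ zero    p q = ≡.refl
constantPoly-+ (suc n) p q = U.∷-cong (constantPoly-+ n p q) U.≋-refl
  where module U = Univariate (polynomialDomain n)

constantPoly-1 : ∀ n → let open CommutativeRing (polynomialRing n) in constantPoly n 1ℚ ≈ 1#
constantPoly-1 zero    = ≡.refl
constantPoly-1 (suc n) = U.∷-cong (constantPoly-1 n) U.≋-refl
  where module U = Univariate (polynomialDomain n)

module _ (n : ℕ) where

  open CommutativeRing (polynomialRing n)
  open IntegerCoefficientSolver (polynomialRing n)
  private
    module F = RawRing (rationalFunctions n)

  fromℤ-+ : ∀ a b → fromℤ (a ℤ.+ b) F.≈ fromℤ a F.+ fromℤ b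
  fromℤ-+ a b = trans
    (*-congʳ (trans (reflexive (≡.cong (constantPoly n) (/1-+ a b))) (constantPoly-+ n _ _)))
    (solve 2 (λ x y → (x :+ y) :* (:1 :* :1) := (x :* :1 :+ y :* :1) :* :1) refl
      (constantPoly n (a ℚ./ 1)) (constantPoly n (b ℚ./ 1)))

  fromℤ-1 : fromℤ 1ℤ F.≈ F.1#
  fromℤ-1 = *-congʳ (constantPoly-1 n)

-- These two laws are what the argument uses of `fromℤ`; with them as an interface, the remaining
-- computations take place over an arbitrary commutative ring.
record IsAdditiveUnital (R : CommutativeRing 0ℓ 0ℓ) (f : ℤ → CommutativeRing.Carrier R) : Set where
  open CommutativeRing R hiding (zero)
  open RingProperties ring using (+-identityˡ-unique; +-inverseʳ-unique)
  field
    f-+ : ∀ a b → f (a ℤ.+ b) ≈ f a + f b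
    f-1 : f 1ℤ ≈ 1#

  f-0 : f 0ℤ ≈ 0#
  f-0 = +-identityˡ-unique _ _ (sym (f-+ 0ℤ 0ℤ))

  f-neg : ∀ a → f (ℤ.- a) ≈ - f a
  f-neg a = +-inverseʳ-unique _ _
    (trans (sym (f-+ a (ℤ.- a))) (trans (reflexive (≡.cong f (ℤ.+-inverseʳ a))) f-0))

  f-suc : ∀ k → f (+ suc k) ≈ 1# + f (+ k)
  f-suc k = trans (f-+ 1ℤ (+ k)) (+-congʳ f-1)

-- Units and logarithmic derivatives

module Units (R : CommutativeRing 0ℓ 0ℓ) where

  open CommutativeRing R hiding (zero)
  open IntegerCoefficientSolver R
  open SetoidReasoning setoid

  -- Invertibility is kept out of the record, so that operations on units agree
  -- propositionally with those on subtraction-free functions.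
  record Unit : Set where
    constructor _⁄_
    field
      value inverse : Carrier
  open Unit public

  Invertible : Unit → Set
  Invertible u = value u * inverse u ≈ 1#

  infix  9 _⁻¹
  infixr 8 _^_ _^ℤ_
  infixl 7 _⊗_

  _⊗_ : Unit → Unit → Unit
  u ⊗ v = (value u * value v) ⁄ (inverse u * inverse v)

  _⁻¹ : Unit → Unit
  u ⁻¹ = inverse u ⁄ value u

  _^_ : Unit → ℕ → Unit
  u ^ zero  = 1# ⁄ 1#
  u ^ suc k = u ⊗ u ^ k

  _^ℤ_ : Unit → ℤ → Unit
  u ^ℤ (+ k)    = u ^ k
  u ^ℤ -[1+ k ] = u ⁻¹ ^ suc k

  invertible-⁻¹ : ∀ {u} → Invertible u → Invertible (u ⁻¹)
  invertible-⁻¹ u-inv = trans (*-comm _ _) u-inv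

  invertible-⊗ : ∀ {u v} → Invertible u → Invertible v → Invertible (u ⊗ v)
  invertible-⊗ {u} {v} u-inv v-inv = begin
    (value u * value v) * (inverse u * inverse v)
      ≈⟨ solve 4 (λ a b c d → (a :* b) :* (c :* d) := (a :* c) :* (b :* d)) refl
           (value u) (value v) (inverse u) (inverse v) ⟩
    (value u * inverse u) * (value v * inverse v)   ≈⟨ *-cong u-inv v-inv ⟩
    1# * 1#                                         ≈⟨ *-identityˡ 1# ⟩
    1#                                              ∎

  invertible-^ : ∀ {u} k → Invertible u → Invertible (u ^ k)
  invertible-^ zero    u-inv = *-identityˡ 1#
  invertible-^ {u} (suc k) u-inv = invertible-⊗ {u} u-inv (invertible-^ k u-inv)

  invertible-^ℤ : ∀ {u} c → Invertible u → Invertible (u ^ℤ c)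
  invertible-^ℤ (+ k)        u-inv = invertible-^ k u-inv
  invertible-^ℤ {u} -[1+ k ] u-inv = invertible-^ (suc k) (invertible-⁻¹ {u} u-inv)

  ζ-sum : ∀ {u w} → Invertible w → value w ≈ value u + 1# → inverse w + value u * inverse w ≈ 1#
  ζ-sum {u} {w} w-inv w≈u+1 = begin
    inverse w + value u * inverse w
      ≈⟨ solve 2 (λ u w → w :+ u :* w := (u :+ :1) :* w) refl (value u) (inverse w) ⟩
    (value u + 1#) * inverse w     ≈⟨ *-congʳ w≈u+1 ⟨
    value w * inverse w            ≈⟨ w-inv ⟩
    1#                             ∎

module LogarithmicDerivative (R : CommutativeRing 0ℓ 0ℓ)
  {d : CommutativeRing.Carrier R → CommutativeRing.Carrier R} (d-isDerivation : IsDerivation R d)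
  {f : ℤ → CommutativeRing.Carrier R} (f-isAdditiveUnital : IsAdditiveUnital R f)
  (y : CommutativeRing.Carrier R) where

  open CommutativeRing R hiding (zero)
  open IsDerivation d-isDerivation
  open IsAdditiveUnital f-isAdditiveUnital
  open IntegerCoefficientSolver R
  open RingProperties ring using (+-inverseʳ-unique)
  open SetoidReasoning setoid

  open Units R

  -- This is y d log u. For u = μ_i, d = ∂/∂y_j and y = y_j it is the entry (i,j) of K.
  ℓ : Unit → Carrier
  ℓ u = inverse u * d (value u) * y

  ℓ-⊗ : ∀ {u v} → Invertible u → Invertible v → ℓ (u ⊗ v) ≈ ℓ u + ℓ v
  ℓ-⊗ {u} {v} u-inv v-inv = begin
    inverse u * inverse v * d (value u * value v) * y
      ≈⟨ *-congʳ (*-congˡ (d-* (value u) (value v))) ⟩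
    inverse u * inverse v * (d (value u) * value v + value u * d (value v)) * y
      ≈⟨ solve 7 (λ a b a′ b′ da db y → a′ :* b′ :* (da :* b :+ a :* db) :* y :=
           a′ :* da :* y :* (b :* b′) :+ b′ :* db :* y :* (a :* a′)) refl
           (value u) (value v) (inverse u) (inverse v) (d (value u)) (d (value v)) y ⟩
    ℓ u * (value v * inverse v) + ℓ v * (value u * inverse u)
      ≈⟨ +-cong (trans (*-congˡ v-inv) (*-identityʳ _)) (trans (*-congˡ u-inv) (*-identityʳ _)) ⟩
    ℓ u + ℓ v ∎

  ℓ-one : ℓ (1# ⁄ 1#) ≈ 0#
  ℓ-one = trans (*-congʳ (trans (*-congˡ d-1) (zeroʳ _))) (zeroˡ _)

  ℓ-⁻¹ : ∀ {u} → Invertible u → ℓ (u ⁻¹) ≈ - ℓ u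
  ℓ-⁻¹ {u} u-inv = +-inverseʳ-unique _ _ (begin
    inverse u * d (value u) * y + value u * d (inverse u) * y
      ≈⟨ solve 5 (λ a b da db y → b :* da :* y :+ a :* db :* y := (da :* b :+ a :* db) :* y) refl
           (value u) (inverse u) (d (value u)) (d (inverse u)) y ⟩
    (d (value u) * inverse u + value u * d (inverse u)) * y
      ≈⟨ *-congʳ (trans (sym (d-* (value u) (inverse u))) (trans (d-cong u-inv) d-1)) ⟩
    0# * y
      ≈⟨ zeroˡ y ⟩
    0# ∎)

  -- d log(u + 1) = u/(u + 1) d log u. The sum is given as a separate unit `w`, because u + 1 need
  -- not be invertible in a general ring.
  ℓ-+1 : ∀ {u w} → Invertible u → value w ≈ value u + 1# → ℓ w ≈ (value u * inverse w) * ℓ u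
  ℓ-+1 {u} {w} u-inv w≈u+1 = begin
    inverse w * d (value w) * y
      ≈⟨ *-congʳ (*-cong (sym (*-identityʳ _))
           (trans (d-cong w≈u+1) (trans (d-+ (value u) 1#) (trans (+-congˡ d-1) (+-identityʳ _))))) ⟩
    inverse w * 1# * d (value u) * y
      ≈⟨ *-congʳ (*-congʳ (*-congˡ u-inv)) ⟨
    inverse w * (value u * inverse u) * d (value u) * y
      ≈⟨ solve 5 (λ w u u′ du y → w :* (u :* u′) :* du :* y := (u :* w) :* (u′ :* du :* y)) refl
           (inverse w) (value u) (inverse u) (d (value u)) y ⟩
    (value u * inverse w) * ℓ u ∎

  ℓ-^ : ∀ {u} k → Invertible u → ℓ (u ^ k) ≈ f (+ k) * ℓ u
  ℓ-^ zero            u-inv = trans ℓ-one (sym (trans (*-congʳ f-0) (zeroˡ _)))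
  ℓ-^ {u} (suc k) u-inv = begin
    ℓ (u ⊗ u ^ k)             ≈⟨ ℓ-⊗ {u} u-inv (invertible-^ k u-inv) ⟩
    ℓ u + ℓ (u ^ k)           ≈⟨ +-cong (sym (*-identityˡ _)) (ℓ-^ k u-inv) ⟩
    1# * ℓ u + f (+ k) * ℓ u  ≈⟨ distribʳ _ _ _ ⟨
    (1# + f (+ k)) * ℓ u      ≈⟨ *-congʳ (f-suc k) ⟨
    f (+ suc k) * ℓ u         ∎

  ℓ-^ℤ : ∀ {u} c → Invertible u → ℓ (u ^ℤ c) ≈ f c * ℓ u
  ℓ-^ℤ (+ k)    u-inv = ℓ-^ k u-inv
  ℓ-^ℤ {u} -[1+ k ] u-inv = begin
    ℓ (u ⁻¹ ^ suc k)         ≈⟨ ℓ-^ (suc k) (invertible-⁻¹ {u} u-inv) ⟩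
    f (+ suc k) * ℓ (u ⁻¹)   ≈⟨ *-congˡ (ℓ-⁻¹ u-inv) ⟩
    f (+ suc k) * - ℓ u      ≈⟨ solve 2 (λ a b → a :* :- b := :- a :* b) refl _ _ ⟩
    - f (+ suc k) * ℓ u      ≈⟨ *-congʳ (f-neg (+ suc k)) ⟨
    f -[1+ k ] * ℓ u         ∎

  module _ {u v w w′ : Unit} (u-inv : Invertible u) (v-inv : Invertible v)
    (w-inv : Invertible w) (w′-inv : Invertible w′)
    (w≈v+1 : value w ≈ value v + 1#) (w′≈v⁻¹+1 : value w′ ≈ inverse v + 1#) where

    private
      ζ₋ ζ₊ : Carrier
      ζ₋ = inverse w
      ζ₊ = value v * inverse w

      coefficient : ℤ → Carrier
      coefficient b = f (+ positivePart b) * ζ₋ + f (+ positivePart (ℤ.- b)) * ζ₊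

      -- This is (1/v)/(1/v + 1) = 1/(v + 1): inverting v exchanges z₊ and z₋.
      ζ₋-dual : inverse v * inverse w′ ≈ ζ₋
      ζ₋-dual = begin
        inverse v * inverse w′
          ≈⟨ trans (sym (*-identityʳ _)) (*-congˡ (sym w-inv)) ⟩
        inverse v * inverse w′ * (value w * inverse w)
          ≈⟨ *-congˡ (*-congʳ w≈v+1) ⟩
        inverse v * inverse w′ * ((value v + 1#) * inverse w)
          ≈⟨ solve 4 (λ v v′ w w′ → v′ :* w′ :* ((v :+ :1) :* w) := w′ :* w :* (v :* v′ :+ v′)) refl
               (value v) (inverse v) (inverse w) (inverse w′) ⟩
        inverse w′ * inverse w * (value v * inverse v + inverse v)
          ≈⟨ *-congˡ (trans (+-congʳ v-inv) (trans (+-comm _ _) (sym w′≈v⁻¹+1))) ⟩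
        inverse w′ * inverse w * value w′
          ≈⟨ solve 3 (λ a b c → a :* b :* c := (c :* a) :* b) refl _ _ _ ⟩
        (value w′ * inverse w′) * inverse w
          ≈⟨ trans (*-congʳ w′-inv) (*-identityˡ _) ⟩
        inverse w ∎

      positivePart-neg : ∀ k → positivePart (ℤ.- + k) ≡ 0
      positivePart-neg zero    = ≡.refl
      positivePart-neg (suc k) = ≡.refl

    -- Two signs cancel, that of the exponent and that of d log(1/v) = - d log v, and `ζ₋-dual`
    -- supplies the factor. In `ℓ-mutation⁻` both signs are absent and the factor is z₊.
    ℓ-mutation⁺ : ∀ k → ℓ (u ⊗ w′ ^ℤ (ℤ.- + k)) ≈ ℓ u + coefficient (+ k) * ℓ v
    ℓ-mutation⁺ k = begin
      ℓ (u ⊗ w′ ^ℤ (ℤ.- + k))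
        ≈⟨ ℓ-⊗ {u} u-inv (invertible-^ℤ {w′} (ℤ.- + k) w′-inv) ⟩
      ℓ u + ℓ (w′ ^ℤ (ℤ.- + k))
        ≈⟨ +-congˡ (trans (ℓ-^ℤ {w′} (ℤ.- + k) w′-inv) (*-cong (f-neg (+ k))
             (trans (ℓ-+1 {v ⁻¹} {w′} (invertible-⁻¹ {v} v-inv) w′≈v⁻¹+1) (*-cong ζ₋-dual (ℓ-⁻¹ v-inv))))) ⟩
      ℓ u + - f (+ k) * (ζ₋ * - ℓ v)
        ≈⟨ solve 5 (λ u a z ζ₊ l → u :+ :- a :* (z :* :- l) := u :+ (a :* z :+ :0 :* ζ₊) :* l) refl
             (ℓ u) (f (+ k)) ζ₋ ζ₊ (ℓ v) ⟩
      ℓ u + (f (+ k) * ζ₋ + 0# * ζ₊) * ℓ v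
        ≈⟨ +-congˡ (*-congʳ (+-congˡ (*-congʳ (trans (reflexive (≡.cong (λ k → f (+ k)) (positivePart-neg k))) f-0)))) ⟨
      ℓ u + coefficient (+ k) * ℓ v ∎

    ℓ-mutation⁻ : ∀ k → ℓ (u ⊗ w ^ℤ (+ suc k)) ≈ ℓ u + coefficient -[1+ k ] * ℓ v
    ℓ-mutation⁻ k = begin
      ℓ (u ⊗ w ^ suc k)
        ≈⟨ ℓ-⊗ {u} u-inv (invertible-^ (suc k) w-inv) ⟩
      ℓ u + ℓ (w ^ suc k)
        ≈⟨ +-congˡ (trans (ℓ-^ (suc k) w-inv) (*-congˡ (ℓ-+1 {v} {w} v-inv w≈v+1))) ⟩
      ℓ u + f (+ suc k) * (ζ₊ * ℓ v)
        ≈⟨ solve 5 (λ u a z ζ₊ l → u :+ a :* (ζ₊ :* l) := u :+ (:0 :* z :+ a :* ζ₊) :* l) refl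
             (ℓ u) (f (+ suc k)) ζ₋ ζ₊ (ℓ v) ⟩
      ℓ u + (0# * ζ₋ + f (+ suc k) * ζ₊) * ℓ v
        ≈⟨ +-congˡ (*-congʳ (+-congʳ (*-congʳ f-0))) ⟨
      ℓ u + coefficient -[1+ k ] * ℓ v ∎

-- The Neumann-Zagier matrix as the eliminated system

-- At the mutated index this says that the summand i = m_t contributes no arrows, only broken edges.
SkewSymmetrizable-diagonal : ∀ {n} {B : Matrix ℤ n n} → SkewSymmetrizable B → ∀ i → B i i ≡ 0ℤ
SkewSymmetrizable-diagonal {B = B} (d , d>0 , skew) i with ℤ.i*j≡0⇒i≡0∨j≡0 (+ d i) (self-negative (skew i i))
  where
  self-negative : ∀ {x} → x ≡ ℤ.- x → x ≡ 0ℤ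
  self-negative {+ zero} e = ≡.refl
... | inj₁ d≡0 = contradiction (ℤ.+-injective d≡0) (ℕ.>⇒≢ (d>0 i))
... | inj₂ B≡0 = B≡0

module NetworkDeterminant (R : CommutativeRing 0ℓ 0ℓ) {n T : ℕ} (γ : MutationSequence n T)
  {f : ℤ → CommutativeRing.Carrier R} (f-isAdditiveUnital : IsAdditiveUnital R f)
  (ζ₋ ζ₊ : Fin T → CommutativeRing.Carrier R) where

  open CommutativeRing R hiding (zero)
  open MatrixOperations rawRing
  open Determinant R
  open IsAdditiveUnital f-isAdditiveUnital
  open IntegerCoefficientSolver R
  open SetoidReasoning setoid
  open MutationSequence γ
  open RawSemiringDefinitions ℕ.+-*-rawSemiring using () renaming (sum to sumℕ)

  coefficient : Fin T → Fin n → Carrier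
  coefficient t i = f (+ positivePart (B⟨_⟩ γ (inject₁ t) (m t) i)) * ζ₋ t +
                    f (+ positivePart (ℤ.- B⟨_⟩ γ (inject₁ t) (m t) i)) * ζ₊ t

  private
    -- The value `- 1#` is the logarithmic form of the replacement of Y_k by its inverse.
    b : Fin T → Fin n → Carrier
    b t i = if does (i Fin.≟ m t) then - 1# else coefficient t i

    indicator : Bool → Carrier
    indicator a = if a then 1# else 0#

    ⟦_∼_⟧ : Ē γ → Ē γ → Carrier
    ⟦ x ∼ y ⟧ = indicator (does (_∼?_ γ x y))

    ⟦∼⟧-cong : ∀ {x y x′ y′} → (_∼_ γ x y → _∼_ γ x′ y′) → (_∼_ γ x′ y′ → _∼_ γ x y) → ⟦ x ∼ y ⟧ ≡ ⟦ x′ ∼ y′ ⟧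
    ⟦∼⟧-cong {x} {y} {x′} {y′} to from = ≡.cong indicator (does-⇔ (mk⇔ to from) (_∼?_ γ x y) (_∼?_ γ x′ y′))

    f-δ : ∀ x y k → f (+ (δ γ x y ℕ.* k)) ≈ ⟦ x ∼ y ⟧ * f (+ k)
    f-δ x y k with does (_∼?_ γ x y)
    ... | true  = trans (reflexive (≡.cong (λ k → f (+ k)) (ℕ.+-identityʳ k))) (sym (*-identityˡ _))
    ... | false = trans f-0 (sym (zeroˡ _))

    f-δ′ : ∀ x y → f (+ δ γ x y) ≈ ⟦ x ∼ y ⟧
    f-δ′ x y with does (_∼?_ γ x y)
    ... | true  = f-1
    ... | false = f-0

    f-sum : ∀ {l} (g : Fin l → ℕ) → f (+ sumℕ g) ≈ ∑ λ i → f (+ g i)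
    f-sum {zero}  g = trans f-0 (sym (∑-empty _))
    f-sum {suc l} g = trans (f-+ (+ g zero) _) (trans (+-congˡ (f-sum (g ∘ suc))) (sym (∑-suc _)))

    vertex : Fin T → Ē γ
    vertex t = m t , inject₁ t

    output : Fin T → Fin n → Ē γ
    output t i = σ t ⟨$⟩ʳ i , suc t

    f-A : ∀ s t (g : Fin n → ℕ) →
      f (+ N₀ γ (vertex s) t ℤ.- + sumℕ (λ i → δ γ (vertex s) (i , inject₁ t) ℕ.* g i)) ≈
      (⟦ vertex s ∼ vertex t ⟧ + ⟦ vertex s ∼ output t (m t) ⟧) -
      ∑ λ i → ⟦ vertex s ∼ (i , inject₁ t) ⟧ * f (+ g i)
    f-A s t g = trans (f-+ (+ N₀ γ (vertex s) t) _) (+-cong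
      (trans (f-+ (+ δ γ (vertex s) (vertex t)) _) (+-cong (f-δ′ _ _) (f-δ′ _ _)))
      (trans (f-neg _) (-‿cong (trans (f-sum _) (∑-cong λ i → f-δ _ _ (g i))))))

    coefficient-vertex : ∀ t → coefficient t (m t) ≈ 0#
    coefficient-vertex t
      rewrite SkewSymmetrizable-diagonal (YSeed.skewSymmetrizable (seed γ (inject₁ t))) (m t) =
      trans (+-cong (trans (*-congʳ f-0) (zeroˡ _)) (trans (*-congʳ f-0) (zeroˡ _))) (+-identityˡ _)

    -- For i ≠ m_t the vertices before and after the step are identified, so incidence can be tested
    -- before it, where the arrows are attached. The exceptional index yields the second broken
    -- edge, with a minus sign.
    output-∼ : ∀ s t i →
      ⟦ vertex s ∼ output t i ⟧ * b t i ≈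
      ⟦ vertex s ∼ (i , inject₁ t) ⟧ * coefficient t i + - ⟦ vertex s ∼ output t (m t) ⟧ * I n i (m t)
    output-∼ s t i with i Fin.≟ m t
    ... | yes ≡.refl = begin
      ⟦ vertex s ∼ output t i ⟧ * - 1#
        ≈⟨ solve 2 (λ h g → h :* :- :1 := g :* :0 :+ :- h :* :1) refl _ _ ⟩
      ⟦ vertex s ∼ vertex t ⟧ * 0# + - ⟦ vertex s ∼ output t i ⟧ * 1#
        -- The arrow term is inserted at i = m_t too, where it is zero, so that the sum over i
        -- becomes uniform.
        ≈⟨ +-congʳ (*-congˡ (coefficient-vertex t)) ⟨
      ⟦ vertex s ∼ vertex t ⟧ * coefficient t i + - ⟦ vertex s ∼ output t i ⟧ * 1# ∎
    ... | no i≢m = begin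
      ⟦ vertex s ∼ output t i ⟧ * coefficient t i
        ≈⟨ *-congʳ (reflexive (⟦∼⟧-cong (λ e → E.trans e (E.sym r)) (λ e → E.trans e r))) ⟩
      ⟦ vertex s ∼ (i , inject₁ t) ⟧ * coefficient t i
        ≈⟨ trans (sym (+-identityʳ _)) (+-congˡ (sym (zeroʳ _))) ⟩
      ⟦ vertex s ∼ (i , inject₁ t) ⟧ * coefficient t i + - ⟦ vertex s ∼ output t (m t) ⟧ * 0# ∎
      where
      module E = IsEquivalence (Eq.isEquivalence (_∼₁_ γ))
      r : _∼_ γ (i , inject₁ t) (output t i)
      r = Eq.return (step t i≢m)

  -- Distinct final vertices are inequivalent, so the identity matrix counts the first broken edge
  -- `g`; the entry -1 of `b` gives the second, `h`. Multiplying g + h by z₋ + z₊ = 1 gives each of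
  -- the two arrow sums its copy of `N₀`.
  neumannZagier : FullyMutated γ → (∀ t → ζ₋ t + ζ₊ t ≈ 1#) → ∀ s t →
    I T s t - ∑ (λ i → ⟦ vertex s ∼ output t i ⟧ * b t i) ≈
    ((λ s t → f (A₊ γ s t)) ⊡ diag ζ₋ ⊞ (λ s t → f (A₋ γ s t)) ⊡ diag ζ₊) s t
  neumannZagier fullyMutated ζ-sum s t = begin
    I T s t - ∑ (λ i → ⟦ vertex s ∼ output t i ⟧ * b t i)
      ≈⟨ +-cong (reflexive (≡.cong indicator (does-⇔ (mk⇔ (λ { ≡.refl → E.refl }) (final-injective-∼ fullyMutated))
           (s Fin.≟ t) (_∼?_ γ (vertex s) (vertex t)))))
           (-‿cong (trans (∑-cong (output-∼ s t)) (trans (∑-+ _ _) (+-congˡ (∑-I (λ _ → - h) (m t)))))) ⟩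
    g - (∑ (λ i → G i * coefficient t i) + - h)
      ≈⟨ +-congˡ (-‿cong (+-congʳ (trans
           (∑-cong λ i → solve 5 (λ G p z q w → G :* (p :* z :+ q :* w) := (G :* p) :* z :+ (G :* q) :* w) refl
             (G i) (f (+ positivePart (B′ i))) (ζ₋ t) (f (+ positivePart (ℤ.- B′ i))) (ζ₊ t))
           (trans (∑-+ _ _) (+-cong (sym (∑-* _ _)) (sym (∑-* _ _))))))) ⟩
    g - ((S₊ * ζ₋ t + S₋ * ζ₊ t) + - h)
      ≈⟨ solve 4 (λ g x y h → g :- ((x :+ y) :+ :- h) := (g :+ h) :* :1 :- (x :+ y)) refl g (S₊ * ζ₋ t) (S₋ * ζ₊ t) h ⟩
    (g + h) * 1# - (S₊ * ζ₋ t + S₋ * ζ₊ t)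
      ≈⟨ +-congʳ (*-congˡ (ζ-sum t)) ⟨
    (g + h) * (ζ₋ t + ζ₊ t) - (S₊ * ζ₋ t + S₋ * ζ₊ t)
      ≈⟨ solve 5 (λ g z w x y → g :* (z :+ w) :- (x :* z :+ y :* w) := (g :- x) :* z :+ (g :- y) :* w) refl
           (g + h) (ζ₋ t) (ζ₊ t) S₊ S₋ ⟩
    ((g + h) - S₊) * ζ₋ t + ((g + h) - S₋) * ζ₊ t
      ≈⟨ +-cong (*-congʳ (f-A s t _)) (*-congʳ (f-A s t _)) ⟨
    f (A₊ γ s t) * ζ₋ t + f (A₋ γ s t) * ζ₊ t
      ≈⟨ +-cong (⊡-diag (λ s t → f (A₊ γ s t)) ζ₋ s t) (⊡-diag (λ s t → f (A₋ γ s t)) ζ₊ s t) ⟨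
    ((λ s t → f (A₊ γ s t)) ⊡ diag ζ₋ ⊞ (λ s t → f (A₋ γ s t)) ⊡ diag ζ₊) s t ∎
    where
    open Paths.FullyMutatedPaths γ
    module E = IsEquivalence (Eq.isEquivalence (_∼₁_ γ))
    B′ : Fin n → ℤ
    B′ = B⟨_⟩ γ (inject₁ t) (m t)
    g h S₊ S₋ : Carrier
    g = ⟦ vertex s ∼ vertex t ⟧
    h = ⟦ vertex s ∼ output t (m t) ⟧
    G : Fin n → Carrier
    G i = ⟦ vertex s ∼ (i , inject₁ t) ⟧
    S₊ = ∑ λ i → G i * f (+ positivePart (B′ i))
    S₋ = ∑ λ i → G i * f (+ positivePart (ℤ.- B′ i))

  det-network : FullyMutated γ → (∀ t → ζ₋ t + ζ₊ t ≈ 1#) →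
    (L : Fin (suc T) → Matrix Carrier n n) →
    (∀ i k → L zero i k ≈ I n i k) →
    (∀ t i k → σ t ⟨$⟩ˡ i ≡ m t → L (suc t) i k ≈ - L (inject₁ t) (m t) k) →
    (∀ t i k → σ t ⟨$⟩ˡ i ≢ m t → L (suc t) i k ≈
      L (inject₁ t) (σ t ⟨$⟩ˡ i) k + coefficient t (σ t ⟨$⟩ˡ i) * L (inject₁ t) (m t) k) →
    det (I n ⊟ L (fromℕ T)) ≈ det ((λ s t → f (A₊ γ s t)) ⊡ diag ζ₋ ⊞ (λ s t → f (A₋ γ s t)) ⊡ diag ζ₊)
  det-network fullyMutated ζ-sum L L-zero L-≡ L-≢ = begin
    det (I n ⊟ L (fromℕ T))                ≡⟨ Det-unfold _ ⟨
    Det (I n ⊟ L (fromℕ T))                ≈⟨ systemDet-transfer L L-zero L-suc ⟨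
    systemDet enumeration                  ≈⟨ systemDet-network fullyMutated ⟩
    Det (λ s t → I T s t - ∑ λ i → ⟦ vertex s ∼ output t i ⟧ * b t i)
                                           ≈⟨ Det-cong (neumannZagier fullyMutated ζ-sum) ⟩
    Det ((λ s t → f (A₊ γ s t)) ⊡ diag ζ₋ ⊞ (λ s t → f (A₋ γ s t)) ⊡ diag ζ₊)
                                           ≡⟨ Det-unfold _ ⟩
    det ((λ s t → f (A₊ γ s t)) ⊡ diag ζ₋ ⊞ (λ s t → f (A₋ γ s t)) ⊡ diag ζ₊) ∎
    where
    open NetworkSystem R γ b
    open SparseSystem _≟_ α β p q
    L-suc : ∀ t i k → let j = σ t ⟨$⟩ˡ i in
      L (suc t) i k ≈ (if does (j Fin.≟ m t) then 0# else 1#) * L (inject₁ t) j k + b t j * L (inject₁ t) (m t) k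
    L-suc t i k with σ t ⟨$⟩ˡ i Fin.≟ m t
    ... | yes j≡m = trans (L-≡ t i k j≡m)
      (solve 2 (λ x y → :- x := :0 :* y :+ :- :1 :* x) refl _ _)
    ... | no j≢m  = trans (L-≢ t i k j≢m) (+-congʳ (sym (*-identityˡ _)))

-- Logarithmic derivatives along a mutation sequence

mutateY-≡ : ∀ {n} (k : Fin n) B Y → mutateY k B Y k ≡ Y k SF.⁻¹
mutateY-≡ k B Y rewrite dec-true (k Fin.≟ k) ≡.refl = ≡.refl

mutateY-⁺ : ∀ {n} (k : Fin n) B Y {i} x → i ≢ k → B k i ≡ + x →
            mutateY k B Y i ≡ Y i SF.* (Y k SF.⁻¹ SF.+ SF.1#) SF.^ℤ (ℤ.- + x)
mutateY-⁺ k B Y {i} x i≢k e rewrite dec-false (i Fin.≟ k) i≢k | e = ≡.refl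

mutateY-⁻ : ∀ {n} (k : Fin n) B Y {i} x → i ≢ k → B k i ≡ -[1+ x ] →
            mutateY k B Y i ≡ Y i SF.* (Y k SF.+ SF.1#) SF.^ℤ (+ suc x)
mutateY-⁻ k B Y {i} x i≢k e rewrite dec-false (i Fin.≟ k) i≢k | e = ≡.refl

fromℤ-isAdditiveUnital : ∀ n → IsAdditiveUnital (rationalFunctionRing n) fromℤ
fromℤ-isAdditiveUnital n = record { f-+ = fromℤ-+ n ; f-1 = fromℤ-1 n }

module _ {n : ℕ} where

  open CommutativeRing (rationalFunctionRing n) using (_≈_; _+_; _*_; -_; 0#; 1#)
  open Units (rationalFunctionRing n) hiding (_⁻¹; _^_; _^ℤ_)
  private
    module P = CommutativeRing (polynomialRing n)
    module U = Units (rationalFunctionRing n)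
    module L (k : Fin n) = LogarithmicDerivative (rationalFunctionRing n)
      (∂-isDerivation n k) (fromℤ-isAdditiveUnital n) (variableRF k)
    open IntegerCoefficientSolver (polynomialRing n)
    open SubtractionFree

  unit : SubtractionFree n → Unit
  unit r = toRationalFunction r ⁄ toRationalFunction (r SF.⁻¹)

  unit-invertible : ∀ r → Invertible (unit r)
  unit-invertible r = solve 2 (λ a b → (a :* b) :* :1 := :1 :* (b :* a)) P.refl (num r) (den r)

  unit-^ : ∀ r k → unit (r SF.^ k) ≡ unit r U.^ k
  unit-^ r zero    = ≡.refl
  unit-^ r (suc k) = ≡.cong (unit r ⊗_) (unit-^ r k)

  unit-^ℤ : ∀ r c → unit (r SF.^ℤ c) ≡ unit r U.^ℤ c
  unit-^ℤ r (+ k)    = unit-^ r k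
  unit-^ℤ r -[1+ k ] = unit-^ (r SF.⁻¹) (suc k)

  logDerivative : Fin n → SubtractionFree n → RationalFunction n
  logDerivative k r = L.ℓ k (unit r)

  logDerivative-variable : ∀ i k → logDerivative k (SF.var i) ≈ MatrixOperations.I (rationalFunctions n) n i k
  logDerivative-variable i k = go (i Fin.≟ k)
    where
    open IsDerivation (∂Poly-isDerivation n k) using (d-1)
    v : Fin n → Polynomial n
    v = variablePoly n
    I : Matrix (RationalFunction n) n n
    I = MatrixOperations.I (rationalFunctions n) n
    I-diagonal : ∀ i → I i i ≡ 1#
    I-diagonal i rewrite dec-true (i Fin.≟ i) ≡.refl = ≡.refl
    I-off-diagonal : i ≢ k → I i k ≡ 0#
    I-off-diagonal i≢k rewrite dec-false (i Fin.≟ k) i≢k = ≡.refl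
    go : Dec (i ≡ k) → logDerivative k (SF.var i) ≈ I i k
    go (yes ≡.refl) = ≡.subst (logDerivative i (SF.var i) ≈_) (≡.sym (I-diagonal i)) (P.trans
      (P.*-congʳ (P.*-congʳ (P.*-congˡ (P.+-cong (P.*-congʳ (∂Poly-variable n i)) (P.-‿cong (P.*-congˡ d-1))))))
      (solve 1 (λ v → ((:1 :* (:1 :* :1 :- v :* :0)) :* v) :* :1 := :1 :* ((v :* (:1 :* :1)) :* :1)) P.refl (v i)))
    go (no i≢k) = ≡.subst (logDerivative k (SF.var i) ≈_) (≡.sym (I-off-diagonal i≢k)) (P.trans
      (P.*-congʳ (P.*-congʳ (P.*-congˡ (P.+-cong (P.*-congʳ (∂Poly-variable-≢ n λ e → i≢k (≡.sym e)))
        (P.-‿cong (P.*-congˡ d-1))))))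
      (solve 2 (λ v w → ((:1 :* (:0 :* :1 :- v :* :0)) :* w) :* :1 := :0 :* ((v :* (:1 :* :1)) :* :1)) P.refl (v i) (v k)))

  logDerivative-mutateY-≡ : ∀ l k B Y → logDerivative l (mutateY k B Y k) ≈ - logDerivative l (Y k)
  logDerivative-mutateY-≡ l k B Y =
    ≡.subst (λ r → logDerivative l r ≈ - logDerivative l (Y k)) (≡.sym (mutateY-≡ k B Y))
      (L.ℓ-⁻¹ l {unit (Y k)} (unit-invertible (Y k)))

  -- One formula covers both branches of `mutateY`: at most one of the two positive parts is
  -- nonzero, and it selects z₋ or z₊.
  logDerivative-mutateY-≢ : ∀ l k (B : Matrix ℤ n n) Y i → i ≢ k →
    logDerivative l (mutateY k B Y i) ≈ logDerivative l (Y i) +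
      (fromℤ (+ positivePart (B k i)) * toRationalFunction ((Y k SF.+ SF.1#) SF.⁻¹) +
       fromℤ (+ positivePart (ℤ.- B k i)) * toRationalFunction (Y k SF.* (Y k SF.+ SF.1#) SF.⁻¹)) *
      logDerivative l (Y k)
  logDerivative-mutateY-≢ l k B Y i i≢k = go (B k i) ≡.refl
    where
    w w′ : SubtractionFree n
    w  = Y k SF.+ SF.1#
    w′ = Y k SF.⁻¹ SF.+ SF.1#
    mutated : ℤ → RationalFunction n
    mutated c = logDerivative l (Y i) +
      (fromℤ (+ positivePart c) * toRationalFunction (w SF.⁻¹) +
       fromℤ (+ positivePart (ℤ.- c)) * toRationalFunction (Y k SF.* w SF.⁻¹)) * logDerivative l (Y k)
    unit-mutateY : ∀ r c → mutateY k B Y i ≡ Y i SF.* r SF.^ℤ c →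
                   unit (Y i) ⊗ unit r U.^ℤ c ≡ unit (mutateY k B Y i)
    unit-mutateY r c e = ≡.trans (≡.cong (unit (Y i) ⊗_) (≡.sym (unit-^ℤ r c))) (≡.cong unit (≡.sym e))
    go : ∀ c → B k i ≡ c → logDerivative l (mutateY k B Y i) ≈ mutated c
    go (+ x) e = ≡.subst (λ u → L.ℓ l u ≈ mutated (+ x))
      (unit-mutateY w′ (ℤ.- + x) (mutateY-⁺ k B Y x i≢k e))
      (L.ℓ-mutation⁺ l {unit (Y i)} {unit (Y k)} {unit w} {unit w′}
        (unit-invertible (Y i)) (unit-invertible (Y k)) (unit-invertible w) (unit-invertible w′) P.refl P.refl x)
    go -[1+ x ] e = ≡.subst (λ u → L.ℓ l u ≈ mutated -[1+ x ])
      (unit-mutateY w (+ suc x) (mutateY-⁻ k B Y x i≢k e))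
      (L.ℓ-mutation⁻ l {unit (Y i)} {unit (Y k)} {unit w} {unit w′}
        (unit-invertible (Y i)) (unit-invertible (Y k)) (unit-invertible w) (unit-invertible w′) P.refl P.refl x)

module _ {n T : ℕ} (γ : MutationSequence n T) where

  open MutationSequence γ
  open CommutativeRing (rationalFunctionRing n) using (_≈_; _+_; _*_; -_; 1#)
  private
    ζ₋ ζ₊ : Fin T → RationalFunction n
    ζ₋ t = toRationalFunction (z₋ γ t)
    ζ₊ t = toRationalFunction (z₊ γ t)

  open NetworkDeterminant (rationalFunctionRing n) γ (fromℤ-isAdditiveUnital n) ζ₋ ζ₊

  -- The matrix y_k ∂ log Y_i(t)/∂y_k, which interpolates between I at time 0 and K at time T.
  Λ : Fin (suc T) → Matrix (RationalFunction n) n n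
  Λ t i k = logDerivative k (Y⟨_⟩ γ t i)

  Y-suc : ∀ t i → Y⟨_⟩ γ (suc t) i ≡
          mutateY (m t) (B⟨_⟩ γ (inject₁ t)) (Y⟨_⟩ γ (inject₁ t)) (σ t ⟨$⟩ˡ i)
  Y-suc t i = ≡.cong (λ S → YSeed.Y S i) (trajectory-suc m σ _ t)

  Λ-≡ : ∀ t i k → σ t ⟨$⟩ˡ i ≡ m t → Λ (suc t) i k ≈ - Λ (inject₁ t) (m t) k
  Λ-≡ t i k j≡m = ≡.subst (λ r → logDerivative k r ≈ - Λ (inject₁ t) (m t) k)
    (≡.sym (≡.trans (Y-suc t i) (≡.cong (mutateY (m t) (B⟨_⟩ γ (inject₁ t)) (Y⟨_⟩ γ (inject₁ t))) j≡m)))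
    (logDerivative-mutateY-≡ k (m t) (B⟨_⟩ γ (inject₁ t)) (Y⟨_⟩ γ (inject₁ t)))

  Λ-≢ : ∀ t i k → σ t ⟨$⟩ˡ i ≢ m t → Λ (suc t) i k ≈
        Λ (inject₁ t) (σ t ⟨$⟩ˡ i) k + coefficient t (σ t ⟨$⟩ˡ i) * Λ (inject₁ t) (m t) k
  Λ-≢ t i k j≢m = ≡.subst (λ r → logDerivative k r ≈ Λ (inject₁ t) (σ t ⟨$⟩ˡ i) k +
                            coefficient t (σ t ⟨$⟩ˡ i) * Λ (inject₁ t) (m t) k)
    (≡.sym (Y-suc t i))
    (logDerivative-mutateY-≢ k (m t) (B⟨_⟩ γ (inject₁ t)) (Y⟨_⟩ γ (inject₁ t)) (σ t ⟨$⟩ˡ i) j≢m)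

  ζ-sum : ∀ t → ζ₋ t + ζ₊ t ≈ 1#
  ζ-sum t = U.ζ-sum {unit y} {unit (y SF.+ SF.1#)} (unit-invertible (y SF.+ SF.1#)) P.refl
    where
    module U = Units (rationalFunctionRing n)
    module P = CommutativeRing (polynomialRing n)
    y = Y⟨_⟩ γ (inject₁ t) (m t)

  open MatrixOperations (rationalFunctions n)

  -- Each diagonal factor collapses its sum to one term, and what is left is the definition of the
  -- logarithmic derivative.
  K≈Λ : ∀ i j → K γ i j ≈ Λ (fromℕ T) i j
  K≈Λ i j = F.trans
    {K γ i j} {(diag μ⁻¹ ⊡ J γ) i j * variableRF j} {Λ (fromℕ T) i j}
    (⊡-diag (diag μ⁻¹ ⊡ J γ) variableRF i j)
    (F.*-congʳ {variableRF j} {(diag μ⁻¹ ⊡ J γ) i j} {μ⁻¹ i * J γ i j} (diag-⊡ (J γ) μ⁻¹ i j))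
    where
    module F = CommutativeRing (rationalFunctionRing n)
    open Determinant (rationalFunctionRing n) using (⊡-diag; diag-⊡)
    μ⁻¹ : Fin n → RationalFunction n
    μ⁻¹ i = toRationalFunction (clusterTransformation γ i SF.⁻¹)

theorem1p1 : ∀ (n T : ℕ) → 1 ≤ n → 1 ≤ T → (γ : MutationSequence n T) → FullyMutated γ →
    let open RawRing (rationalFunctions n) using (_≈_)
        open MatrixOperations (rationalFunctions n) in
    det (I n ⊟ K γ) ≈ det (fromℤMatrix (A₊ γ) ⊡ Z₋ γ ⊞ fromℤMatrix (A₋ γ) ⊡ Z₊ γ)
theorem1p1 n T _ _ γ fullyMutated = F.trans
  {det (I n ⊟ K γ)} {det (I n ⊟ Λ γ (fromℕ T))} {det (fromℤMatrix (A₊ γ) ⊡ Z₋ γ ⊞ fromℤMatrix (A₋ γ) ⊡ Z₊ γ)}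
  (det-cong {M = I n ⊟ K γ} {I n ⊟ Λ γ (fromℕ T)} λ i j →
    F.+-congˡ {I n i j} {F.- K γ i j} {F.- Λ γ (fromℕ T) i j}
      (F.-‿cong {K γ i j} {Λ γ (fromℕ T) i j} (K≈Λ γ i j)))
  (det-network fullyMutated (ζ-sum γ) (Λ γ) logDerivative-variable (Λ-≡ γ) (Λ-≢ γ))
  where
  module F = CommutativeRing (rationalFunctionRing n)
  open MatrixOperations (rationalFunctions n)
  open Determinant (rationalFunctionRing n) using (det-cong)
  open NetworkDeterminant (rationalFunctionRing n) γ (fromℤ-isAdditiveUnital n)
    (λ t → toRationalFunction (z₋ γ t)) (λ t → toRationalFunction (z₊ γ t))
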